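{- Let $M\subseteq\{\Box,\Diamond,\wedge,\vee,\overline{\cdot},\top,\bot,\mathrm{dep},\veebar\}$ with $\{\Box,\Diamond,\wedge,\overline{\cdot},\mathrm{dep}\}\subseteq M$. Then $\mathrm{MDL}_3\text{ - }\mathrm{SAT}(M)$ is $\Sigma_3^p$-hard.
   Context: Modal dependence logic (MDL). Fix a set $AP$ of atomic propositions. MDL formulas are generated by $\varphi ::= \top \mid \bot \mid p \mid \overline{p} \mid \mathrm{dep}(p_1,\dots,p_{n-1};p_n) \mid \overline{\mathrm{dep}(p_1,\dots,p_{n-1};p_n)} \mid \varphi\wedge\varphi \mid \varphi\vee\varphi \mid \varphi\veebar\varphi \mid \Box\varphi \mid \Diamond\varphi$, where $p,p_i\in AP$ and $n\ge 1$. Here $\overline{\cdot}$ is negation (applied only to atomic propositions and dependence atoms), $\mathrm{dep}(p_1,\dots,p_{n-1};p_n)$ is a dependence atom of arity $n-1$, $\vee$ is dependence disjunction and $\veebar$ is classical disjunction. A frame is $W=(S,R,\pi)$ with $S$ a nonempty set of worlds, $R\subseteq S\times S$, and $\pi:S\to 2^{AP}$. For $T\subseteq S$, satisfaction $W,T\models\varphi$ is defined by: $W,T\models\top$ always; $W,T\models\bot$ iff $T=\emptyset$; $W,T\models p$ iff $p\in\pi(s)$ for all $s\in T$; $W,T\models\overline{p}$ iff $p\notin\pi(s)$ for all $s\in T$; $W,T\models \mathrm{dep}(p_1,\dots,p_{n-1};p_n)$ iff for all $s_1,s_2\in T$ with $\pi(s_1)\cap\{p_1,\dots,p_{n-1}\}=\pi(s_2)\cap\{p_1,\dots,p_{n-1}\}$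 we have $p_n\in\pi(s_1)\Leftrightarrow p_n\in\pi(s_2)$; $W,T\models\overline{\mathrm{dep}(\dots)}$ iff $T=\emptyset$; $W,T\models\varphi\wedge\psi$ iff both hold; $W,T\models\varphi\vee\psi$ iff there are $T_1,T_2$ with $T=T_1\cup T_2$, $W,T_1\models\varphi$ and $W,T_2\models\psi$; $W,T\models\varphi\veebar\psi$ iff $W,T\models\varphi$ or $W,T\models\psi$; $W,T\models\Box\varphi$ iff $W,\{s'\mid \exists s\in T,(s,s')\in R\}\models\varphi$; $W,T\models\Diamond\varphi$ iff there is $T'\subseteq S$ with $W,T'\models\varphi$ such that every $s\in T$ has some $s'\in T'$ with $(s,s')\in R$. For a set $M$ of operators, $\mathrm{MDL}[M]$ is the set of MDL formulas built from atomic propositions using only operators and constants from $M$ (a negated dependence atom uses both $\overline{\cdot}$ and $\mathrm{dep}$); $\mathrm{MDL}_3[M]$ is the set of those formulas in $\mathrm{MDL}[M]$ all of whose dependence atoms have arity at most $3$. $\mathrm{MDL}_3\text{ - }\mathrm{SAT}(M)$ is the problem: given $\varphi\in\mathrm{MDL}_3[M]$, decide whether there exist a frame $W$ and a nonempty team $T$ with $W,T\models\varphi$. Hardness is with respect to polynomial-time many-one reductions. -}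

module Defs where

open import Data.Nat using (ℕ; zero; suc; _+_; _*_; _∸_; _^_; _≤_; _≡ᵇ_)
open import Data.Bool using (Bool; true; false; if_then_else_)
open import Data.List using (List; []; _∷_; length; _++_; concatMap)
open import Data.List.Relation.Unary.All using (All)
open import Data.Fin using (Fin)
open import Data.Product using (Σ; _×_; _,_; proj₁; proj₂)
open import Data.Sum using (_⊎_)
open import Data.Empty using (⊥)
open import Data.Unit using (⊤)
open import Relation.Nullary using (¬_)
open import Relation.Binary.PropositionalEquality using (_≡_)
open import Function.Bundles using (_⇔_)
open import Level using (Lift)
import Level

AP : Set
AP = ℕ

-- dep ps q  is  dep(p₁,…,p_{n-1}; p_n)  with ps = [p₁,…,p_{n-1}] (possibly
-- empty, n ≥ 1) and q = p_n; its arity is length ps.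
-- ndep ps q is the negated dependence atom.
data Fml : Set where
  top bot     : Fml
  atom natom  : AP → Fml
  dep ndep    : List AP → AP → Fml
  _∧'_        : Fml → Fml → Fml
  _∨'_        : Fml → Fml → Fml
  _⊻'_        : Fml → Fml → Fml
  □ ◇         : Fml → Fml

record Frame : Set₁ where
  field
    S          : Set
    R          : S → S → Set
    π          : S → AP → Bool
    inhabitant : S

Team : Frame → Set₁
Team W = Frame.S W → Set

agreeOn : List AP → (AP → Bool) → (AP → Bool) → Set
agreeOn ps v w = All (λ p → v p ≡ w p) ps

IsUnion : {S : Set} → (S → Set) → (S → Set) → (S → Set) → Set
IsUnion {S} T T₁ T₂ =
  ((s : S) → T s → T₁ s ⊎ T₂ s) × ((s : S) → T₁ s → T s) × ((s : S) → T₂ s → T s)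

Sat : (W : Frame) → Team W → Fml → Set₁
Sat W T top = Lift (Level.suc Level.zero) ⊤
Sat W T bot = Lift (Level.suc Level.zero) ((s : Frame.S W) → ¬ T s)
Sat W T (atom p) = Lift (Level.suc Level.zero) ((s : Frame.S W) → T s → Frame.π W s p ≡ true)
Sat W T (natom p) = Lift (Level.suc Level.zero) ((s : Frame.S W) → T s → Frame.π W s p ≡ false)
Sat W T (dep ps q) = Lift (Level.suc Level.zero) ((s₁ s₂ : Frame.S W) → T s₁ → T s₂ →
  agreeOn ps (Frame.π W s₁) (Frame.π W s₂) → Frame.π W s₁ q ≡ Frame.π W s₂ q)
Sat W T (ndep ps q) = Lift (Level.suc Level.zero) ((s : Frame.S W) → ¬ T s)
Sat W T (φ ∧' ψ) = Sat W T φ × Sat W T ψ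
Sat W T (φ ∨' ψ) = Σ (Team W) λ T₁ → Σ (Team W) λ T₂ →
  Lift (Level.suc Level.zero) (IsUnion T T₁ T₂) × Sat W T₁ φ × Sat W T₂ ψ
Sat W T (φ ⊻' ψ) = Sat W T φ ⊎ Sat W T ψ
Sat W T (□ φ) = Sat W (λ s' → Σ (Frame.S W) λ s → T s × Frame.R W s s') φ
Sat W T (◇ φ) = Σ (Team W) λ T' → Sat W T' φ ×
  Lift (Level.suc Level.zero) ((s : Frame.S W) → T s → Σ (Frame.S W) λ s' → T' s' × Frame.R W s s')

Satisfiable : Fml → Set₁
Satisfiable φ = Σ Frame λ W → Σ (Team W) λ T →
  Lift (Level.suc Level.zero) (Σ (Frame.S W) T) × Sat W T φ

data Op : Set where
  opBox opDia opAnd opOr opNeg opTop opBot opDep opCor : Op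

OpSet : Set
OpSet = Op → Bool

_∈ₒ_ : Op → OpSet → Set
o ∈ₒ M = M o ≡ true

InFrag : OpSet → Fml → Set
InFrag M top = opTop ∈ₒ M
InFrag M bot = opBot ∈ₒ M
InFrag M (atom p) = ⊤
InFrag M (natom p) = opNeg ∈ₒ M
InFrag M (dep ps q) = opDep ∈ₒ M
InFrag M (ndep ps q) = (opNeg ∈ₒ M) × (opDep ∈ₒ M)
InFrag M (φ ∧' ψ) = (opAnd ∈ₒ M) × InFrag M φ × InFrag M ψ
InFrag M (φ ∨' ψ) = (opOr ∈ₒ M) × InFrag M φ × InFrag M ψ
InFrag M (φ ⊻' ψ) = (opCor ∈ₒ M) × InFrag M φ × InFrag M ψ
InFrag M (□ φ) = (opBox ∈ₒ M) × InFrag M φ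
InFrag M (◇ φ) = (opDia ∈ₒ M) × InFrag M φ

Arity3 : Fml → Set
Arity3 top = ⊤
Arity3 bot = ⊤
Arity3 (atom p) = ⊤
Arity3 (natom p) = ⊤
Arity3 (dep ps q) = length ps ≤ 3
Arity3 (ndep ps q) = length ps ≤ 3
Arity3 (φ ∧' ψ) = Arity3 φ × Arity3 ψ
Arity3 (φ ∨' ψ) = Arity3 φ × Arity3 ψ
Arity3 (φ ⊻' ψ) = Arity3 φ × Arity3 ψ
Arity3 (□ φ) = Arity3 φ
Arity3 (◇ φ) = Arity3 φ

-- Binary encoding of formulas (prefix-free Polish notation).
-- Atom pᵢ is written in unary as 1ⁱ0; a list of atoms as (1 code)* 0;
-- each constructor has a 4-bit tag.

encAP : AP → List Bool
encAP zero = false ∷ []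
encAP (suc i) = true ∷ encAP i

encAPs : List AP → List Bool
encAPs [] = false ∷ []
encAPs (p ∷ ps) = true ∷ (encAP p ++ encAPs ps)

tag : Bool → Bool → Bool → Bool → List Bool
tag a b c d = a ∷ b ∷ c ∷ d ∷ []

enc : Fml → List Bool
enc top = tag false false false false
enc bot = tag false false false true
enc (atom p) = tag false false true false ++ encAP p
enc (natom p) = tag false false true true ++ encAP p
enc (dep ps q) = tag false true false false ++ encAPs ps ++ encAP q
enc (ndep ps q) = tag false true false true ++ encAPs ps ++ encAP q
enc (φ ∧' ψ) = tag false true true false ++ enc φ ++ enc ψ
enc (φ ∨' ψ) = tag false true true true ++ enc φ ++ enc ψ
enc (φ ⊻' ψ) = tag true false false false ++ enc φ ++ enc ψ
enc (□ φ) = tag true false false true ++ enc φ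
enc (◇ φ) = tag true false true false ++ enc φ

MDL3-SAT : OpSet → List Bool → Set₁
MDL3-SAT M w = Σ Fml λ φ →
  Lift (Level.suc Level.zero) ((enc φ ≡ w) × InFrag M φ × Arity3 φ) × Satisfiable φ

-- Deterministic single-tape Turing machines (one-way infinite tape,
-- alphabet {blank,0,1}; moving left at cell 0 stays at cell 0).

data Sym : Set where
  blank b0 b1 : Sym

data Move : Set where
  left right stay : Move

toSym : Bool → Sym
toSym false = b0
toSym true  = b1

record TM : Set where
  field
    nStates : ℕ
    start   : Fin (suc nStates)
    halting : Fin (suc nStates) → Bool
    accepting : Fin (suc nStates) → Bool
    δ       : Fin (suc nStates) → Sym → Fin (suc nStates) × Sym × Move

record Config (M : TM) : Set where
  constructor cfg
  field
    state : Fin (suc (TM.nStates M))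
    head  : ℕ
    tape  : ℕ → Sym

move : Move → ℕ → ℕ
move left  h = h ∸ 1
move right h = suc h
move stay  h = h

step : (M : TM) → Config M → Config M
step M (cfg q h t) with TM.halting M q
... | true  = cfg q h t
... | false with TM.δ M q (t h)
...   | (q' , s , m) = cfg q' (move m h) (λ i → if i ≡ᵇ h then s else t i)

run : (M : TM) → ℕ → Config M → Config M
run M zero c = c
run M (suc n) c = run M n (step M c)

inputTape : List Bool → ℕ → Sym
inputTape [] i = blank
inputTape (b ∷ x) zero = toSym b
inputTape (b ∷ x) (suc i) = inputTape x i

initial : (M : TM) → List Bool → Config M
initial M x = cfg (TM.start M) 0 (inputTape x)

after : (M : TM) → List Bool → ℕ → Config M
after M x t = run M t (initial M x)

Halted : (M : TM) → Config M → Set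
Halted M c = TM.halting M (Config.state c) ≡ true

Accepted : (M : TM) → Config M → Set
Accepted M c = TM.accepting M (Config.state c) ≡ true

readsAt : (ℕ → Sym) → ℕ → List Bool → Set
readsAt t n [] = t n ≡ blank
readsAt t n (b ∷ y) = (t n ≡ toSym b) × readsAt t (suc n) y

poly : ℕ → ℕ → ℕ
poly c n = c * n ^ c + c

PolyTimeComputable : (List Bool → List Bool) → Set
PolyTimeComputable f = Σ TM λ M → Σ ℕ λ c → (x : List Bool) →
  Halted M (after M x (poly c (length x))) ×
  readsAt (Config.tape (after M x (poly c (length x)))) 0 (f x)

PolyTimeMachine : TM → ℕ → Set
PolyTimeMachine M d = (x : List Bool) → Halted M (after M x (poly d (length x)))

AcceptsP : TM → ℕ → List Bool → Set
AcceptsP M d x = Accepted M (after M x (poly d (length x)))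

encTuple : List (List Bool) → List Bool
encTuple = concatMap (λ w → concatMap (λ b → b ∷ b ∷ []) w ++ (false ∷ true ∷ []))

InSigma3p : (List Bool → Set) → Set
InSigma3p L = Σ TM λ V → Σ ℕ λ d → Σ ℕ λ c → PolyTimeMachine V d ×
  ((x : List Bool) → L x ⇔
    (Σ (List Bool) λ y₁ → length y₁ ≤ poly c (length x) ×
      ((y₂ : List Bool) → length y₂ ≤ poly c (length x) →
        Σ (List Bool) λ y₃ → length y₃ ≤ poly c (length x) ×
          AcceptsP V d (encTuple (x ∷ y₁ ∷ y₂ ∷ y₃ ∷ [])))))

_≤ₚ_ : ∀ {a b} → (List Bool → Set a) → (List Bool → Set b) → Set _
L ≤ₚ K = Σ (List Bool → List Bool) λ f → PolyTimeComputable f ×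
  ((x : List Bool) → L x ⇔ K (f x))

Sigma3p-hard : ∀ {b} → (List Bool → Set b) → Set _
Sigma3p-hard K = (L : List Bool → Set) → InSigma3p L → L ≤ₚ K

-- The formula describes, at every leaf of a tree of worlds, a run of the verifier on x, y₁, y₂, y₃ by a
-- Cook–Levin tableau whose constraints are clauses with at most three atoms. The word y₁ is the same at all
-- leaves because its atoms p satisfy dep(;p); the word y₂ ranges over all words because below □ʲ there is one
-- diamond for each possible entry j; the word y₃ is whatever the leaf says it is.
--
-- A clause on atoms a, b, c is imposed without disjunction by a private flag f: the flag is up at all leaves, a
-- separate chain of diamonds of the same length ends in a world that violates the clause and has its flag down,
-- and dep(a,b,c;f) holds at that depth. Hence no leaf agrees with that world on a, b, c. Conversely, defining f
-- in every world as "the clause is not violated here" satisfies all these dependence atoms at once.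
--
-- The formula consists of nested conjunctions over unary ranges, so it is printed by a program of a small
-- language whose only loops run over registers. Each operation of such a program costs a Turing machine
-- linear time in the length of the tape in use, and the number of operations is polynomial by structural
-- recursion on the program.

module Submission where

open import Defs
open import Data.Bool using (Bool; true; false; if_then_else_; not; _∧_)
open import Data.Empty using (⊥; ⊥-elim)
open import Data.Fin as Fin using (Fin; zero; suc; toℕ; fromℕ<; _↑ˡ_; _↑ʳ_; splitAt)
open import Data.Fin.Properties using (splitAt-↑ˡ; splitAt-↑ʳ; toℕ-injective; toℕ-fromℕ<; toℕ<n; toℕ≤pred[n])
open import Data.List using (take; drop; allFin; cartesianProductWith; lookup; List; []; _∷_; length; _++_; _ʳ++_; reverse; map; replicate; concatMap)
open import Data.List.Properties using (++-assoc; ++-identityʳ; length-++; length-map; length-replicate; ++-ʳ++; ʳ++-defn; ʳ++-ʳ++; reverse-map; length-reverse; map-++)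
open import Data.List.Membership.Propositional using (_∈_)
open import Data.List.Membership.Propositional.Properties using (∈-cartesianProductWith⁺; ∈-allFin; ∈-++⁺ˡ; ∈-++⁺ʳ)
open import Data.List.Relation.Unary.All as All using (All)
open import Data.List.Relation.Unary.Any as Any using (here; there)
open import Data.List.Relation.Unary.Any.Properties using (lookup-index)
open import Data.Maybe using (Maybe; just; nothing; _>>=_)
open import Data.Maybe.Properties using (just-injective)
open import Data.Nat using (NonZero; ℕ; zero; suc; _+_; _*_; _∸_; _^_; _≤_; _<_; _≡ᵇ_; z≤n; s≤s)
open import Data.Nat.DivMod using (_/_; _%_; m%n<n; m<n⇒m/n≡0; m<n⇒m%n≡m; +-distrib-/-∣ʳ; m*n/n≡m; [m+kn]%n≡m%n)
open import Data.Nat.Divisibility using (n∣m*n)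
open import Data.Nat.Properties
open import Function using (_∘_)
open import Relation.Binary.Definitions using (tri<; tri≈; tri>)
open import Data.Nat.Tactic.RingSolver using (solve-∀)
open import Data.Product using (Σ; _×_; _,_; proj₁; proj₂)
open import Data.Sum using (_⊎_; inj₁; inj₂; [_,_]′)
open import Data.Unit using (⊤; tt)
open import Data.Vec as Vec using (Vec; []; _∷_)
open import Data.Vec.Properties using (lookup-++ˡ; lookup-++ʳ; []≔-++-↑ˡ)
open import Relation.Nullary using (yes; no)
open import Function.Bundles using (mk⇔; Equivalence)
open import Level using (lift; lower)
open import Relation.Binary.PropositionalEquality using (_≡_; _≢_; refl; sym; trans; cong; cong₂; subst; subst₂; module ≡-Reasoning)

-- Turing machine fragments

-- The tableau is one-sided. Apart from the clauses that make every guessed entry some item, each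
-- clause derives one true atom from true atoms, and nothing forbids a leaf to make further atoms
-- true. Soundness follows only the atoms that are forced, from the first code position and the
-- initial head position on, and ends because the last row contains no atom of a non-accepting
-- state. No uniqueness constraints are needed, and two premises and one conclusion always suffice.
--
-- A diamond chooses its team freely, and this team may contain worlds that succeed nothing in the
-- given team. The leaves used in soundness are therefore traced along paths from one world that
-- lies both in the team of the outer diamond and among the successors of the given team. At such
-- leaves the raised flags and the dependence atoms apply together.
--
-- In the converse direction distinct atoms need distinct numbers. A coordinate of an atom is at
-- most 4 plus two loop counters, each at most `N`, whence the base `2N + 5` of the numbering.

Zip : Set
Zip = List Sym × List Sym

hd : List Sym → Sym
hd []      = blank
hd (s ∷ _) = s

tl : List Sym → List Sym
tl []       = []
tl (_ ∷ rs) = rs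

put : Move → List Sym → Sym → List Sym → Zip
put left  []       s rs = [] , s ∷ rs
put left  (l ∷ ls) s rs = ls , l ∷ s ∷ rs
put right ls       s rs = s ∷ ls , rs
put stay  ls       s rs = ls , s ∷ rs

-- Leaving a fragment is itself a transition, labelled by an exit in `X`. The exit type carries the
-- control flow: `⊤` marks a routine that another one can follow, `Bool` a loop body that reports
-- whether to go on.
record Frag (X : Set) : Set where
  field
    size : ℕ
    st   : Fin size
    δ    : Fin size → Sym → (Fin size ⊎ X) × Sym × Move

open Frag

-- The number is an upper bound on the number of steps, not their exact number.
data Run {X : Set} (F : Frag X) : Fin (size F) → Zip → ℕ → X → Zip → Set where
  exit : ∀ {q ls rs x s m n} → δ F q (hd rs) ≡ (inj₂ x , s , m) →
         Run F q (ls , rs) (suc n) x (put m ls s (tl rs))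
  more : ∀ {q ls rs q′ s m n x z} → δ F q (hd rs) ≡ (inj₁ q′ , s , m) →
         Run F q′ (put m ls s (tl rs)) n x z → Run F q (ls , rs) (suc n) x z

Steps : {X : Set} → Frag X → Zip → ℕ → X → Zip → Set
Steps F = Run F (st F)

run-mono : ∀ {X} {F : Frag X} {q z n m x z′} → n ≤ m → Run F q z n x z′ → Run F q z m x z′
run-mono (s≤s le) (exit e)   = exit e
run-mono (s≤s le) (more e r) = more e (run-mono le r)

retarget : ∀ {X Y : Set} {k l} → (Fin k → Fin l) → (X → Fin l ⊎ Y) →
           (Fin k ⊎ X) × Sym × Move → (Fin l ⊎ Y) × Sym × Move
retarget f out (inj₁ q , r) = inj₁ (f q) , r
retarget f out (inj₂ x , r) = out x , r

-- Sequencing, looping and branching all put a copy of `F` into a larger fragment and redirect its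
-- exits. Their runs come from the two lemmas below: an exit of `F` either leaves `H` too or jumps
-- to a state of `H`.
module Embedding {X Y : Set} (F : Frag X) (H : Frag Y)
  (f : Fin (size F) → Fin (size H)) (out : X → Fin (size H) ⊎ Y)
  (δ-f : ∀ q s → δ H (f q) s ≡ retarget f out (δ F q s)) where

  embed-exit : ∀ {q z n x y z′} → out x ≡ inj₂ y → Run F q z n x z′ → Run H (f q) z n y z′
  embed-exit {q} ox (exit {rs = rs} {s = s} {m = m} e) =
    exit (trans (δ-f q (hd rs)) (trans (cong (retarget f out) e) (cong (λ o → o , s , m) ox)))
  embed-exit {q} ox (more {rs = rs} e r) =
    more (trans (δ-f q (hd rs)) (cong (retarget f out) e)) (embed-exit ox r)

  embed-jump : ∀ {q z n x p z′ m y z″} → out x ≡ inj₁ p → Run F q z n x z′ →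
               Run H p z′ m y z″ → Run H (f q) z (n + m) y z″
  embed-jump {q} {m = k} ox (exit {rs = rs} {s = s} {m = m} {n = n} e) r′ =
    more (trans (δ-f q (hd rs)) (trans (cong (retarget f out) e) (cong (λ o → o , s , m) ox)))
         (run-mono (m≤n+m k n) r′)
  embed-jump {q} ox (more {rs = rs} e r) r′ =
    more (trans (δ-f q (hd rs)) (cong (retarget f out) e)) (embed-jump ox r r′)

module Sequence {X : Set} (F : Frag ⊤) (G : Frag X) where

  frag : Frag X
  frag = record
    { size = size F + size G
    ; st   = st F ↑ˡ size G
    ; δ    = λ q s → [ (λ p → retarget (_↑ˡ size G) (λ _ → inj₁ (size F ↑ʳ st G)) (δ F p s))
                     , (λ p → retarget (size F ↑ʳ_) inj₂ (δ G p s)) ]′ (splitAt (size F) q)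
    }

  first : ∀ q s → δ frag (q ↑ˡ size G) s ≡
          retarget (_↑ˡ size G) (λ _ → inj₁ (size F ↑ʳ st G)) (δ F q s)
  first q s rewrite splitAt-↑ˡ (size F) q (size G) = refl

  second : ∀ q s → δ frag (size F ↑ʳ q) s ≡ retarget (size F ↑ʳ_) inj₂ (δ G q s)
  second q s rewrite splitAt-↑ʳ (size F) (size G) q = refl

module Branching {X : Set} (F : Sym → Frag X) where

  nb n0 n1 : ℕ
  nb = size (F blank)
  n0 = size (F b0)
  n1 = size (F b1)

  inject : (s : Sym) → Fin (size (F s)) → Fin (nb + (n0 + n1))
  inject blank q = q ↑ˡ (n0 + n1)
  inject b0    q = nb ↑ʳ (q ↑ˡ n1)
  inject b1    q = nb ↑ʳ (n0 ↑ʳ q)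

  branch : (s : Sym) → Fin (size (F s)) → Sym → (Fin (suc (nb + (n0 + n1))) ⊎ X) × Sym × Move
  branch s q r = retarget (λ p → suc (inject s p)) inj₂ (δ (F s) q r)

  frag : Frag X
  frag = record
    { size = suc (nb + (n0 + n1))
    ; st   = zero
    ; δ    = λ { zero    s → inj₁ (suc (inject s (st (F s)))) , s , stay
               ; (suc q) r → [ (λ p → branch blank p r)
                             , (λ p → [ (λ p′ → branch b0 p′ r) , (λ p′ → branch b1 p′ r) ]′ (splitAt n0 p))
                             ]′ (splitAt nb q) }
    }

  δ-inject : ∀ s q r → δ frag (suc (inject s q)) r ≡ branch s q r
  δ-inject blank q r rewrite splitAt-↑ˡ nb q (n0 + n1) = refl
  δ-inject b0 q r rewrite splitAt-↑ʳ nb (n0 + n1) (q ↑ˡ n1) | splitAt-↑ˡ n0 q n1 = refl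
  δ-inject b1 q r rewrite splitAt-↑ʳ nb (n0 + n1) (n0 ↑ʳ q) | splitAt-↑ʳ n0 n1 q = refl

infixr 4 _»_ _⟫_

-- Abstract, so that fragments can be inferred from the types of their runs.
abstract

  act : {X : Set} → (Sym → X × Sym × Move) → Frag X
  act g = record { size = 1 ; st = zero ; δ = λ _ s → inj₂ (proj₁ (g s)) , proj₂ (g s) }

  act-run : ∀ {X : Set} {g : Sym → X × Sym × Move} {ls s rs} →
            Steps (act g) (ls , s ∷ rs) 1 (proj₁ (g s)) (put (proj₂ (proj₂ (g s))) ls (proj₁ (proj₂ (g s))) rs)
  act-run = exit refl

  _»_ : {X : Set} → Frag ⊤ → Frag X → Frag X
  F » G = Sequence.frag F G

  _⟫_ : ∀ {X : Set} {F : Frag ⊤} {G : Frag X} {z n t z′ m x z″} →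
        Steps F z n t z′ → Steps G z′ m x z″ → Steps (F » G) z (n + m) x z″
  _⟫_ {F = F} {G} r r′ = Embedding.embed-jump F _ _ _ (Sequence.first F G) refl r
                           (Embedding.embed-exit G _ _ _ (Sequence.second F G) refl r′)

  repeatF : Frag Bool → Frag ⊤
  repeatF F = record
    { size = size F
    ; st   = st F
    ; δ    = λ q s → retarget (λ p → p) (λ b → if b then inj₁ (st F) else inj₂ tt) (δ F q s)
    }

  repeat-again : ∀ {F : Frag Bool} {z n z′ m z″} → Steps F z n true z′ → Steps (repeatF F) z′ m tt z″ →
                 Steps (repeatF F) z (n + m) tt z″
  repeat-again {F} = Embedding.embed-jump F (repeatF F) _ _ (λ _ _ → refl) refl

  repeat-done : ∀ {F : Frag Bool} {z n z′} → Steps F z n false z′ → Steps (repeatF F) z n tt z′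
  repeat-done {F} = Embedding.embed-exit F (repeatF F) _ _ (λ _ _ → refl) refl

  test : {X : Set} → (Sym → Frag X) → Frag X
  test = Branching.frag

  test-run : ∀ {X : Set} {F : Sym → Frag X} {ls s rs n x z} → Steps (F s) (ls , s ∷ rs) n x z →
             Steps (test F) (ls , s ∷ rs) (suc n) x z
  test-run {F = F} {s = s} r =
    more refl (Embedding.embed-exit (F s) (Branching.frag F) _ _ (Branching.δ-inject F s) refl r)

-- Fields on the tape and passes over them

syms : List Bool → List Sym
syms = map toSym

flat : List (List Bool) → List Sym
flat []       = []
flat (r ∷ fs) = syms r ++ blank ∷ flat fs

length-syms : ∀ r → length (syms r) ≡ length r
length-syms = length-map toSym

flat-++ : ∀ fs gs → flat (fs ++ gs) ≡ flat fs ++ flat gs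
flat-++ []       gs = refl
flat-++ (r ∷ fs) gs =
  trans (cong (λ w → syms r ++ blank ∷ w) (flat-++ fs gs)) (sym (++-assoc (syms r) (blank ∷ flat fs) (flat gs)))

field≤ : ∀ r fs → suc (length r) + length (flat fs) ≡ length (flat (r ∷ fs))
field≤ r fs = sym (trans (length-++ (syms r)) (trans (+-suc _ _) (cong (λ l → suc (l + length (flat fs))) (length-syms r))))

-- The left half of a zipper is stored in reverse, so a pass to the left is an induction on the
-- reversed word. This translates its result back to the word as written on the tape.
syms-reversed : ∀ r → Σ (List Bool) λ w → (∀ ls → syms r ʳ++ ls ≡ syms w ++ ls) ×
                (∀ rs → syms w ʳ++ rs ≡ syms r ++ rs) × length w ≡ length r
syms-reversed r = reverse r
  , (λ ls → trans (ʳ++-defn (syms r)) (cong (_++ ls) (sym (reverse-map toSym r))))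
  , (λ rs → trans (cong (_ʳ++ rs) (reverse-map toSym r)) (ʳ++-ʳ++ (syms r)))
  , length-reverse r

flat-ʳ++ : ∀ r fs ls → flat (r ∷ fs) ʳ++ ls ≡ flat fs ʳ++ (blank ∷ (syms r ʳ++ ls))
flat-ʳ++ r fs ls = ++-ʳ++ (syms r)

moveL moveR : Frag ⊤
moveL = act λ s → tt , s , left
moveR = act λ s → tt , s , right

writeR : Sym → Frag ⊤
writeR b = act λ _ → tt , b , right

scan : Move → Move → Frag ⊤
scan d e = repeatF (act λ { blank → false , blank , e ; s → true , s , d })

scan-right : ∀ {e ls rs} r → Steps (scan right e) (ls , syms r ++ blank ∷ rs) (suc (length r)) tt
                                   (put e (syms r ʳ++ ls) blank rs)
scan-right []          = repeat-done act-run
scan-right (false ∷ r) = repeat-again act-run (scan-right r)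
scan-right (true ∷ r)  = repeat-again act-run (scan-right r)

scan-left : ∀ {ls s rs} w → Steps (scan left right) (put left (syms w ++ blank ∷ ls) s rs) (suc (length w)) tt
                                  (blank ∷ ls , syms w ʳ++ (s ∷ rs))
scan-left []          = repeat-done act-run
scan-left (false ∷ w) = repeat-again act-run (scan-left w)
scan-left (true ∷ w)  = repeat-again act-run (scan-left w)

codeSym : Fin 3 → Sym
codeSym zero             = blank
codeSym (suc zero)       = b0
codeSym (suc (suc zero)) = b1

-- The state is the symbol picked up from the previous cell.
carry : Move → (Sym → Sym × Move) → Frag ⊤
carry d e = record
  { size = 3
  ; st   = zero
  ; δ    = λ { q blank → inj₂ tt , e (codeSym q)
             ; q b0    → inj₁ (suc zero) , codeSym q , d
             ; q b1    → inj₁ (suc (suc zero)) , codeSym q , d }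
  }

carry-right : ∀ {ls rs} q r → Run (carry right (_, right)) q (ls , syms r ++ blank ∷ rs)
                                  (suc (length r)) tt ((codeSym q ∷ syms r) ʳ++ ls , rs)
carry-right q []          = exit refl
carry-right q (false ∷ r) = more refl (carry-right (suc zero) r)
carry-right q (true ∷ r)  = more refl (carry-right (suc (suc zero)) r)

carry-left : ∀ {ls s rs} q w → Run (carry left (_, stay)) q (put left (syms w ++ blank ∷ ls) s rs)
                                   (suc (length w)) tt (ls , syms w ʳ++ (codeSym q ∷ s ∷ rs))
carry-left q []          = exit refl
carry-left q (false ∷ w) = more refl (carry-left (suc zero) w)
carry-left q (true ∷ w)  = more refl (carry-left (suc (suc zero)) w)

-- Unlike in `carry-left`, the symbol picked up last is never written. The field moves one cell to
-- the left and loses its first bit, which is the `tl` in the result.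
carry-left-drop : ∀ {ls s rs} q w → Run (carry left (λ _ → blank , right)) q (put left (syms w ++ blank ∷ ls) s rs)
                                        (suc (length w)) tt (blank ∷ ls , tl (syms w ʳ++ (codeSym q ∷ s ∷ rs)))
carry-left-drop q []          = exit refl
carry-left-drop q (false ∷ w) = more refl (carry-left-drop (suc zero) w)
carry-left-drop q (true ∷ w)  = more refl (carry-left-drop (suc (suc zero)) w)

abstract

  skipField shiftField unshiftField dropFirst backField : Frag ⊤
  skipField    = scan right right
  shiftField   = carry right (_, right)
  unshiftField = moveL » carry left (_, stay)
  dropFirst    = moveL » carry left (λ _ → blank , right)
  backField    = moveL » moveL » scan left right

  skipField-run : ∀ {ls rs} r → Steps skipField (ls , syms r ++ blank ∷ rs) (suc (length r)) tt
                                      (blank ∷ (syms r ʳ++ ls) , rs)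
  skipField-run = scan-right

  shiftField-run : ∀ {ls rs} r → Steps shiftField (ls , syms r ++ blank ∷ rs) (suc (length r)) tt
                                       ((blank ∷ syms r) ʳ++ ls , rs)
  shiftField-run = carry-right zero

  unshiftField-run : ∀ {ls s rs} r → Steps unshiftField (syms r ʳ++ (blank ∷ ls) , s ∷ rs) (2 + length r) tt
                                         (ls , syms r ++ blank ∷ s ∷ rs)
  unshiftField-run {ls} {s} {rs} r with syms-reversed r
  ... | w , from , to , len rewrite from (blank ∷ ls) | sym (to (blank ∷ s ∷ rs)) | sym len =
    act-run ⟫ carry-left zero w

  dropFirst-run : ∀ {ls s rs} b r → Steps dropFirst (syms (b ∷ r) ʳ++ (blank ∷ ls) , s ∷ rs) (3 + length r) tt
                                        (blank ∷ ls , syms r ++ blank ∷ s ∷ rs)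
  dropFirst-run {ls} {s} {rs} b r with syms-reversed (b ∷ r)
  ... | w , from , to , len = subst₂ (λ l z → Steps dropFirst (l , s ∷ rs) (3 + length r) tt (blank ∷ ls , tl z))
          (sym (from (blank ∷ ls))) (to (blank ∷ s ∷ rs))
          (subst (λ n → Steps dropFirst (syms w ++ blank ∷ ls , s ∷ rs) (2 + n) tt (blank ∷ ls , tl (syms w ʳ++ (blank ∷ s ∷ rs))))
                 len (act-run ⟫ carry-left-drop zero w))

  backField-run : ∀ {ls s rs} r → Steps backField (blank ∷ (syms r ʳ++ (blank ∷ ls)) , s ∷ rs) (3 + length r) tt
                                      (blank ∷ ls , syms r ++ blank ∷ s ∷ rs)
  backField-run {ls} {s} {rs} r with syms-reversed r
  ... | w , from , to , len rewrite from (blank ∷ ls) | sym (to (blank ∷ s ∷ rs)) | sym len =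
    act-run ⟫ act-run ⟫ scan-left w

-- The same unrolled loop, peeled at different ends. A list of fields is traversed from left to
-- right by induction with `iterF`; from right to left its first field comes last, which fits
-- `iterL`.
iterF iterL : {X : Set} → ℕ → Frag ⊤ → Frag X → Frag X
iterF zero    F G = G
iterF (suc n) F G = F » iterF n F G
iterL zero    F G = G
iterL (suc n) F G = iterL n F (F » G)

++-nonempty : ∀ (xs : List Sym) s rs → Σ Sym λ s′ → Σ (List Sym) λ rs′ → xs ++ s ∷ rs ≡ s′ ∷ rs′
++-nonempty []       s rs = s , rs , refl
++-nonempty (x ∷ xs) s rs = x , xs ++ s ∷ rs , refl

flat-ʳ++-blank : ∀ fs ls → Σ (List Sym) λ ls′ → flat fs ʳ++ (blank ∷ ls) ≡ blank ∷ ls′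
flat-ʳ++-blank []       ls = ls , refl
flat-ʳ++-blank (r ∷ fs) ls =
  let ls′ , e = flat-ʳ++-blank fs (syms r ʳ++ (blank ∷ ls)) in
  ls′ , trans (flat-ʳ++ r fs (blank ∷ ls)) e

-- A pass over a field of length `l` takes at most `3 + l` steps, hence at most three per cell if
-- the terminator is counted. At this uniform rate costs add up along `flat`.
pass-cost : ∀ r fs → 3 * suc (length r) + 3 * length (flat fs) ≡ 3 * length (flat (r ∷ fs))
pass-cost r fs = trans (sym (*-distribˡ-+ 3 (suc (length r)) (length (flat fs)))) (cong (3 *_) (field≤ r fs))

regroup : ∀ r fs n → 3 * length (flat fs) + (3 * suc (length r) + n) ≤ 3 * length (flat (r ∷ fs)) + n
regroup r fs n = ≤-reflexive (trans (trans (sym (+-assoc b a n)) (cong (_+ n) (+-comm b a))) (cong (_+ n) (pass-cost r fs)))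
  where
  a = 3 * suc (length r)
  b = 3 * length (flat fs)

regroup′ : ∀ r fs n → 3 * suc (length r) + (3 * length (flat fs) + n) ≤ 3 * length (flat (r ∷ fs)) + n
regroup′ r fs n = ≤-reflexive (trans (sym (+-assoc (3 * suc (length r)) _ n)) (cong (_+ n) (pass-cost r fs)))

1+≤3* : ∀ n → suc n ≤ 3 * suc n
1+≤3* n = m≤m+n (suc n) _

3+≤3* : ∀ n → 3 + n ≤ 3 * suc n
3+≤3* n = subst (3 + n ≤_) (e n) (m≤m+n (3 + n) (n + n))
  where
  e : ∀ n → (3 + n) + (n + n) ≡ 3 * suc n
  e = solve-∀

module _ {X : Set} {G : Frag X} {n : ℕ} {x : X} {z : Zip} where

  skips : ∀ fs {ls rs} → Steps G (flat fs ʳ++ ls , rs) n x z →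
          Steps (iterF (length fs) skipField G) (ls , flat fs ++ rs) (3 * length (flat fs) + n) x z
  skips []       k = k
  skips (r ∷ fs) {ls} {rs} k rewrite ++-assoc (syms r) (blank ∷ flat fs) rs =
    run-mono (regroup′ r fs n)
      (run-mono (1+≤3* (length r)) (skipField-run r) ⟫
       skips fs (subst (λ l → Steps G (l , rs) n x z) (flat-ʳ++ r fs ls) k))

  shifts : ∀ fs {ls rs} → Steps G (flat fs ʳ++ (blank ∷ ls) , rs) n x z →
           Steps (iterF (length fs) shiftField (moveR » G)) (ls , flat fs ++ blank ∷ rs) (3 * length (flat fs) + suc n) x z
  shifts []       k = act-run ⟫ k
  shifts (r ∷ fs) {ls} {rs} k rewrite ++-assoc (syms r) (blank ∷ flat fs) (blank ∷ rs) =
    run-mono (regroup′ r fs (suc n))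
      (run-mono (1+≤3* (length r)) (shiftField-run r) ⟫
       shifts fs (subst (λ l → Steps G (l , rs) n x z) (flat-ʳ++ r fs (blank ∷ ls)) k))

backs : ∀ {X : Set} {G : Frag X} {n x z} fs {ls s rs} → Steps G (blank ∷ ls , flat fs ++ s ∷ rs) n x z →
        Steps (iterL (length fs) backField G) (flat fs ʳ++ (blank ∷ ls) , s ∷ rs) (3 * length (flat fs) + n) x z
backs []       k = k
backs {G = G} {n} {x} {z} (r ∷ fs) {ls} {s} {rs} k
  rewrite flat-ʳ++ r fs (blank ∷ ls) | ++-assoc (syms r) (blank ∷ flat fs) (s ∷ rs) =
  run-mono (regroup r fs n)
    (backs fs (run-mono (3+≤3* (length r)) step′ ⟫ k))
  where
  step′ : Steps backField (blank ∷ (syms r ʳ++ (blank ∷ ls)) , flat fs ++ s ∷ rs) (3 + length r) tt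
                          (blank ∷ ls , syms r ++ blank ∷ flat fs ++ s ∷ rs)
  step′ with ++-nonempty (flat fs) s rs
  ... | s′ , rs′ , e rewrite e = backField-run r

unshifts : ∀ {X : Set} {G : Frag X} {n x z} fs {ls s rs} → Steps G (ls , flat fs ++ blank ∷ s ∷ rs) n x z →
           Steps (moveL » iterL (length fs) unshiftField G) (flat fs ʳ++ (blank ∷ ls) , s ∷ rs) (3 * length (flat fs) + suc n) x z
unshifts {n = n} fs k = run-mono (≤-reflexive (sym (+-suc _ n))) (go fs act-run k)
  where
  go : ∀ {X : Set} {G : Frag X} {n x z z₀} fs {ls s rs} →
       Steps moveL z₀ 1 tt (put left (flat fs ʳ++ (blank ∷ ls)) s rs) →
       Steps G (ls , flat fs ++ blank ∷ s ∷ rs) n x z →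
       Steps (moveL » iterL (length fs) unshiftField G) z₀ (suc (3 * length (flat fs) + n)) x z
  go []       m k = m ⟫ k
  go {G = G} {n} {x} {z} (r ∷ fs) {ls} {s} {rs} m k
    rewrite flat-ʳ++ r fs (blank ∷ ls) | ++-assoc (syms r) (blank ∷ flat fs) (blank ∷ s ∷ rs) =
    run-mono (s≤s (regroup r fs n))
      (go fs m (run-mono (≤-trans (n≤1+n _) (3+≤3* (length r))) step′ ⟫ k))
    where
    step′ : Steps unshiftField (syms r ʳ++ (blank ∷ ls) , flat fs ++ blank ∷ s ∷ rs) (2 + length r) tt
                               (ls , syms r ++ blank ∷ flat fs ++ blank ∷ s ∷ rs)
    step′ with ++-nonempty (flat fs) blank (s ∷ rs)
    ... | s′ , rs′ , e rewrite e = unshiftField-run r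

-- Queue operations on the layout

blanks : ℕ → List Sym
blanks k = replicate (suc k) blank

-- The blank in cell 0 marks the left end: walking back over the first field stops there. `blanks k`
-- has one blank more than the `k` free cells, so that there is always a cell under the head.
At : List (List Bool) → ℕ → Zip
At fs k = blank ∷ [] , flat fs ++ blanks k

-- The part of the tape in use has constant length Z, so that every operation costs O(Z).
Fits : ℕ → List (List Bool) → ℕ → Set
Fits Z fs k = length (flat fs) + k ≡ Z

-- The dearest operation is popping a bit, with at most `14 * Z + 6` steps; 20 is a round bound for
-- all of them.
opCost : ℕ → ℕ
opCost Z = 20 * suc Z

-- The numbers `j` and `e` count the fields before and behind the one operated on. A field is a
-- queue: `push` appends at its end and `pop` takes from its front, so transferring a field bit by
-- bit preserves its order.
push : {X : Set} → ℕ → ℕ → Bool → Frag X → Frag X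
push j e b G =
  iterF j skipField (scan right stay » writeR (toSym b) » iterF e shiftField (moveR » iterL (j + suc e) backField G))

delete : {X : Set} → ℕ → ℕ → Frag X → Frag X
delete j e G = skipField » iterF e skipField (moveL » iterL e unshiftField (dropFirst » iterL j backField G))

popBranch : {X : Set} → ℕ → ℕ → Frag X → (Bool → Frag X) → Sym → Frag X
popBranch j e G H blank = iterL j backField G
popBranch j e G H b0    = delete j e (H false)
popBranch j e G H b1    = delete j e (H true)

pop : {X : Set} → ℕ → ℕ → Frag X → (Bool → Frag X) → Frag X
pop j e G H = iterF j skipField (test (popBranch j e G H))

newFront freeFront : {X : Set} → ℕ → Frag X → Frag X
newFront  D G = iterF D shiftField (moveR » iterL (suc D) backField G)
freeFront D G = moveR » iterF D skipField (moveL » iterL D unshiftField G)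

flat-split : ∀ pre r post → flat (pre ++ r ∷ post) ≡ flat pre ++ syms r ++ blank ∷ flat post
flat-split pre r post = flat-++ pre (r ∷ post)

length-flat-split : ∀ pre r post → length (flat (pre ++ r ∷ post)) ≡ length (flat pre) + (suc (length r) + length (flat post))
length-flat-split pre r post =
  trans (cong length (flat-++ pre (r ∷ post))) (trans (length-++ (flat pre)) (cong (length (flat pre) +_) (sym (field≤ r post))))

module Bounds {Z k} pre r post (fits : Fits Z (pre ++ r ∷ post) k) where

  whole≤ : length (flat (pre ++ r ∷ post)) ≤ Z
  whole≤ = m+n≤o⇒m≤o _ (≤-reflexive fits)

  private
    sum≤ : length (flat pre) + (suc (length r) + length (flat post)) ≤ Z
    sum≤ = subst (_≤ Z) (length-flat-split pre r post) whole≤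

  pre≤ : length (flat pre) ≤ Z
  pre≤ = m+n≤o⇒m≤o _ sum≤

  field′≤ : suc (length r) ≤ Z
  field′≤ = m+n≤o⇒m≤o _ (m+n≤o⇒n≤o (length (flat pre)) sum≤)

  post≤ : length (flat post) ≤ Z
  post≤ = m+n≤o⇒n≤o (suc (length r)) (m+n≤o⇒n≤o (length (flat pre)) sum≤)

  3pre≤ : 3 * length (flat pre) ≤ 3 * Z
  3pre≤ = *-monoʳ-≤ 3 pre≤

  3post≤ : 3 * length (flat post) ≤ 3 * Z
  3post≤ = *-monoʳ-≤ 3 post≤

  3whole≤ : 3 * length (flat (pre ++ r ∷ post)) ≤ 3 * Z
  3whole≤ = *-monoʳ-≤ 3 whole≤

fits-longer : ∀ {Z k} pre r post b → Fits Z (pre ++ r ∷ post) (suc k) → Fits Z (pre ++ (b ∷ r) ∷ post) k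
fits-longer {Z} {k} pre r post b fits = trans (cong (_+ k) (length-flat-split pre (b ∷ r) post))
  (trans (e (length (flat pre)) (length r) (length (flat post)) k)
         (trans (cong (_+ suc k) (sym (length-flat-split pre r post))) fits))
  where
  e : ∀ p r q k → (p + (suc (suc r) + q)) + k ≡ (p + (suc r + q)) + suc k
  e = solve-∀

fits-push : ∀ {Z k} pre r post b → Fits Z (pre ++ r ∷ post) (suc k) → Fits Z (pre ++ (r ++ b ∷ []) ∷ post) k
fits-push {Z} {k} pre r post b fits =
  trans (cong (_+ k) (trans (length-flat-split pre (r ++ b ∷ []) post)
          (trans (cong (λ l → length (flat pre) + (suc l + length (flat post))) (trans (length-++ r) (+-comm (length r) 1)))
                 (sym (length-flat-split pre (b ∷ r) post)))))
        (fits-longer pre r post b fits)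

module _ {X : Set} {G : Frag X} {n : ℕ} {x : X} {z : Zip} where

  backs-field : ∀ pre r {Y} → Steps G (blank ∷ [] , flat pre ++ syms r ++ blank ∷ Y) n x z →
                Steps (iterL (length pre) backField G) (flat pre ʳ++ (blank ∷ []) , syms r ++ blank ∷ Y)
                      (3 * length (flat pre) + n) x z
  backs-field pre []      = backs pre
  backs-field pre (b ∷ r) = backs pre

At-split : ∀ pre r post k → At (pre ++ r ∷ post) k ≡ (blank ∷ [] , flat pre ++ syms r ++ blank ∷ flat post ++ blanks k)
At-split pre r post k = cong (blank ∷ [] ,_)
  (trans (cong (_++ blanks k) (flat-split pre r post))
         (trans (++-assoc (flat pre) _ _) (cong (flat pre ++_) (++-assoc (syms r) _ _))))

pushed-left : ∀ pre r post b → flat (pre ++ (r ++ b ∷ []) ∷ post) ʳ++ (blank ∷ []) ≡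
              flat post ʳ++ (blank ∷ toSym b ∷ (syms r ʳ++ (flat pre ʳ++ (blank ∷ []))))
pushed-left pre r post b = begin
  flat (pre ++ (r ++ b ∷ []) ∷ post) ʳ++ (blank ∷ [])
    ≡⟨ cong (_ʳ++ (blank ∷ [])) (flat-++ pre ((r ++ b ∷ []) ∷ post)) ⟩
  (flat pre ++ flat ((r ++ b ∷ []) ∷ post)) ʳ++ (blank ∷ [])
    ≡⟨ ++-ʳ++ (flat pre) ⟩
  flat ((r ++ b ∷ []) ∷ post) ʳ++ L
    ≡⟨ flat-ʳ++ (r ++ b ∷ []) post L ⟩
  flat post ʳ++ (blank ∷ (syms (r ++ b ∷ []) ʳ++ L))
    ≡⟨ cong (λ l → flat post ʳ++ (blank ∷ (l ʳ++ L))) (map-++ toSym r (b ∷ [])) ⟩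
  flat post ʳ++ (blank ∷ ((syms r ++ toSym b ∷ []) ʳ++ L))
    ≡⟨ cong (λ l → flat post ʳ++ (blank ∷ l)) (++-ʳ++ (syms r)) ⟩
  flat post ʳ++ (blank ∷ toSym b ∷ (syms r ʳ++ L)) ∎
  where
  open ≡-Reasoning
  L = flat pre ʳ++ (blank ∷ [])

private
  pay : ∀ {Z m} s n → m + s ≤ 20 * suc Z + n → m ≤ 20 * suc Z + n
  pay s n = ≤-trans (m≤m+n _ s)

module _ {X : Set} {G : Frag X} {Z k n : ℕ} {x : X} {z : Zip} where

  push-run : ∀ pre r post b → Fits Z (pre ++ r ∷ post) (suc k) →
             Steps G (At (pre ++ (r ++ b ∷ []) ∷ post) k) n x z →
             Steps (push (length pre) (length post) b G) (At (pre ++ r ∷ post) (suc k)) (opCost Z + n) x z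
  push-run pre r post b fits cont rewrite At-split pre r post (suc k) =
    run-mono cost
      (skips pre (scan-right r ⟫ act-run ⟫ shifts post
        (subst (λ l → Steps (iterL (length pre + suc (length post)) backField G) (l , blanks k) (3 * length (flat fs′) + n) x z) (pushed-left pre r post b)
          (subst (λ d → Steps (iterL d backField G) (flat fs′ ʳ++ (blank ∷ []) , blanks k) (3 * length (flat fs′) + n) x z) (length-++ pre)
            (backs fs′ cont)))))
    where
    fs′ = pre ++ (r ++ b ∷ []) ∷ post
    module B = Bounds pre r post fits
    module B′ = Bounds pre (r ++ b ∷ []) post (fits-push pre r post b fits)
    e : ∀ Z n → (3 * Z + (Z + suc (3 * Z + suc (3 * Z + n)))) + (10 * Z + 18) ≡ 20 * suc Z + n
    e = solve-∀
    cost : 3 * length (flat pre) + (suc (length r) + suc (3 * length (flat post) + suc (3 * length (flat fs′) + n))) ≤ opCost Z + n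
    cost = ≤-trans (+-mono-≤ B.3pre≤ (+-mono-≤ B.field′≤ (s≤s (+-mono-≤ B.3post≤ (s≤s (+-monoˡ-≤ n B′.3whole≤))))))
                   (pay (10 * Z + 18) n (≤-reflexive (e Z n)))

module _ {X : Set} {Z k n : ℕ} {x : X} {z : Zip} where

  delete-run : ∀ {G : Frag X} pre b r post → Fits Z (pre ++ (b ∷ r) ∷ post) k →
               Steps G (At (pre ++ r ∷ post) (suc k)) n x z →
               Steps (delete (length pre) (length post) G)
                     (flat pre ʳ++ (blank ∷ []) , syms (b ∷ r) ++ blank ∷ flat post ++ blanks k) (11 * Z + 5 + n) x z
  delete-run {G} pre b r post fits cont rewrite At-split pre r post (suc k) =
    run-mono cost
      (skipField-run (b ∷ r) ⟫ skips post (unshifts post (dropStep ⟫ backs-field pre r cont)))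
    where
    module B = Bounds pre (b ∷ r) post fits
    dropStep : Steps dropFirst (syms (b ∷ r) ʳ++ (flat pre ʳ++ (blank ∷ [])) , flat post ++ blanks (suc k)) (3 + length r) tt
                               (flat pre ʳ++ (blank ∷ []) , syms r ++ blank ∷ flat post ++ blanks (suc k))
    dropStep with flat-ʳ++-blank pre [] | ++-nonempty (flat post) blank (blanks k)
    ... | ls , e | s , rs , e′ rewrite e | e′ = dropFirst-run b r
    e : ∀ Z n → Z + (3 * Z + (3 * Z + suc ((1 + Z) + (3 * Z + n)))) + 3 ≡ 11 * Z + 5 + n
    e = solve-∀
    cost : suc (suc (length r)) + (3 * length (flat post) + (3 * length (flat post) + suc (3 + length r + (3 * length (flat pre) + n)))) ≤ 11 * Z + 5 + n
    cost = ≤-trans (+-mono-≤ B.field′≤ (+-mono-≤ B.3post≤ (+-mono-≤ B.3post≤ (s≤s (+-mono-≤ (s≤s B.field′≤) (+-monoˡ-≤ n B.3pre≤))))))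
                   (≤-trans (m≤m+n _ 3) (≤-reflexive (e Z n)))

  pop-empty : ∀ {G : Frag X} {H} pre post → Fits Z (pre ++ [] ∷ post) k →
              Steps G (At (pre ++ [] ∷ post) k) n x z →
              Steps (pop (length pre) (length post) G H) (At (pre ++ [] ∷ post) k) (opCost Z + n) x z
  pop-empty pre post fits cont rewrite At-split pre [] post k =
    run-mono cost (skips pre (test-run (backs-field pre [] cont)))
    where
    module B = Bounds pre [] post fits
    e : ∀ Z n → (3 * Z + suc (3 * Z + n)) + (14 * Z + 19) ≡ 20 * suc Z + n
    e = solve-∀
    cost : 3 * length (flat pre) + suc (3 * length (flat pre) + n) ≤ opCost Z + n
    cost = ≤-trans (+-mono-≤ B.3pre≤ (s≤s (+-monoˡ-≤ n B.3pre≤))) (pay (14 * Z + 19) n (≤-reflexive (e Z n)))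

  pop-run : ∀ {G : Frag X} {H} pre b r post → Fits Z (pre ++ (b ∷ r) ∷ post) k →
            Steps (H b) (At (pre ++ r ∷ post) (suc k)) n x z →
            Steps (pop (length pre) (length post) G H) (At (pre ++ (b ∷ r) ∷ post) k) (opCost Z + n) x z
  pop-run pre b r post fits cont rewrite At-split pre (b ∷ r) post k =
    run-mono cost (skips pre (head-test b fits cont))
    where
    module B = Bounds pre (b ∷ r) post fits
    head-test : ∀ {G H} b → Fits Z (pre ++ (b ∷ r) ∷ post) k → Steps (H b) (At (pre ++ r ∷ post) (suc k)) n x z →
                Steps (test (popBranch (length pre) (length post) G H))
                      (flat pre ʳ++ (blank ∷ []) , syms (b ∷ r) ++ blank ∷ flat post ++ blanks k) (suc (11 * Z + 5 + n)) x z
    head-test false fits cont = test-run (delete-run pre false r post fits cont)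
    head-test true  fits cont = test-run (delete-run pre true r post fits cont)
    e : ∀ Z n → (3 * Z + suc (11 * Z + 5 + n)) + (6 * Z + 14) ≡ 20 * suc Z + n
    e = solve-∀
    cost : 3 * length (flat pre) + suc (11 * Z + 5 + n) ≤ opCost Z + n
    cost = ≤-trans (+-monoˡ-≤ _ B.3pre≤) (pay (6 * Z + 14) n (≤-reflexive (e Z n)))

  newFront-run : ∀ {G : Frag X} fs → Fits Z fs (suc k) → Steps G (At ([] ∷ fs) k) n x z →
                 Steps (newFront (length fs) G) (At fs (suc k)) (opCost Z + n) x z
  newFront-run fs fits cont = run-mono cost (shifts fs (backs ([] ∷ fs) cont))
    where
    len≤ : suc (length (flat fs)) ≤ Z
    len≤ = m+n≤o⇒m≤o _ (≤-reflexive (trans (sym (+-suc _ k)) fits))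
    e : ∀ Z n → (3 * Z + suc (3 * Z + n)) + (14 * Z + 19) ≡ 20 * suc Z + n
    e = solve-∀
    cost : 3 * length (flat fs) + suc (3 * suc (length (flat fs)) + n) ≤ opCost Z + n
    cost = ≤-trans (+-mono-≤ (*-monoʳ-≤ 3 (≤-trans (n≤1+n _) len≤)) (s≤s (+-monoˡ-≤ n (*-monoʳ-≤ 3 len≤))))
                   (pay (14 * Z + 19) n (≤-reflexive (e Z n)))

  freeFront-run : ∀ {G : Frag X} fs → Fits Z ([] ∷ fs) k → Steps G (At fs (suc k)) n x z →
                  Steps (freeFront (length fs) G) (At ([] ∷ fs) k) (opCost Z + n) x z
  freeFront-run fs fits cont = run-mono cost (act-run ⟫ skips fs (unshifts fs cont))
    where
    len≤ : length (flat fs) ≤ Z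
    len≤ = ≤-trans (n≤1+n _) (m+n≤o⇒m≤o _ (≤-reflexive fits))
    e : ∀ Z n → suc (3 * Z + (3 * Z + suc n)) + (14 * Z + 18) ≡ 20 * suc Z + n
    e = solve-∀
    cost : suc (3 * length (flat fs) + (3 * length (flat fs) + suc n)) ≤ opCost Z + n
    cost = ≤-trans (s≤s (+-mono-≤ (*-monoʳ-≤ 3 len≤) (+-monoˡ-≤ (suc n) (*-monoʳ-≤ 3 len≤))))
                   (pay (14 * Z + 18) n (≤-reflexive (e Z n)))

-- A register language and its compilation

-- for i g h consumes register i bit by bit into a fresh front register, which holds the bits already seen,
-- and runs g or h on each bit; afterwards register i is restored.
data G : ℕ → Set where
  nop  : ∀ {d} → G d
  emit : ∀ {d} → Bool → G d
  _⨾_  : ∀ {d} → G d → G d → G d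
  for  : ∀ {d} → Fin d → G (suc d) → G (suc d) → G d
  lett : ∀ {d} → G d → G (suc d) → G d

infixr 5 _⨾_

Env : ℕ → Set
Env = Vec (List Bool)

infixl 6 _[_]≔_
_[_]≔_ : ∀ {d} → Env d → Fin d → List Bool → Env d
_[_]≔_ = Vec._[_]≔_

sweep : {A : Set} → (List Bool → Bool → List Bool → List A) → List Bool → List Bool → List A
sweep f p []      = []
sweep f p (b ∷ r) = f p b r ++ sweep f (p ++ b ∷ []) r

total : (List Bool → Bool → List Bool → ℕ) → List Bool → List Bool → ℕ
total f p []      = 0
total f p (b ∷ r) = (3 + f p b r) + total f (p ++ b ∷ []) r

⟦_⟧ : ∀ {d} → G d → Env d → List Bool
⟦ nop ⟧ ρ       = []
⟦ emit b ⟧ ρ    = b ∷ []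
⟦ g ⨾ h ⟧ ρ     = ⟦ g ⟧ ρ ++ ⟦ h ⟧ ρ
⟦ for i g h ⟧ ρ = sweep (λ p b r → if b then ⟦ h ⟧ (p ∷ ρ [ i ]≔ r) else ⟦ g ⟧ (p ∷ ρ [ i ]≔ r)) [] (Vec.lookup ρ i)
⟦ lett g h ⟧ ρ  = ⟦ h ⟧ (⟦ g ⟧ ρ ∷ ρ)

-- The unit is `opCost`. Each bit of a loop is charged a pop, a push and an exit, and again three
-- units for its restoration; a bit of a local register is charged three units for its transfer and
-- two for its removal. The constant 6 pays for creating and freeing the front register and for the
-- final tests of two machine loops. The same count also bounds the length of the output and the
-- growth of the fields.
ops : ∀ {d} → G d → Env d → ℕ
ops nop ρ         = 0
ops (emit b) ρ    = 1
ops (g ⨾ h) ρ     = ops g ρ + ops h ρ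
ops (for i g h) ρ = (total (λ p b r → if b then ops h (p ∷ ρ [ i ]≔ r) else ops g (p ∷ ρ [ i ]≔ r)) [] (Vec.lookup ρ i)
                    + 3 * length (Vec.lookup ρ i)) + 6
ops (lett g h) ρ  = (ops g ρ + 5 * length (⟦ g ⟧ ρ)) + (ops h (⟦ g ⟧ ρ ∷ ρ) + 6)

length-sweep : ∀ f t → (∀ p b r → length (f p b r) ≤ t p b r) → ∀ p r → length (sweep {Bool} f p r) ≤ total t p r
length-sweep f t h p []      = z≤n
length-sweep f t h p (b ∷ r) = ≤-trans (≤-reflexive (length-++ (f p b r)))
  (+-mono-≤ (≤-trans (h p b r) (m≤n+m _ 3)) (length-sweep f t h (p ++ b ∷ []) r))

length-⟦⟧ : ∀ {d} (g : G d) ρ → length (⟦ g ⟧ ρ) ≤ ops g ρ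
length-⟦⟧ nop ρ         = z≤n
length-⟦⟧ (emit b) ρ    = ≤-refl
length-⟦⟧ (g ⨾ h) ρ     = ≤-trans (≤-reflexive (length-++ (⟦ g ⟧ ρ))) (+-mono-≤ (length-⟦⟧ g ρ) (length-⟦⟧ h ρ))
length-⟦⟧ (for i g h) ρ = ≤-trans (length-sweep _ _ body [] (Vec.lookup ρ i)) (≤-trans (m≤m+n _ _) (m≤m+n _ 6))
  where
  body : ∀ p b r → length (if b then ⟦ h ⟧ (p ∷ ρ [ i ]≔ r) else ⟦ g ⟧ (p ∷ ρ [ i ]≔ r))
                   ≤ (if b then ops h (p ∷ ρ [ i ]≔ r) else ops g (p ∷ ρ [ i ]≔ r))
  body p false r = length-⟦⟧ g _
  body p true  r = length-⟦⟧ h _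
length-⟦⟧ (lett g h) ρ = ≤-trans (length-⟦⟧ h _) (≤-trans (m≤m+n _ 6) (m≤n+m _ (ops g ρ + 5 * length (⟦ g ⟧ ρ))))

ret : Bool → Frag Bool
ret v = act λ s → v , s , stay

behindCount : ∀ {d} → Fin d → ℕ
behindCount {suc d} zero    = d
behindCount {suc d} (suc i) = behindCount i

refill : ℕ → ℕ → ℕ → ℕ → Frag Bool
refill j e j′ e′ = pop j e (ret false) (λ b → push j′ e′ b (ret true))

-- Fields on the tape: the d registers, m suspended outputs, and the current output.
compile : ∀ {X : Set} {d} → G d → ℕ → Frag X → Frag X
forBody : ∀ {d} → Fin d → G (suc d) → G (suc d) → ℕ → Frag Bool

compile nop m K = K
compile {d = d} (emit b) m K = push (d + m) 0 b K
compile (g ⨾ h) m K = compile g m (compile h m K)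
compile {d = d} (for i g h) m K =
  newFront (d + suc m)
    (repeatF (forBody i g h m) »
     repeatF (refill 0 (d + suc m) (suc (toℕ i)) (behindCount i + suc m)) »
     freeFront (d + suc m) K)
compile {d = d} (lett g h) m K =
  compile g (suc m)
    (newFront (d + suc (suc m))
      (repeatF (refill (suc (d + suc m)) 0 0 (d + suc (suc m))) »
       compile h m
         (repeatF (pop 0 (d + suc m) (ret false) (λ _ → ret true)) »
          freeFront (d + suc m) K)))

forBody {d = d} i g h m = pop (suc (toℕ i)) (behindCount i + suc m) (ret false)
  (λ b → if b then compile h m (push 0 (d + suc m) true (ret true))
              else compile g m (push 0 (d + suc m) false (ret true)))

-- Correctness of the compilation

wt : List (List Bool) → ℕ
wt fs = length (flat fs)

Lay : ℕ → List (List Bool) → Zip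
Lay Z fs = At fs (Z ∸ wt fs)

lay-fits : ∀ {Z} fs → wt fs ≤ Z → Fits Z fs (Z ∸ wt fs)
lay-fits fs = m+[n∸m]≡n

room : ∀ {Z w} → w < Z → Z ∸ w ≡ suc (Z ∸ suc w)
room {suc Z} {zero}  (s≤s le) = refl
room {suc Z} {suc w} (s≤s le) = room le

wt-∷ : ∀ r fs → wt (r ∷ fs) ≡ suc (length r) + wt fs
wt-∷ r fs = sym (field≤ r fs)

wt-++ : ∀ fs gs → wt (fs ++ gs) ≡ wt fs + wt gs
wt-++ fs gs = trans (cong length (flat-++ fs gs)) (length-++ (flat fs))

wt-grow : ∀ pre b r post → wt (pre ++ (b ∷ r) ∷ post) ≡ suc (wt (pre ++ r ∷ post))
wt-grow pre b r post = trans (length-flat-split pre (b ∷ r) post)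
  (trans (+-suc (wt pre) _) (cong suc (sym (length-flat-split pre r post))))

wt-append : ∀ pre r w post → wt (pre ++ (r ++ w) ∷ post) ≡ length w + wt (pre ++ r ∷ post)
wt-append pre r w post = trans (length-flat-split pre (r ++ w) post)
  (trans (cong (λ l → wt pre + (suc l + wt post)) (length-++ r))
    (trans (e (wt pre) (length r) (length w) (wt post)) (cong (length w +_) (sym (length-flat-split pre r post)))))
  where
  e : ∀ p r w q → p + (suc (r + w) + q) ≡ w + (p + (suc r + q))
  e = solve-∀

module _ {X : Set} {K : Frag X} {Z n : ℕ} {x : X} {z : Zip} where

  push-lay : ∀ pre r post b {fs fs′ j e} → fs ≡ pre ++ r ∷ post → fs′ ≡ pre ++ (r ++ b ∷ []) ∷ post →
             length pre ≡ j → length post ≡ e → wt fs < Z →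
             Steps K (Lay Z fs′) n x z → Steps (push j e b K) (Lay Z fs) (opCost Z + n) x z
  push-lay pre r post b refl refl refl refl lt cont =
    subst (λ k → Steps (push (length pre) (length post) b K) (At (pre ++ r ∷ post) k) (opCost Z + n) x z) (sym (room lt))
      (push-run pre r post b (trans (+-suc _ _) (m+[n∸m]≡n lt))
        (subst (λ w → Steps K (At (pre ++ (r ++ b ∷ []) ∷ post) (Z ∸ w)) n x z) (wt-append pre r (b ∷ []) post) cont))

  pop-empty-lay : ∀ {H} pre post {fs j e} → fs ≡ pre ++ [] ∷ post →
                  length pre ≡ j → length post ≡ e → wt fs ≤ Z →
                  Steps K (Lay Z fs) n x z → Steps (pop j e K H) (Lay Z fs) (opCost Z + n) x z
  pop-empty-lay pre post refl refl refl le cont = pop-empty pre post (lay-fits (pre ++ [] ∷ post) le) cont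

  pop-lay : ∀ {H} pre b r post {fs fs′ j e} → fs ≡ pre ++ (b ∷ r) ∷ post → fs′ ≡ pre ++ r ∷ post →
            length pre ≡ j → length post ≡ e → wt fs ≤ Z →
            Steps (H b) (Lay Z fs′) n x z → Steps (pop j e K H) (Lay Z fs) (opCost Z + n) x z
  pop-lay {H} pre b r post refl refl refl refl le cont =
    pop-run pre b r post (lay-fits (pre ++ (b ∷ r) ∷ post) le)
      (subst (λ k → Steps (H b) (At (pre ++ r ∷ post) k) n x z)
             (trans (room lt) (cong (λ w → suc (Z ∸ w)) (sym (wt-grow pre b r post)))) cont)
    where
    lt : wt (pre ++ r ∷ post) < Z
    lt = subst (_≤ Z) (wt-grow pre b r post) le

  newFront-lay : ∀ fs {D} → length fs ≡ D → wt fs < Z →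
                 Steps K (Lay Z ([] ∷ fs)) n x z → Steps (newFront D K) (Lay Z fs) (opCost Z + n) x z
  newFront-lay fs refl lt cont =
    subst (λ k → Steps (newFront (length fs) K) (At fs k) (opCost Z + n) x z) (sym (room lt))
      (newFront-run fs (trans (+-suc _ _) (m+[n∸m]≡n lt)) cont)

  freeFront-lay : ∀ fs {D} → length fs ≡ D → wt ([] ∷ fs) ≤ Z →
                  Steps K (Lay Z fs) n x z → Steps (freeFront D K) (Lay Z ([] ∷ fs)) (opCost Z + n) x z
  freeFront-lay fs refl le cont =
    freeFront-run fs (lay-fits ([] ∷ fs) le)
      (subst (λ k → Steps K (At fs k) n x z) (room le) cont)

lay-extend : ∀ {Z} fs → wt fs < Z → Lay Z fs ≡ Lay Z (fs ++ [] ∷ [])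
lay-extend {Z} fs lt = begin
  At fs (Z ∸ wt fs)                        ≡⟨ cong (At fs) (room lt) ⟩
  At fs (suc (Z ∸ suc (wt fs)))            ≡⟨ cong (blank ∷ [] ,_) (sym (trans (cong (_++ blanks (Z ∸ suc (wt fs))) (flat-++ fs ([] ∷ []))) (++-assoc (flat fs) _ _))) ⟩
  At (fs ++ [] ∷ []) (Z ∸ suc (wt fs))     ≡⟨ cong (λ w → At (fs ++ [] ∷ []) (Z ∸ w)) (sym (trans (wt-++ fs ([] ∷ [])) (+-comm (wt fs) 1))) ⟩
  At (fs ++ [] ∷ []) (Z ∸ wt (fs ++ [] ∷ [])) ∎
  where open ≡-Reasoning

ret-lay : ∀ v fs {Z} → Steps (ret v) (Lay Z fs) 1 v (Lay Z fs)
ret-lay v []                   = act-run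
ret-lay v ([] ∷ fs)            = act-run
ret-lay v ((b ∷ r) ∷ fs)       = act-run

before behind : ∀ {d} → Env d → Fin d → List (List Bool)
before (v ∷ ρ) zero    = []
before (v ∷ ρ) (suc i) = v ∷ before ρ i
behind (v ∷ ρ) zero    = Vec.toList ρ
behind (v ∷ ρ) (suc i) = behind ρ i

split-≔ : ∀ {d} (ρ : Env d) i v → Vec.toList (ρ [ i ]≔ v) ≡ before ρ i ++ v ∷ behind ρ i
split-≔ (u ∷ ρ) zero    v = refl
split-≔ (u ∷ ρ) (suc i) v = cong (u ∷_) (split-≔ ρ i v)

length-before : ∀ {d} (ρ : Env d) i → length (before ρ i) ≡ toℕ i
length-before (v ∷ ρ) zero    = refl
length-before (v ∷ ρ) (suc i) = cong suc (length-before ρ i)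

length-toList : ∀ {d} (ρ : Env d) → length (Vec.toList ρ) ≡ d
length-toList []      = refl
length-toList (v ∷ ρ) = cong suc (length-toList ρ)

length-behind : ∀ {d} (ρ : Env d) i → length (behind ρ i) ≡ behindCount i
length-behind (v ∷ ρ) zero    = length-toList ρ
length-behind (v ∷ ρ) (suc i) = length-behind ρ i

≔-lookup : ∀ {d} (ρ : Env d) i → ρ [ i ]≔ Vec.lookup ρ i ≡ ρ
≔-lookup (v ∷ ρ) zero    = refl
≔-lookup (v ∷ ρ) (suc i) = cong (v ∷_) (≔-lookup ρ i)

fields : ∀ {d} → Env d → List (List Bool) → List Bool → List (List Bool)
fields ρ os o = Vec.toList ρ ++ os ++ o ∷ []

fields-at : ∀ {d} (ρ : Env d) i v os o → fields (ρ [ i ]≔ v) os o ≡ before ρ i ++ v ∷ (behind ρ i ++ os ++ o ∷ [])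
fields-at ρ i v os o = trans (cong (_++ (os ++ o ∷ [])) (split-≔ ρ i v)) (++-assoc (before ρ i) _ _)

length-snoc : ∀ {A : Set} (os : List A) (o : A) → length (os ++ o ∷ []) ≡ suc (length os)
length-snoc os o = trans (length-++ os) (+-comm (length os) 1)

length-fields : ∀ {d} (ρ : Env d) os o → length (fields ρ os o) ≡ d + suc (length os)
length-fields ρ os o = trans (length-++ (Vec.toList ρ)) (cong₂ _+_ (length-toList ρ) (length-snoc os o))

fields-out : ∀ {d} (ρ : Env d) os o → fields ρ os o ≡ (Vec.toList ρ ++ os) ++ o ∷ []
fields-out ρ os o = sym (++-assoc (Vec.toList ρ) os (o ∷ []))

wt-out : ∀ {d} (ρ : Env d) os o w → wt (fields ρ os (o ++ w)) ≡ length w + wt (fields ρ os o)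
wt-out ρ os o w = trans (cong wt (fields-out ρ os (o ++ w)))
  (trans (wt-append (Vec.toList ρ ++ os) o w []) (cong (λ f → length w + wt f) (sym (fields-out ρ os o))))

wt-shift : ∀ {d} (ρ : Env d) i b r os o → wt (fields (ρ [ i ]≔ (b ∷ r)) os o) ≡ suc (wt (fields (ρ [ i ]≔ r) os o))
wt-shift ρ i b r os o = trans (cong wt (fields-at ρ i (b ∷ r) os o))
  (trans (wt-grow (before ρ i) b r _) (cong (λ f → suc (wt f)) (sym (fields-at ρ i r os o))))

1≤opCost : ∀ Z → 1 ≤ opCost Z
1≤opCost Z = s≤s z≤n

module _ {Z : ℕ} where

  private
    c = opCost Z

  refill-run : ∀ {d} (ρ : Env d) i os o p r → wt (p ∷ fields (ρ [ i ]≔ r) os o) ≤ Z →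
    Steps (repeatF (refill 0 (d + suc (length os)) (suc (toℕ i)) (behindCount i + suc (length os))))
          (Lay Z (p ∷ fields (ρ [ i ]≔ r) os o)) ((3 * length p + 2) * c) tt
          (Lay Z ([] ∷ fields (ρ [ i ]≔ (r ++ p)) os o))
  refill-run {d} ρ i os o [] r le rewrite ++-identityʳ r =
    repeat-done (run-mono cost
      (pop-empty-lay [] F refl refl (length-fields (ρ [ i ]≔ r) os o) le (ret-lay false ([] ∷ F) {Z})))
    where
    F = fields (ρ [ i ]≔ r) os o
    cost : c + 1 ≤ 2 * c
    cost = ≤-trans (+-monoʳ-≤ c (1≤opCost Z)) (≤-reflexive (cong (c +_) (sym (+-identityʳ c))))
  refill-run {d} ρ i os o (b ∷ p) r le =
    subst (λ v → Steps _ (Lay Z ((b ∷ p) ∷ fields (ρ [ i ]≔ r) os o)) ((3 * suc (length p) + 2) * c) tt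
                         (Lay Z ([] ∷ fields (ρ [ i ]≔ v) os o))) (++-assoc r (b ∷ []) p)
      (run-mono cost (repeat-again
        (pop-lay [] b p (fields (ρ [ i ]≔ r) os o) refl refl refl (length-fields (ρ [ i ]≔ r) os o) le
          (push-lay (p ∷ before ρ i) r (behind ρ i ++ os ++ o ∷ []) b {fs = p ∷ fields (ρ [ i ]≔ r) os o} {fs′ = p ∷ fields (ρ [ i ]≔ (r ++ b ∷ [])) os o} (cong (p ∷_) (fields-at ρ i r os o)) (cong (p ∷_) (fields-at ρ i _ os o))
             (cong suc (length-before ρ i)) lenB le″ (ret-lay true (p ∷ fields (ρ [ i ]≔ (r ++ b ∷ [])) os o))))
        (refill-run ρ i os o p (r ++ b ∷ []) le′)))
    where
    lenB : length (behind ρ i ++ os ++ o ∷ []) ≡ behindCount i + suc (length os)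
    lenB = trans (length-++ (behind ρ i)) (cong₂ _+_ (length-behind ρ i) (length-snoc os o))
    le″ : wt (p ∷ fields (ρ [ i ]≔ r) os o) < Z
    le″ = le
    le′ : wt (p ∷ fields (ρ [ i ]≔ (r ++ b ∷ [])) os o) ≤ Z
    le′ = ≤-trans (≤-reflexive (trans (cong wt (cong (p ∷_) (fields-at ρ i (r ++ b ∷ []) os o)))
            (trans (wt-append (p ∷ before ρ i) r (b ∷ []) (behind ρ i ++ os ++ o ∷ [])) (cong (λ f → suc (wt (p ∷ f))) (sym (fields-at ρ i r os o)))))) le
    e : ∀ c l → (c + (c + c)) + (3 * l + 2) * c ≡ (3 * suc l + 2) * c
    e = solve-∀
    cost : (c + (c + 1)) + (3 * length p + 2) * c ≤ (3 * suc (length p) + 2) * c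
    cost = ≤-trans (+-monoˡ-≤ _ (+-monoʳ-≤ c (+-monoʳ-≤ c (1≤opCost Z)))) (≤-reflexive (e c (length p)))

  drain-run : ∀ F {D} → length F ≡ D → ∀ u → wt (u ∷ F) ≤ Z →
    Steps (repeatF (pop 0 D (ret false) (λ _ → ret true))) (Lay Z (u ∷ F)) ((2 * length u + 2) * c) tt (Lay Z ([] ∷ F))
  drain-run F len [] le =
    repeat-done (run-mono (≤-trans (+-monoʳ-≤ c (1≤opCost Z)) (≤-reflexive (cong (c +_) (sym (+-identityʳ c)))))
      (pop-empty-lay [] F refl refl len le (ret-lay false ([] ∷ F) {Z})))
  drain-run F len (b ∷ u) le = run-mono cost′ (repeat-again
    (pop-lay [] b u F refl refl refl len le (ret-lay true (u ∷ F) {Z}))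
    (drain-run F len u (≤-trans (n≤1+n _) le)))
    where
    e : ∀ c l → (c + c) + (2 * l + 2) * c ≡ (2 * suc l + 2) * c
    e = solve-∀
    cost′ : (c + 1) + (2 * length u + 2) * c ≤ (2 * suc (length u) + 2) * c
    cost′ = ≤-trans (+-monoˡ-≤ _ (+-monoʳ-≤ c (1≤opCost Z))) (≤-reflexive (e c (length u)))

  -- Fragments are compiled together with what follows them, so the induction extends a given run of
  -- the continuation `K`. Since `ops` also bounds the growth of the fields, the hypothesis keeps
  -- every intermediate layout within `Z`, and each operation costs at most `opCost Z`.
  compile-run : ∀ {d} (g : G d) ρ os o {X : Set} {K : Frag X} {n x z} →
    wt (fields ρ os o) + ops g ρ ≤ Z →
    Steps K (Lay Z (fields ρ os (o ++ ⟦ g ⟧ ρ))) n x z →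
    Steps (compile g (length os) K) (Lay Z (fields ρ os o)) (ops g ρ * c + n) x z
  compile-run nop ρ os o le cont rewrite ++-identityʳ o = cont
  compile-run (emit b) ρ os o {n = n} le cont =
    run-mono (≤-reflexive (cong (_+ n) (sym (+-identityʳ c))))
      (push-lay (Vec.toList ρ ++ os) o [] b (fields-out ρ os o) (fields-out ρ os _)
        (trans (length-++ (Vec.toList ρ)) (cong (_+ length os) (length-toList ρ))) refl
        (subst (_≤ Z) (+-comm _ 1) le) cont)
  compile-run (g ⨾ h) ρ os o {K = K} {n} {x} {z} le cont =
    run-mono (≤-reflexive cost)
      (compile-run g ρ os o (≤-trans (+-monoʳ-≤ _ (m≤m+n (ops g ρ) _)) le)
        (compile-run h ρ os (o ++ ⟦ g ⟧ ρ) le′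
          (subst (λ w → Steps K (Lay Z (fields ρ os w)) n x z) (sym (++-assoc o (⟦ g ⟧ ρ) (⟦ h ⟧ ρ))) cont)))
    where
    le′ : wt (fields ρ os (o ++ ⟦ g ⟧ ρ)) + ops h ρ ≤ Z
    le′ = ≤-trans (+-monoˡ-≤ (ops h ρ) (≤-trans (≤-reflexive (wt-out ρ os o (⟦ g ⟧ ρ))) (+-monoˡ-≤ _ (length-⟦⟧ g ρ))))
            (≤-trans (≤-reflexive (e (ops g ρ) (wt (fields ρ os o)) (ops h ρ))) le)
      where
      e : ∀ a w b → (a + w) + b ≡ w + (a + b)
      e = solve-∀
    cost : ops g ρ * c + (ops h ρ * c + n) ≡ (ops g ρ + ops h ρ) * c + n
    cost = e (ops g ρ) (ops h ρ) c n
      where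
      e : ∀ a b c n → a * c + (b * c + n) ≡ (a + b) * c + n
      e = solve-∀
  compile-run {d} (for i g h) ρ os o {K = K} {n} {x} {z} le cont =
    run-mono (≤-reflexive (cost (total t [] r₀) (length r₀) c n))
      (newFront-lay (fields ρ os o) (length-fields ρ os o) start<
        (subst (λ ρ′ → Steps (repeatF (forBody i g h m)) (Lay Z ([] ∷ fields ρ′ os o)) ((total t [] r₀ + 2) * c) tt
                             (Lay Z (r₀ ∷ fields (ρ [ i ]≔ []) os (o ++ w)))) (≔-lookup ρ i) (loop r₀ [] o loop≤)
         ⟫ subst (λ ρ′ → Steps _ (Lay Z (r₀ ∷ fields (ρ [ i ]≔ []) os (o ++ w))) ((3 * length r₀ + 2) * c) tt
                             (Lay Z ([] ∷ fields ρ′ os (o ++ w)))) (≔-lookup ρ i) (refill-run ρ i os (o ++ w) r₀ [] refill≤)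
         ⟫ freeFront-lay (fields ρ os (o ++ w)) (length-fields ρ os (o ++ w)) free≤ cont))
    where
    m = length os
    r₀ = Vec.lookup ρ i
    f : List Bool → Bool → List Bool → List Bool
    f p b r = if b then ⟦ h ⟧ (p ∷ ρ [ i ]≔ r) else ⟦ g ⟧ (p ∷ ρ [ i ]≔ r)
    t : List Bool → Bool → List Bool → ℕ
    t p b r = if b then ops h (p ∷ ρ [ i ]≔ r) else ops g (p ∷ ρ [ i ]≔ r)
    w = sweep f [] r₀

    f≤t : ∀ p b r → length (f p b r) ≤ t p b r
    f≤t p false r = length-⟦⟧ g _
    f≤t p true  r = length-⟦⟧ h _

    body-run : ∀ b p r o → wt (p ∷ fields (ρ [ i ]≔ r) os o) + suc (t p b r) ≤ Z →
      Steps (if b then compile h m (push 0 (d + suc m) true (ret true)) else compile g m (push 0 (d + suc m) false (ret true)))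
            (Lay Z (p ∷ fields (ρ [ i ]≔ r) os o)) (t p b r * c + (c + 1)) true
            (Lay Z ((p ++ b ∷ []) ∷ fields (ρ [ i ]≔ r) os (o ++ f p b r)))
    body-run b p r o le = go b le
      where
      W = wt (p ∷ fields (ρ [ i ]≔ r) os o)
      finish : ∀ b → W + suc (t p b r) ≤ Z →
        Steps (push 0 (d + suc m) b (ret true)) (Lay Z (p ∷ fields (ρ [ i ]≔ r) os (o ++ f p b r))) (c + 1) true
              (Lay Z ((p ++ b ∷ []) ∷ fields (ρ [ i ]≔ r) os (o ++ f p b r)))
      finish b le = push-lay [] p (fields (ρ [ i ]≔ r) os (o ++ f p b r)) b refl refl refl (length-fields (ρ [ i ]≔ r) os (o ++ f p b r))
        (≤-trans (s≤s (≤-trans (≤-reflexive (wt-out (p ∷ ρ [ i ]≔ r) os o (f p b r))) (+-monoˡ-≤ W (f≤t p b r))))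
                 (≤-trans (≤-reflexive (+-comm (suc (t p b r)) W)) le))
        (ret-lay true ((p ++ b ∷ []) ∷ fields (ρ [ i ]≔ r) os (o ++ f p b r)) {Z})
      go : ∀ b → W + suc (t p b r) ≤ Z → Steps (if b then compile h m (push 0 (d + suc m) true (ret true)) else compile g m (push 0 (d + suc m) false (ret true)))
            (Lay Z (p ∷ fields (ρ [ i ]≔ r) os o)) (t p b r * c + (c + 1)) true
            (Lay Z ((p ++ b ∷ []) ∷ fields (ρ [ i ]≔ r) os (o ++ f p b r)))
      go false le = compile-run g (p ∷ ρ [ i ]≔ r) os o (≤-trans (+-monoʳ-≤ W (n≤1+n _)) le) (finish false le)
      go true  le = compile-run h (p ∷ ρ [ i ]≔ r) os o (≤-trans (+-monoʳ-≤ W (n≤1+n _)) le) (finish true le)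

    lenB : ∀ o → length (behind ρ i ++ os ++ o ∷ []) ≡ behindCount i + suc (length os)
    lenB o = trans (length-++ (behind ρ i)) (cong₂ _+_ (length-behind ρ i) (length-snoc os o))

    loop : ∀ r p o → wt (p ∷ fields (ρ [ i ]≔ r) os o) + total t p r ≤ Z →
      Steps (repeatF (forBody i g h m)) (Lay Z (p ∷ fields (ρ [ i ]≔ r) os o)) ((total t p r + 2) * c) tt
            (Lay Z ((p ++ r) ∷ fields (ρ [ i ]≔ []) os (o ++ sweep f p r)))
    loop [] p o le rewrite ++-identityʳ p | ++-identityʳ o =
      repeat-done (run-mono cost₀
        (pop-empty-lay (p ∷ before ρ i) (behind ρ i ++ os ++ o ∷ []) {fs = p ∷ fields (ρ [ i ]≔ []) os o}
          (cong (p ∷_) (fields-at ρ i [] os o)) (cong suc (length-before ρ i)) (lenB o)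
          (≤-trans (m≤m+n _ 0) le) (ret-lay false (p ∷ fields (ρ [ i ]≔ []) os o) {Z})))
      where
      cost₀ : c + 1 ≤ 2 * c
      cost₀ = ≤-trans (+-monoʳ-≤ c (1≤opCost Z)) (≤-reflexive (cong (c +_) (sym (+-identityʳ c))))
    loop (b ∷ r) p o le =
      subst₂ (λ q u → Steps (repeatF (forBody i g h m)) (Lay Z (p ∷ fields (ρ [ i ]≔ (b ∷ r)) os o)) ((total t p (b ∷ r) + 2) * c) tt
                            (Lay Z (q ∷ fields (ρ [ i ]≔ []) os u)))
        (++-assoc p (b ∷ []) r) (++-assoc o (f p b r) (sweep f (p ++ b ∷ []) r))
        (run-mono cost₁ (repeat-again
          (pop-lay (p ∷ before ρ i) b r (behind ρ i ++ os ++ o ∷ []) {fs = p ∷ fields (ρ [ i ]≔ (b ∷ r)) os o} {fs′ = p ∷ fields (ρ [ i ]≔ r) os o}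
            (cong (p ∷_) (fields-at ρ i (b ∷ r) os o)) (cong (p ∷_) (fields-at ρ i r os o))
            (cong suc (length-before ρ i)) (lenB o) (≤-trans (m≤m+n _ _) le)
            (body-run b p r o (≤-trans (m≤m+n _ (suc (suc (suc rest)))) (≤-trans (≤-reflexive (e W T rest)) le′))))
          (loop r (p ++ b ∷ []) (o ++ f p b r) next≤)))
      where
      W = wt (p ∷ fields (ρ [ i ]≔ r) os o)
      T = t p b r
      rest = total t (p ++ b ∷ []) r
      le′ : suc W + ((3 + T) + rest) ≤ Z
      le′ = subst (λ v → v + ((3 + T) + rest) ≤ Z)
        (trans (wt-∷ p (fields (ρ [ i ]≔ (b ∷ r)) os o)) (trans (cong (suc (length p) +_) (wt-shift ρ i b r os o))
          (trans (+-suc (suc (length p)) (wt (fields (ρ [ i ]≔ r) os o))) (cong suc (sym (wt-∷ p (fields (ρ [ i ]≔ r) os o))))))) le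
      e : ∀ W T rest → (W + suc T) + suc (suc (suc rest)) ≡ suc W + ((3 + T) + rest)
      e = solve-∀
      next≤ : wt ((p ++ b ∷ []) ∷ fields (ρ [ i ]≔ r) os (o ++ f p b r)) + rest ≤ Z
      next≤ = ≤-trans (+-monoˡ-≤ rest (≤-trans (≤-reflexive
                (trans (wt-append [] p (b ∷ []) (fields (ρ [ i ]≔ r) os (o ++ f p b r)))
                       (cong suc (wt-out (p ∷ ρ [ i ]≔ r) os o (f p b r))))) (s≤s (+-monoˡ-≤ W (f≤t p b r)))))
              (≤-trans (m≤m+n _ 3) (≤-trans (≤-reflexive (e′ W T rest)) le′))
        where
        e′ : ∀ W T rest → (suc (T + W) + rest) + 3 ≡ suc W + ((3 + T) + rest)
        e′ = solve-∀
      cost₁ : (c + (T * c + (c + 1))) + (rest + 2) * c ≤ (((3 + T) + rest) + 2) * c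
      cost₁ = ≤-trans (+-monoˡ-≤ _ (+-monoʳ-≤ c (+-monoʳ-≤ (T * c) (+-monoʳ-≤ c (1≤opCost Z))))) (≤-reflexive (e₁ c T rest))
        where
        e₁ : ∀ c T rest → (c + (T * c + (c + c))) + (rest + 2) * c ≡ (((3 + T) + rest) + 2) * c
        e₁ = solve-∀

    W₀ = wt (fields ρ os o)
    T₀ = total t [] r₀
    start< : W₀ < Z
    start< = ≤-trans (≤-trans (m≤m+n _ ((T₀ + 3 * length r₀) + 5)) (≤-reflexive (e W₀ T₀ (3 * length r₀)))) le
      where
      e : ∀ W T q → suc W + ((T + q) + 5) ≡ W + ((T + q) + 6)
      e = solve-∀
    loop≤ : wt ([] ∷ fields (ρ [ i ]≔ r₀) os o) + T₀ ≤ Z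
    loop≤ = ≤-trans (≤-reflexive (cong (λ ρ′ → suc (wt (fields ρ′ os o)) + T₀) (≔-lookup ρ i)))
              (≤-trans (m≤m+n _ (3 * length r₀ + 5)) (≤-trans (≤-reflexive (e W₀ T₀ (3 * length r₀))) le))
      where
      e : ∀ W T q → (suc W + T) + (q + 5) ≡ W + ((T + q) + 6)
      e = solve-∀
    out≤ : wt (fields ρ os (o ++ w)) ≤ T₀ + W₀
    out≤ = ≤-trans (≤-reflexive (wt-out ρ os o w)) (+-monoˡ-≤ W₀ (length-sweep f t f≤t [] r₀))
    free≤ : wt ([] ∷ fields ρ os (o ++ w)) ≤ Z
    free≤ = ≤-trans (s≤s out≤) (≤-trans (m≤m+n _ (3 * length r₀ + 5)) (≤-trans (≤-reflexive (e W₀ T₀ (3 * length r₀))) le))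
      where
      e : ∀ W T q → suc (T + W) + (q + 5) ≡ W + ((T + q) + 6)
      e = solve-∀
    refill≤ : wt (r₀ ∷ fields (ρ [ i ]≔ []) os (o ++ w)) ≤ Z
    refill≤ = ≤-trans (≤-reflexive same) free≤
      where
      same : wt (r₀ ∷ fields (ρ [ i ]≔ []) os (o ++ w)) ≡ wt ([] ∷ fields ρ os (o ++ w))
      -- The loop has merely moved the contents of register `i` to the front, so the weight is that
      -- of the restored environment with an empty front register.
      same = trans (wt-∷ r₀ (fields (ρ [ i ]≔ []) os (o ++ w)))
        (cong suc (trans (cong (length r₀ +_) (cong wt (fields-at ρ i [] os (o ++ w))))
          (trans (sym (wt-append (before ρ i) [] r₀ (behind ρ i ++ os ++ (o ++ w) ∷ [])))
            (trans (cong wt (sym (fields-at ρ i r₀ os (o ++ w)))) (cong (λ ρ′ → wt (fields ρ′ os (o ++ w))) (≔-lookup ρ i))))))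
    cost : ∀ T q c n → c + ((T + 2) * c + ((3 * q + 2) * c + (c + n))) ≡ ((T + 3 * q) + 6) * c + n
    cost = solve-∀
  compile-run {d} (lett g h) ρ os o {K = K} {n} {x} {z} le cont =
    run-mono (≤-reflexive (cost (ops g ρ) (length w) (ops h (w ∷ ρ)) c n))
      (subst (λ y → Steps (compile (lett g h) m K) y (ops g ρ * c + n₁) x z) (sym (trans (lay-extend F start<) (cong (Lay Z) (sym (inner [])))))
        (subst (λ l → Steps (compile g l rest₁) (Lay Z (fields ρ (os ++ o ∷ []) [])) (ops g ρ * c + n₁) x z)
               (length-snoc os o)
          (compile-run g ρ (os ++ o ∷ []) [] g≤
            (subst (λ y → Steps rest₁ y n₁ x z) (cong (Lay Z) (sym (inner w)))
              (newFront-lay (F ++ w ∷ []) lenFw new<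
                (move-run F (length-fields ρ os o) w [] move≤ ⟫
                 subst (λ y → Steps rest₂ y n₂ x z) (lay-extend (w ∷ F) shrink<)
                   (compile-run h (w ∷ ρ) os o h≤
                     (drain-run F′ (length-fields ρ os (o ++ v)) w drain≤ ⟫
                      freeFront-lay F′ (length-fields ρ os (o ++ v)) (≤-trans (s≤s (m≤n+m _ (length w))) (subst (_≤ Z) (wt-∷ w F′) drain≤)) cont))))))))
    where
    m = length os
    w = ⟦ g ⟧ ρ
    v = ⟦ h ⟧ (w ∷ ρ)
    F = fields ρ os o
    F′ = fields ρ os (o ++ v)
    n₂ = ops h (w ∷ ρ) * c + ((2 * length w + 2) * c + (c + n))
    n₁ = c + ((3 * length w + 2) * c + n₂)
    rest₂ = compile h m (repeatF (pop 0 (d + suc m) (ret false) (λ _ → ret true)) » freeFront (d + suc m) K)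
    rest₁ = newFront (d + suc (suc m)) (repeatF (refill (suc (d + suc m)) 0 0 (d + suc (suc m))) » rest₂)

    inner : ∀ u → fields ρ (os ++ o ∷ []) u ≡ F ++ u ∷ []
    inner u = sym (++-assoc (Vec.toList ρ) (os ++ o ∷ []) (u ∷ []))

    lenFw : ∀ {u} → length (F ++ u ∷ []) ≡ d + suc (suc m)
    lenFw {u} = trans (length-snoc F u) (trans (cong suc (length-fields ρ os o)) (sym (+-suc d (suc m))))

    move-run : ∀ F → length F ≡ d + suc m → ∀ u v → wt (v ∷ F ++ u ∷ []) ≤ Z →
      Steps (repeatF (refill (suc (d + suc m)) 0 0 (d + suc (suc m)))) (Lay Z (v ∷ F ++ u ∷ [])) ((3 * length u + 2) * c) tt
            (Lay Z ((v ++ u) ∷ F ++ [] ∷ []))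
    move-run F len [] v le rewrite ++-identityʳ v =
      repeat-done (run-mono (≤-trans (+-monoʳ-≤ c (1≤opCost Z)) (≤-reflexive (cong (c +_) (sym (+-identityʳ c)))))
        (pop-empty-lay (v ∷ F) [] refl (cong suc len) refl le (ret-lay false (v ∷ F ++ [] ∷ []) {Z})))
    move-run F len (b ∷ u) v le =
      subst (λ q → Steps _ (Lay Z (v ∷ F ++ (b ∷ u) ∷ [])) ((3 * suc (length u) + 2) * c) tt (Lay Z (q ∷ F ++ [] ∷ [])))
        (++-assoc v (b ∷ []) u)
        (run-mono cost′ (repeat-again
          (pop-lay (v ∷ F) b u [] {fs = v ∷ F ++ (b ∷ u) ∷ []} {fs′ = v ∷ F ++ u ∷ []} refl refl (cong suc len) refl le
            (push-lay [] v (F ++ u ∷ []) b refl refl refl lenFu less (ret-lay true ((v ++ b ∷ []) ∷ F ++ u ∷ []) {Z})))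
          (move-run F len u (v ++ b ∷ []) (≤-trans (≤-reflexive (wt-append [] v (b ∷ []) (F ++ u ∷ []))) less))))
      where
      lenFu : length (F ++ u ∷ []) ≡ d + suc (suc m)
      lenFu = trans (length-snoc F u) (trans (cong suc len) (sym (+-suc d (suc m))))
      less : wt (v ∷ F ++ u ∷ []) < Z
      less = subst (_≤ Z) (wt-grow (v ∷ F) b u []) le
      e : ∀ c l → (c + (c + c)) + (3 * l + 2) * c ≡ (3 * suc l + 2) * c
      e = solve-∀
      cost′ : (c + (c + 1)) + (3 * length u + 2) * c ≤ (3 * suc (length u) + 2) * c
      cost′ = ≤-trans (+-monoˡ-≤ _ (+-monoʳ-≤ c (+-monoʳ-≤ c (1≤opCost Z)))) (≤-reflexive (e c (length u)))

    W = wt F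
    og = ops g ρ
    oh = ops h (w ∷ ρ)
    l = length w
    wtF[] : ∀ u → wt (F ++ u ∷ []) ≡ W + suc (length u)
    wtF[] u = trans (wt-++ F (u ∷ [])) (cong (W +_) (trans (wt-∷ u []) (+-identityʳ _)))
    start< : W < Z
    start< = ≤-trans (≤-trans (m≤m+n (suc W) (((og + 5 * l) + oh) + 5)) (≤-reflexive (e W og (5 * l) oh))) le
      where
      e : ∀ W a b h → suc W + (((a + b) + h) + 5) ≡ W + ((a + b) + (h + 6))
      e = solve-∀
    g≤ : wt (fields ρ (os ++ o ∷ []) []) + ops g ρ ≤ Z
    g≤ = ≤-trans (≤-reflexive (cong (_+ og) (trans (cong wt (inner [])) (wtF[] []))))
           (≤-trans (m≤m+n _ ((5 * l + oh) + 5)) (≤-trans (≤-reflexive (e W og (5 * l) oh)) le))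
      where
      e : ∀ W a b h → ((W + 1) + a) + ((b + h) + 5) ≡ W + ((a + b) + (h + 6))
      e = solve-∀
    new< : wt (F ++ w ∷ []) < Z
    new< = ≤-trans (≤-reflexive (cong suc (wtF[] w))) (≤-trans (m≤m+n _ (((og + 4 * l) + oh) + 4)) (≤-trans (≤-reflexive (e W og l oh)) le))
      where
      e : ∀ W a l h → suc (W + suc l) + (((a + 4 * l) + h) + 4) ≡ W + ((a + 5 * l) + (h + 6))
      e = solve-∀
    move≤ : wt ([] ∷ F ++ w ∷ []) ≤ Z
    move≤ = new<
    shrink< : wt (w ∷ F) < Z
    shrink< = ≤-trans (≤-reflexive (trans (cong suc (trans (wt-∷ w F) (+-comm (suc l) W))) (cong suc (sym (wtF[] w))))) new<
    h≤ : wt (fields (w ∷ ρ) os o) + oh ≤ Z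
    h≤ = ≤-trans (≤-reflexive (cong (_+ oh) (wt-∷ w F))) (≤-trans (m≤m+n _ ((og + 4 * l) + 5)) (≤-trans (≤-reflexive (e W og l oh)) le))
      where
      e : ∀ W a l h → ((suc l + W) + h) + ((a + 4 * l) + 5) ≡ W + ((a + 5 * l) + (h + 6))
      e = solve-∀
    drain≤ : wt (w ∷ F′) ≤ Z
    drain≤ = ≤-trans (≤-reflexive (wt-out (w ∷ ρ) os o v))
      (≤-trans (+-monoˡ-≤ _ (length-⟦⟧ h (w ∷ ρ))) (≤-trans (≤-reflexive (+-comm oh _)) h≤))
    cost : ∀ a l h c n → a * c + (c + ((3 * l + 2) * c + (h * c + ((2 * l + 2) * c + (c + n))))) ≡ ((a + 5 * l) + (h + 6)) * c + n
    cost = solve-∀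

-- From fragments to Turing machines

nth : List Sym → ℕ → Sym
nth []       i       = blank
nth (s ∷ ss) zero    = s
nth (s ∷ ss) (suc i) = nth ss i

nth-head : ∀ pre rs → nth (pre ++ rs) (length pre) ≡ hd rs
nth-head []        []       = refl
nth-head []        (s ∷ rs) = refl
nth-head (p ∷ pre) rs       = nth-head pre rs

nth-write : ∀ pre s rs i → nth (pre ++ s ∷ tl rs) i ≡ (if i ≡ᵇ length pre then s else nth (pre ++ rs) i)
nth-write []        s rs       zero    = refl
nth-write []        s []       (suc i) = refl
nth-write []        s (r ∷ rs) (suc i) = refl
nth-write (p ∷ pre) s rs       zero    = refl
nth-write (p ∷ pre) s rs       (suc i) = nth-write pre s rs i

tapeOf : Zip → ℕ → Sym
tapeOf (ls , rs) = nth (ls ʳ++ rs)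

tapeOf-head : ∀ ls rs → tapeOf (ls , rs) (length ls) ≡ hd rs
tapeOf-head ls rs = trans (cong₂ nth (ʳ++-defn ls) (sym (length-reverse ls))) (nth-head (reverse ls) rs)

tapeOf-put : ∀ m ls s rs i → tapeOf (put m ls s (tl rs)) i ≡ (if i ≡ᵇ length ls then s else tapeOf (ls , rs) i)
tapeOf-put m ls s rs i = trans (moved m ls) (trans (cong (λ l → nth l i) (ʳ++-defn ls))
  (trans (nth-write (reverse ls) s rs i)
    (cong₂ (λ n l → if i ≡ᵇ n then s else nth l i) (length-reverse ls) (sym (ʳ++-defn ls)))))
  where
  moved : ∀ m ls → tapeOf (put m ls s (tl rs)) i ≡ nth (ls ʳ++ (s ∷ tl rs)) i
  moved left  []       = refl
  moved left  (l ∷ ls) = refl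
  moved right ls       = refl
  moved stay  ls       = refl

put-head : ∀ m ls s rs → length (proj₁ (put m ls s rs)) ≡ move m (length ls)
put-head left  []       s rs = refl
put-head left  (l ∷ ls) s rs = refl
put-head right ls       s rs = refl
put-head stay  ls       s rs = refl

module Machine (F : Frag ⊤) where

  embedState : Fin (size F) ⊎ ⊤ → Fin (suc (size F))
  embedState (inj₁ q) = suc q
  embedState (inj₂ _) = zero

  machine : TM
  machine = record
    { nStates   = size F
    ; start     = suc (st F)
    ; halting   = λ { zero → true ; (suc _) → false }
    ; accepting = λ _ → false
    ; δ         = λ { zero    s → zero , s , stay
                    ; (suc q) s → embedState (proj₁ (δ F q s)) , proj₂ (δ F q s) }
    }

  -- A zipper is finite and a tape is a function, so they are compared cell by cell, with `nth`
  -- reading blanks beyond the end of the zipper.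
  record Matches (c : Config machine) (q : Fin (suc (size F))) (z : Zip) : Set where
    constructor matches
    field
      state≡ : Config.state c ≡ q
      head≡  : Config.head c ≡ length (proj₁ z)
      tape≡  : ∀ i → Config.tape c i ≡ tapeOf z i

  step-matches : ∀ {c q ls rs o s m} → δ F q (hd rs) ≡ (o , s , m) → Matches c (suc q) (ls , rs) →
                 Matches (step machine c) (embedState o) (put m ls s (tl rs))
  step-matches {cfg .(suc q) .(length ls) t} {q} {ls} {rs} {o} {s} {m} e (matches refl refl t≡)
    rewrite trans (t≡ (length ls)) (tapeOf-head ls rs) | e =
    matches refl (sym (put-head m ls s (tl rs))) λ i →
      trans (cong (if i ≡ᵇ length ls then s else_) (t≡ i)) (sym (tapeOf-put m ls s rs i))

  run-halted : ∀ {c z} n → Matches c zero z → Matches (run machine n c) zero z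
  run-halted zero    mt = mt
  run-halted {cfg .zero h t} (suc n) (matches refl a b) = run-halted n (matches refl a b)

  simulate : ∀ {c q z n x z′} → Run F q z n x z′ → Matches c (suc q) z → ∀ {N} → n ≤ N →
             Matches (run machine N c) zero z′
  simulate (exit e)   mt {suc N} (s≤s le) = run-halted N (step-matches e mt)
  simulate (more e r) mt {suc N} (s≤s le) = simulate r (step-matches e mt) le

nth-blanks : ∀ k i → nth (replicate k blank) i ≡ blank
nth-blanks zero    i       = refl
nth-blanks (suc k) zero    = refl
nth-blanks (suc k) (suc i) = nth-blanks k i

inputTape-nth : ∀ x k i → inputTape x i ≡ nth (syms x ++ replicate k blank) i
inputTape-nth []      k i       = sym (nth-blanks k i)
inputTape-nth (b ∷ x) k zero    = refl
inputTape-nth (b ∷ x) k (suc i) = inputTape-nth x k i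

readsAt-nth : ∀ {t} w rs n → (∀ i → t (n + i) ≡ nth (syms w ++ blank ∷ rs) i) → readsAt t n w
readsAt-nth {t} []      rs n e = trans (cong t (sym (+-identityʳ n))) (e 0)
readsAt-nth {t} (b ∷ w) rs n e =
  trans (cong t (sym (+-identityʳ n))) (e 0) ,
  readsAt-nth w rs (suc n) (λ i → trans (cong t (sym (+-suc n i))) (e (suc i)))

-- The input starts in cell 0 and is first shifted to make room for the end marker. At the end the
-- input is deleted and the output moves one cell to the left, over the marker, because it must be
-- readable from cell 0.
program : G 1 → Frag ⊤
program g =
  shiftField » moveR » backField »
  compile g 0 (repeatF (pop 0 1 (ret false) (λ _ → ret true)) » freeFront 1 (scan right stay » unshiftField))

runTime : ℕ → ℕ → ℕ
runTime n o = suc n + (1 + ((3 + n) + (o * opCost Z + ((2 * n + 2) * opCost Z + (opCost Z + (suc o + (2 + o)))))))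
  where Z = (n + 2) + o

program-run : ∀ g x → Σ ℕ λ k → Σ (List Sym) λ rs →
              Steps (program g) ([] , syms x ++ replicate k blank) (runTime (length x) (ops g (x ∷ []))) tt
                                ([] , syms (⟦ g ⟧ (x ∷ [])) ++ blank ∷ rs)
-- Beyond the `suc k` trailing blanks of the layout, three more cells are used up: by the end
-- marker, the terminator of the input and that of the empty output.
program-run g x = 3 + suc k , blank ∷ blanks k′ ,
  run-mono (+-monoʳ-≤ (suc (length x)) (+-monoʳ-≤ 1 (+-monoʳ-≤ (3 + length x) (+-monoʳ-≤ (o * c) (+-monoʳ-≤ ((2 * length x + 2) * c)
      (+-monoʳ-≤ c (+-mono-≤ (s≤s (length-⟦⟧ g (x ∷ []))) (s≤s (s≤s (length-⟦⟧ g (x ∷ [])))))))))))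
    (shiftField-run x ⟫ act-run ⟫ backField-run x ⟫
     subst (λ rs → Steps tail₁ (blank ∷ [] , rs) n₁ tt final) (++-assoc (syms x) (blank ∷ blank ∷ []) (blanks k))
      (compile-run {Z} g (x ∷ []) [] [] (≤-reflexive (cong (_+ o) wt≡))
        (drain-run (w ∷ []) refl x fin≤ ⟫
         freeFront-lay (w ∷ []) refl (≤-trans (s≤s (m≤n+m _ (length x))) (subst (_≤ Z) (wt-∷ x (w ∷ [])) fin≤))
          (subst (λ rs → Steps (scan right stay » unshiftField) (blank ∷ [] , rs) n₂ tt final) (sym (++-assoc (syms w) (blank ∷ []) (blanks k′)))
            (scan-right w ⟫ unshiftField-run w)))))
  where
  o = ops g (x ∷ [])
  w = ⟦ g ⟧ (x ∷ [])
  Z = (length x + 2) + o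
  c = opCost Z
  k = Z ∸ wt (x ∷ [] ∷ [])
  k′ = Z ∸ wt (w ∷ [])
  final = [] , syms w ++ blank ∷ blank ∷ blanks k′
  tail₁ = compile g 0 (repeatF (pop 0 1 (ret false) (λ _ → ret true)) » freeFront 1 (scan right stay » unshiftField))
  n₂ = suc (length w) + (2 + length w)
  n₁ = o * c + ((2 * length x + 2) * c + (c + n₂))
  wt≡ : wt (x ∷ [] ∷ []) ≡ length x + 2
  wt≡ = trans (wt-∷ x ([] ∷ [])) (sym (+-suc (length x) 1))
  fin≤ : wt (x ∷ w ∷ []) ≤ Z
  fin≤ = ≤-trans (≤-reflexive (trans (wt-out (x ∷ []) [] [] w) (+-comm (length w) _)))
                 (+-mono-≤ (≤-reflexive wt≡) (length-⟦⟧ g (x ∷ [])))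

halts-reading : ∀ F x k n w rs → Steps F ([] , syms x ++ replicate k blank) n tt ([] , syms w ++ blank ∷ rs) →
                ∀ N → n ≤ N → let M = Machine.machine F in
                Halted M (after M x N) × readsAt (Config.tape (after M x N)) 0 w
halts-reading F x k n w rs r N n≤ = cong (TM.halting (Machine.machine F)) (Machine.Matches.state≡ end) ,
  readsAt-nth w rs 0 (Machine.Matches.tape≡ end)
  where
  end = Machine.simulate F r (Machine.matches refl refl (inputTape-nth x k)) n≤

-- Polynomial time bounds

-- The exponents k of the bounds (2 + n) ^ k compose more easily than the constants of poly.
PolyBounded : (ℕ → ℕ) → Set
PolyBounded f = Σ ℕ λ k → ∀ n → f n ≤ (2 + n) ^ k

pow≥1 : ∀ n k → 1 ≤ (2 + n) ^ k
pow≥1 n zero    = s≤s z≤n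
pow≥1 n (suc k) = *-mono-≤ {1} {2 + n} {1} (s≤s z≤n) (pow≥1 n k)

below-pow : ∀ n k → k ≤ (2 + n) ^ k
below-pow n zero    = z≤n
below-pow n (suc k) = ≤-trans (+-mono-≤ (pow≥1 n k) (below-pow n k))
  (≤-trans (≤-reflexive (cong ((2 + n) ^ k +_) (sym (+-identityʳ _)))) (*-monoˡ-≤ ((2 + n) ^ k) (s≤s (s≤s (z≤n {n})))))

polyB-const : ∀ c → PolyBounded (λ _ → c)
polyB-const c = c , λ n → below-pow n c

polyB-id : PolyBounded (λ n → n)
polyB-id = 1 , λ n → ≤-trans (m≤n+m n 2) (≤-reflexive (sym (*-identityʳ (2 + n))))

polyB-+ : ∀ {f g} → PolyBounded f → PolyBounded g → PolyBounded (λ n → f n + g n)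
polyB-+ (a , p) (b , q) = suc (a + b) , λ n → ≤-trans (+-mono-≤
    (≤-trans (p n) (^-monoʳ-≤ (2 + n) (m≤m+n a b))) (≤-trans (q n) (^-monoʳ-≤ (2 + n) (m≤n+m b a))))
  (≤-trans (≤-reflexive (cong ((2 + n) ^ (a + b) +_) (sym (+-identityʳ _)))) (*-monoˡ-≤ ((2 + n) ^ (a + b)) (s≤s (s≤s (z≤n {n})))))

polyB-* : ∀ {f g} → PolyBounded f → PolyBounded g → PolyBounded (λ n → f n * g n)
polyB-* (a , p) (b , q) = a + b , λ n → ≤-trans (*-mono-≤ (p n) (q n)) (≤-reflexive (sym (^-distribˡ-+-* (2 + n) a b)))

-- The bound on `f` has base `2 + g n`, which is at most `4 * (2 + n) ^ b`. Absorbing the 4 costs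
-- two further factors `2 + n`, hence the exponent `(2 + b) * a`.
polyB-∘ : ∀ {f g} → PolyBounded f → PolyBounded g → PolyBounded (λ n → f (g n))
polyB-∘ (a , p) (b , q) = (2 + b) * a , λ n → ≤-trans (p _) (≤-trans (^-monoˡ-≤ a (inner n))
  (≤-reflexive (^-*-assoc (2 + n) (2 + b) a)))
  where
  inner : ∀ n → 2 + _ ≤ (2 + n) ^ (2 + b)
  inner n = ≤-trans (+-monoʳ-≤ 2 (q n)) (≤-trans (quadruple ((2 + n) ^ b) (pow≥1 n b))
    (*-mono-≤ {2} {2 + n} two (*-mono-≤ {2} {2 + n} {(2 + n) ^ b} two ≤-refl)))
    where
    two : 2 ≤ 2 + n
    two = s≤s (s≤s z≤n)
    quadruple : ∀ p → 1 ≤ p → 2 + p ≤ 2 * (2 * p)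
    quadruple (suc p) _ = ≤-trans (m≤m+n (3 + p) (1 + 3 * p)) (≤-reflexive (e p))
      where
      e : ∀ p → (3 + p) + (1 + 3 * p) ≡ 2 * (2 * suc p)
      e = solve-∀

polyB-^ : ∀ k → PolyBounded (_^ k)
polyB-^ zero    = polyB-const 1
polyB-^ (suc k) = polyB-* polyB-id (polyB-^ k)

polyB-poly : ∀ c → PolyBounded (poly c)
polyB-poly c = polyB-+ (polyB-* (polyB-const c) (polyB-^ c)) (polyB-const c)

^-distrib-* : ∀ a b k → (a * b) ^ k ≡ a ^ k * b ^ k
^-distrib-* a b zero    = refl
^-distrib-* a b (suc k) = trans (cong (a * b *_) (^-distrib-* a b k)) (e a b (a ^ k) (b ^ k))
  where
  e : ∀ a b x y → a * b * (x * y) ≡ a * x * (b * y)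
  e = solve-∀

-- For positive `n` the base is at most `3 * n`, so the coefficient must reach `3 ^ k` and the
-- exponent `k`; at 0 the additive constant does the work. In `poly` one number plays all three
-- roles, hence the sum.
pow≤poly : ∀ k n → (2 + n) ^ k ≤ poly (3 ^ k + k) n
pow≤poly k zero = ≤-trans (^-monoˡ-≤ k {2} {3} (s≤s (s≤s z≤n))) (≤-trans (m≤m+n _ k) (m≤n+m _ ((3 ^ k + k) * 0 ^ (3 ^ k + k))))
pow≤poly k (suc n) = ≤-trans (^-monoˡ-≤ k (3n n)) (≤-trans (≤-reflexive (^-distrib-* 3 (suc n) k))
  (≤-trans (*-mono-≤ (m≤m+n (3 ^ k) k) (^-monoʳ-≤ (suc n) (m≤n+m k (3 ^ k)))) (m≤m+n _ _)))
  where
  3n : ∀ n → 3 + n ≤ 3 * suc n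
  3n = 3+≤3*

polyB-bound : ∀ {f} → PolyBounded f → Σ ℕ λ c → ∀ n → f n ≤ poly c n
polyB-bound (k , p) = 3 ^ k + k , λ n → ≤-trans (p n) (pow≤poly k n)

Small : ∀ {d} → ℕ → Env d → Set
Small B ρ = ∀ i → length (Vec.lookup ρ i) ≤ B

small-≔ : ∀ {d B} (ρ : Env d) i v → Small B ρ → length v ≤ B → Small B (ρ [ i ]≔ v)
small-≔ (u ∷ ρ) zero    v sm le zero    = le
small-≔ (u ∷ ρ) zero    v sm le (suc j) = sm (suc j)
small-≔ (u ∷ ρ) (suc i) v sm le zero    = sm zero
small-≔ (u ∷ ρ) (suc i) v sm le (suc j) = small-≔ ρ i v (λ k → sm (suc k)) le j

small-∷ : ∀ {d B v} {ρ : Env d} → length v ≤ B → Small B ρ → Small B (v ∷ ρ)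
small-∷ le sm zero    = le
small-∷ le sm (suc i) = sm i

total-≤ : ∀ {B b} (t : List Bool → Bool → List Bool → ℕ) →
          (∀ p c r → length p ≤ B → length r ≤ B → t p c r ≤ b) →
          ∀ p r → length p + length r ≤ B → total t p r ≤ length r * (3 + b)
total-≤ t h p []      le = z≤n
total-≤ t h p (c ∷ r) le = +-mono-≤
  (+-monoʳ-≤ 3 (h p c r (m+n≤o⇒m≤o _ le) (≤-trans (n≤1+n _) (m+n≤o⇒n≤o (length p) le))))
  (total-≤ t h (p ++ c ∷ []) r (≤-trans (≤-reflexive (trans (cong (_+ length r) (length-snoc p c)) (sym (+-suc _ _)))) le))

-- A bound that depends only on a common bound `B` for the registers. The pieces `p` and `r` seen in
-- a loop are parts of a register and stay below `B`; only `lett` raises the bound, by the length of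
-- the new register. As the program is fixed, finitely many polynomials are composed.
opsB : ∀ {d} → G d → ℕ → ℕ
opsB nop B         = 0
opsB (emit b) B    = 1
opsB (g ⨾ h) B     = opsB g B + opsB h B
opsB (for i g h) B = (B * (3 + (opsB g B + opsB h B)) + 3 * B) + 6
opsB (lett g h) B  = (opsB g B + 5 * opsB g B) + (opsB h (B + opsB g B) + 6)

ops-≤ : ∀ {d} (g : G d) ρ {B} → Small B ρ → ops g ρ ≤ opsB g B
ops-≤ nop ρ sm         = z≤n
ops-≤ (emit b) ρ sm    = ≤-refl
ops-≤ (g ⨾ h) ρ sm     = +-mono-≤ (ops-≤ g ρ sm) (ops-≤ h ρ sm)
ops-≤ (for i g h) ρ {B} sm = +-monoˡ-≤ 6 (+-mono-≤
  (≤-trans (total-≤ _ body [] (Vec.lookup ρ i) (sm i)) (*-monoˡ-≤ _ (sm i))) (*-monoʳ-≤ 3 (sm i)))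
  where
  body : ∀ p b r → length p ≤ B → length r ≤ B →
         (if b then ops h (p ∷ ρ [ i ]≔ r) else ops g (p ∷ ρ [ i ]≔ r)) ≤ opsB g B + opsB h B
  body p false r p≤ r≤ = ≤-trans (ops-≤ g _ (small-∷ p≤ (small-≔ ρ i r sm r≤))) (m≤m+n _ _)
  body p true  r p≤ r≤ = ≤-trans (ops-≤ h _ (small-∷ p≤ (small-≔ ρ i r sm r≤))) (m≤n+m _ (opsB g B))
ops-≤ (lett g h) ρ {B} sm = +-mono-≤ (+-mono-≤ og (*-monoʳ-≤ 5 w≤))
  (+-monoˡ-≤ 6 (ops-≤ h _ (small-∷ (≤-trans w≤ (m≤n+m _ B)) (λ i → ≤-trans (sm i) (m≤m+n B _)))))
  where
  og = ops-≤ g ρ sm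
  w≤ : length (⟦ g ⟧ ρ) ≤ opsB g B
  w≤ = ≤-trans (length-⟦⟧ g ρ) og

polyB-ops : ∀ {d} (g : G d) → PolyBounded (opsB g)
polyB-ops nop         = polyB-const 0
polyB-ops (emit b)    = polyB-const 1
polyB-ops (g ⨾ h)     = polyB-+ (polyB-ops g) (polyB-ops h)
polyB-ops (for i g h) = polyB-+ (polyB-+ (polyB-* polyB-id (polyB-+ (polyB-const 3) (polyB-+ (polyB-ops g) (polyB-ops h))))
                                         (polyB-* (polyB-const 3) polyB-id)) (polyB-const 6)
polyB-ops (lett g h)  = polyB-+ (polyB-+ (polyB-ops g) (polyB-* (polyB-const 5) (polyB-ops g)))
                                (polyB-+ (polyB-∘ (polyB-ops h) (polyB-+ polyB-id (polyB-ops g))) (polyB-const 6))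

opCost-mono : ∀ {a b} → a ≤ b → opCost a ≤ opCost b
opCost-mono le = *-monoʳ-≤ 20 (s≤s le)

runTime-mono : ∀ n {o o′} → o ≤ o′ → runTime n o ≤ runTime n o′
runTime-mono n {o} {o′} le = +-monoʳ-≤ (suc n) (+-monoʳ-≤ 1 (+-monoʳ-≤ (3 + n) (+-mono-≤ (*-mono-≤ le c≤)
  (+-mono-≤ (*-monoʳ-≤ (2 * n + 2) c≤) (+-mono-≤ c≤ (+-mono-≤ (s≤s le) (+-monoʳ-≤ 2 le)))))))
  where
  c≤ : opCost ((n + 2) + o) ≤ opCost ((n + 2) + o′)
  c≤ = opCost-mono (+-monoʳ-≤ (n + 2) le)

polyB-runTime : ∀ {o} → PolyBounded o → PolyBounded (λ n → runTime n (o n))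
polyB-runTime {o} po = polyB-+ (polyB-+ (polyB-const 1) polyB-id) (polyB-+ (polyB-const 1) (polyB-+ (polyB-+ (polyB-const 3) polyB-id)
  (polyB-+ (polyB-* po pc) (polyB-+ (polyB-* (polyB-+ (polyB-* (polyB-const 2) polyB-id) (polyB-const 2)) pc)
    (polyB-+ pc (polyB-+ (polyB-+ (polyB-const 1) po) (polyB-+ (polyB-const 2) po)))))))
  where
  pc : PolyBounded (λ n → opCost ((n + 2) + o n))
  pc = polyB-* (polyB-const 20) (polyB-+ (polyB-const 1) (polyB-+ (polyB-+ polyB-id (polyB-const 2)) po))

computable : ∀ g → PolyTimeComputable (λ x → ⟦ g ⟧ (x ∷ []))
computable g = Machine.machine (program g) , proj₁ bound , λ x → let k , rs , r = program-run g x in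
  halts-reading (program g) x k (runTime (length x) (ops g (x ∷ []))) (⟦ g ⟧ (x ∷ [])) rs r (poly (proj₁ bound) (length x))
    (≤-trans (runTime-mono (length x) (ops-≤ g (x ∷ []) (small-∷ ≤-refl (λ ())))) (proj₂ bound (length x)))
  where
  bound : Σ ℕ λ c → ∀ n → runTime n (opsB g n) ≤ poly c n
  bound = polyB-bound (polyB-runTime (polyB-ops g))

-- Unique readability of the encoding

parseAP : List Bool → Maybe (AP × List Bool)
parseAP []          = nothing
parseAP (false ∷ r) = just (zero , r)
parseAP (true ∷ r)  = parseAP r >>= λ { (p , u) → just (suc p , u) }

parseAP-enc : ∀ p u → parseAP (encAP p ++ u) ≡ just (p , u)
parseAP-enc zero    u = refl
parseAP-enc (suc p) u rewrite parseAP-enc p u = refl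

parseAPs : ℕ → List Bool → Maybe (List AP × List Bool)
parseAPs k       []          = nothing
parseAPs k       (false ∷ r) = just ([] , r)
parseAPs zero    (true ∷ r)  = nothing
parseAPs (suc k) (true ∷ r)  = parseAP r >>= λ { (p , u) → parseAPs k u >>= λ { (ps , v) → just (p ∷ ps , v) } }

parseAPs-enc : ∀ ps u {k} → length ps ≤ k → parseAPs k (encAPs ps ++ u) ≡ just (ps , u)
parseAPs-enc []       u le = refl
parseAPs-enc (p ∷ ps) u {suc k} (s≤s le)
  rewrite ++-assoc (encAP p) (encAPs ps) u | parseAP-enc p (encAPs ps ++ u) | parseAPs-enc ps u le = refl

parse : ℕ → List Bool → Maybe (Fml × List Bool)
parseDep : ℕ → (List AP → AP → Fml) → List Bool → Maybe (Fml × List Bool)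
parseDep k c r = parseAPs k r >>= λ { (ps , u) → parseAP u >>= λ { (q , v) → just (c ps q , v) } }

parse₁ : ℕ → (Fml → Fml) → List Bool → Maybe (Fml × List Bool)
parse₂ : ℕ → (Fml → Fml → Fml) → List Bool → Maybe (Fml × List Bool)
parse₁ k c r = parse k r >>= λ { (φ , u) → just (c φ , u) }
parse₂ k c r = parse k r >>= λ { (φ , u) → parse k u >>= λ { (ψ , v) → just (c φ ψ , v) } }

parse zero    _ = nothing
parse (suc k) (false ∷ false ∷ false ∷ false ∷ r) = just (top , r)
parse (suc k) (false ∷ false ∷ false ∷ true ∷ r)  = just (bot , r)
parse (suc k) (false ∷ false ∷ true ∷ false ∷ r)  = parseAP r >>= λ { (p , u) → just (atom p , u) }
parse (suc k) (false ∷ false ∷ true ∷ true ∷ r)   = parseAP r >>= λ { (p , u) → just (natom p , u) }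
parse (suc k) (false ∷ true ∷ false ∷ false ∷ r)  = parseDep k dep r
parse (suc k) (false ∷ true ∷ false ∷ true ∷ r)   = parseDep k ndep r
parse (suc k) (false ∷ true ∷ true ∷ false ∷ r)   = parse₂ k _∧'_ r
parse (suc k) (false ∷ true ∷ true ∷ true ∷ r)    = parse₂ k _∨'_ r
parse (suc k) (true ∷ false ∷ false ∷ false ∷ r)  = parse₂ k _⊻'_ r
parse (suc k) (true ∷ false ∷ false ∷ true ∷ r)   = parse₁ k □ r
parse (suc k) (true ∷ false ∷ true ∷ false ∷ r)   = parse₁ k ◇ r
parse (suc k) _ = nothing

-- Fuel for the parser, whose recursive calls act on whatever an earlier call left over. Each atom
-- in the list of a dependence atom needs fuel as well.
rank : Fml → ℕ
rank top        = 1
rank bot        = 1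
rank (atom p)   = 1
rank (natom p)  = 1
rank (dep ps q)  = suc (length ps)
rank (ndep ps q) = suc (length ps)
rank (φ ∧' ψ)   = suc (rank φ + rank ψ)
rank (φ ∨' ψ)   = suc (rank φ + rank ψ)
rank (φ ⊻' ψ)   = suc (rank φ + rank ψ)
rank (□ φ)      = suc (rank φ)
rank (◇ φ)      = suc (rank φ)

parse-enc : ∀ φ u {k} → rank φ ≤ k → parse k (enc φ ++ u) ≡ just (φ , u)

parseDep-enc : ∀ c ps q u {k} → length ps ≤ k → parseDep k c ((encAPs ps ++ encAP q) ++ u) ≡ just (c ps q , u)
parseDep-enc c ps q u le
  rewrite ++-assoc (encAPs ps) (encAP q) u | parseAPs-enc ps (encAP q ++ u) le | parseAP-enc q u = refl

parse₁-enc : ∀ c φ u {k} → rank φ ≤ k → parse₁ k c (enc φ ++ u) ≡ just (c φ , u)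
parse₁-enc c φ u le rewrite parse-enc φ u le = refl

parse₂-enc : ∀ c φ ψ u {k} → rank φ + rank ψ ≤ k → parse₂ k c ((enc φ ++ enc ψ) ++ u) ≡ just (c φ ψ , u)
parse₂-enc c φ ψ u le
  rewrite ++-assoc (enc φ) (enc ψ) u | parse-enc φ (enc ψ ++ u) (m+n≤o⇒m≤o (rank φ) le)
        | parse-enc ψ u (m+n≤o⇒n≤o (rank φ) le) = refl

parse-enc top u (s≤s le)        = refl
parse-enc bot u (s≤s le)        = refl
parse-enc (atom p) u (s≤s le)  rewrite parseAP-enc p u = refl
parse-enc (natom p) u (s≤s le) rewrite parseAP-enc p u = refl
parse-enc (dep ps q) u (s≤s le)  = parseDep-enc dep ps q u le
parse-enc (ndep ps q) u (s≤s le) = parseDep-enc ndep ps q u le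
parse-enc (φ ∧' ψ) u (s≤s le)   = parse₂-enc _∧'_ φ ψ u le
parse-enc (φ ∨' ψ) u (s≤s le)   = parse₂-enc _∨'_ φ ψ u le
parse-enc (φ ⊻' ψ) u (s≤s le)   = parse₂-enc _⊻'_ φ ψ u le
parse-enc (□ φ) u (s≤s le)      = parse₁-enc □ φ u le
parse-enc (◇ φ) u (s≤s le)      = parse₁-enc ◇ φ u le

-- The satisfiability problem is about words and asks for some formula with the given code.
-- Injectivity identifies it with the formula that the reduction printed.
enc-injective : ∀ φ ψ → enc φ ≡ enc ψ → φ ≡ ψ
enc-injective φ ψ e = cong proj₁ (just-injective (begin
  just (φ , [])        ≡⟨ parse-enc φ [] (m≤m+n (rank φ) (rank ψ)) ⟨
  parse k (enc φ ++ []) ≡⟨ cong (λ w → parse k (w ++ [])) e ⟩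
  parse k (enc ψ ++ []) ≡⟨ parse-enc ψ [] (m≤n+m (rank ψ) (rank φ)) ⟩
  just (ψ , [])        ∎))
  where
  open ≡-Reasoning
  k = rank φ + rank ψ

-- Formula templates and their printers

-- Coordinates of atoms: a constant up to 4 plus at most two registers, each read as its length.
-- With registers of length at most `N` the value stays below `2N + 5`.
data Ex (d : ℕ) : Set where
  con  : Fin 5 → Ex d
  var  : Fin d → Fin 5 → Ex d
  var² : Fin d → Fin d → Fin 5 → Ex d

reg : ∀ {d} → Env d → Fin d → ℕ
reg ρ v = length (Vec.lookup ρ v)

value : ∀ {d} → Ex d → Env d → ℕ
value (con c) ρ      = toℕ c
value (var v c) ρ    = toℕ c + reg ρ v
value (var² v w c) ρ = toℕ c + (reg ρ v + reg ρ w)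

-- The constant ⊤ may be missing from the fragment.
tautology : Fml
tautology = dep (0 ∷ []) 0

conj : (List Bool → Bool → List Bool → Fml) → List Bool → List Bool → Fml
conj f p []      = tautology
conj f p (b ∷ r) = f p b r ∧' conj f (p ++ b ∷ []) r

boxes diamonds : ℕ → Fml → Fml
boxes zero    φ = φ
boxes (suc n) φ = □ (boxes n φ)
diamonds zero    φ = φ
diamonds (suc n) φ = ◇ (diamonds n φ)

record AtomT (K d : ℕ) : Set where
  constructor at⟨_,_,_,_⟩
  field
    kind  : Fin K
    t i j : Ex d

infixr 6 _∧ᵗ_
-- The constructors mirror what the register language can print. As in `for`, the counter of `⋀` is
-- the length of the prefix already consumed; its two bodies let a conjunction over the input depend
-- on the bits.
data FT (K : ℕ) : ℕ → Set where
  valid     : ∀ {d} → FT K d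
  pos neg   : ∀ {d} → AtomT K d → FT K d
  dep₀      : ∀ {d} → AtomT K d → FT K d
  dep₃      : ∀ {d} → AtomT K d → AtomT K d → AtomT K d → AtomT K d → FT K d
  _∧ᵗ_      : ∀ {d} → FT K d → FT K d → FT K d
  □ᵗ ◇ᵗ     : ∀ {d} → FT K d → FT K d
  □^ ◇^     : ∀ {d} → Fin d → FT K d → FT K d
  ⋀         : ∀ {d} → Fin d → FT K (suc d) → FT K (suc d) → FT K d

-- The factors of the coordinates in an atom number. They are a parameter because the printer takes
-- them from register lengths, soundness treats them abstractly, and only the construction of a
-- model fixes them to powers of a base.
record Weights : Set where
  constructor weights
  field
    w₂ w₁ w₀ : ℕ

module _ {K : ℕ} (W : Weights) where
  open Weights W

  index : ∀ {d} → AtomT K d → Env d → AP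
  index at⟨ k , t , i , j ⟩ ρ = value t ρ * w₂ + (value i ρ * w₁ + (value j ρ * w₀ + toℕ k))

  sem : ∀ {d} → FT K d → Env d → Fml
  sem valid ρ           = tautology
  sem (pos a) ρ         = atom (index a ρ)
  sem (neg a) ρ         = natom (index a ρ)
  sem (dep₀ a) ρ        = dep [] (index a ρ)
  sem (dep₃ a b c f) ρ  = dep (index a ρ ∷ index b ρ ∷ index c ρ ∷ []) (index f ρ)
  sem (φ ∧ᵗ ψ) ρ        = sem φ ρ ∧' sem ψ ρ
  sem (□ᵗ φ) ρ          = □ (sem φ ρ)
  sem (◇ᵗ φ) ρ          = ◇ (sem φ ρ)
  sem (□^ v φ) ρ        = boxes (reg ρ v) (sem φ ρ)
  sem (◇^ v φ) ρ        = diamonds (reg ρ v) (sem φ ρ)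
  sem (⋀ v φ ψ) ρ       = conj (λ p b r → if b then sem ψ (p ∷ ρ [ v ]≔ r) else sem φ (p ∷ ρ [ v ]≔ r)) [] (Vec.lookup ρ v)

  module _ (M : OpSet) (box : opBox ∈ₒ M) (dia : opDia ∈ₒ M) (and : opAnd ∈ₒ M) (neg∈ : opNeg ∈ₒ M) (dep∈ : opDep ∈ₒ M) where

    Good : Fml → Set
    Good φ = InFrag M φ × Arity3 φ

    conj-good : ∀ f p r → (∀ p b r → Good (f p b r)) → Good (conj f p r)
    conj-good f p []      h = dep∈ , s≤s z≤n
    conj-good f p (b ∷ r) h =
      let x , y = h p b r ; x′ , y′ = conj-good f (p ++ b ∷ []) r h in (and , x , x′) , y , y′

    boxes-good : ∀ n {φ} → Good φ → Good (boxes n φ)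
    boxes-good zero    g = g
    boxes-good (suc n) g = let x , y = boxes-good n g in (box , x) , y

    diamonds-good : ∀ n {φ} → Good φ → Good (diamonds n φ)
    diamonds-good zero    g = g
    diamonds-good (suc n) g = let x , y = diamonds-good n g in (dia , x) , y

    sem-good : ∀ {d} (φ : FT K d) ρ → Good (sem φ ρ)
    sem-good valid ρ          = dep∈ , s≤s z≤n
    sem-good (pos a) ρ        = tt , tt
    sem-good (neg a) ρ        = neg∈ , tt
    sem-good (dep₀ a) ρ       = dep∈ , z≤n
    sem-good (dep₃ a b c f) ρ = dep∈ , s≤s (s≤s (s≤s z≤n))
    sem-good (φ ∧ᵗ ψ) ρ       = let x , y = sem-good φ ρ ; x′ , y′ = sem-good ψ ρ in (and , x , x′) , y , y′
    sem-good (□ᵗ φ) ρ         = let x , y = sem-good φ ρ in (box , x) , y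
    sem-good (◇ᵗ φ) ρ         = let x , y = sem-good φ ρ in (dia , x) , y
    sem-good (□^ v φ) ρ       = boxes-good (reg ρ v) (sem-good φ ρ)
    sem-good (◇^ v φ) ρ       = diamonds-good (reg ρ v) (sem-good φ ρ)
    sem-good (⋀ v φ ψ) ρ      = conj-good _ [] (Vec.lookup ρ v)
      λ { p false r → sem-good φ (p ∷ ρ [ v ]≔ r) ; p true r → sem-good ψ (p ∷ ρ [ v ]≔ r) }

ones : ℕ → List Bool
ones n = replicate n true

ones-+ : ∀ m n → ones m ++ ones n ≡ ones (m + n)
ones-+ zero    n = refl
ones-+ (suc m) n = cong (true ∷_) (ones-+ m n)

encAP-ones : ∀ n → encAP n ≡ ones n ++ false ∷ []
encAP-ones zero    = refl
encAP-ones (suc n) = cong (true ∷_) (encAP-ones n)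

emits : ∀ {d} → List Bool → G d
emits []       = nop
emits (b ∷ bs) = emit b ⨾ emits bs

⟦emits⟧ : ∀ {d} bs (ρ : Env d) → ⟦ emits bs ⟧ ρ ≡ bs
⟦emits⟧ []       ρ = refl
⟦emits⟧ (b ∷ bs) ρ = cong (b ∷_) (⟦emits⟧ bs ρ)

copies : ∀ {d} → ℕ → G d → G d
copies zero    g = nop
copies (suc n) g = g ⨾ copies n g

⟦copies⟧-ones : ∀ {d} n k (g : G d) ρ → ⟦ g ⟧ ρ ≡ ones k → ⟦ copies n g ⟧ ρ ≡ ones (n * k)
⟦copies⟧-ones zero    k g ρ e = refl
⟦copies⟧-ones (suc n) k g ρ e rewrite e | ⟦copies⟧-ones n k g ρ e = ones-+ k (n * k)

each : ∀ {d} → Fin d → G (suc d) → G d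
each v g = for v g g

sweep-ones : ∀ f k p r → (∀ p b r → f p b r ≡ ones k) → sweep f p r ≡ ones (length r * k)
sweep-ones f k p []      h = refl
sweep-ones f k p (b ∷ r) h rewrite h p b r | sweep-ones f k (p ++ b ∷ []) r h = ones-+ k (length r * k)

⟦each⟧-ones : ∀ {d} (v : Fin d) g ρ k → (∀ p r → ⟦ g ⟧ (p ∷ ρ [ v ]≔ r) ≡ ones k) →
              ⟦ each v g ⟧ ρ ≡ ones (reg ρ v * k)
⟦each⟧-ones v g ρ k h = sweep-ones _ k [] (Vec.lookup ρ v) λ { p false r → h p r ; p true r → h p r }

copy : ∀ {d} → Fin d → G d
copy v = each v (emit true)

⟦copy⟧ : ∀ {d} (v : Fin d) ρ → ⟦ copy v ⟧ ρ ≡ ones (reg ρ v)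
⟦copy⟧ v ρ = trans (⟦each⟧-ones v (emit true) ρ 1 (λ _ _ → refl)) (cong ones (*-identityʳ _))

-- Atom numbers are written in unary, so counter times weight is printed by a loop over the counter
-- that copies a weight register. The weights lie behind the registers of the template, where new
-- loop registers only shift their index.
module Printing {K e : ℕ} (u₂ u₁ u₀ : Fin e) where

  copyTail : ∀ {d} → Fin e → G (d + e)
  copyTail {d} u = copy (d ↑ʳ u)

  times : ∀ {d} → Fin d → Fin e → G (d + e)
  times v u = each (v ↑ˡ e) (copyTail u)

  printEx : ∀ {d} → Ex d → Fin e → G (d + e)
  printEx (con c) u      = copies (toℕ c) (copyTail u)
  printEx (var v c) u    = copies (toℕ c) (copyTail u) ⨾ times v u
  printEx (var² v w c) u = copies (toℕ c) (copyTail u) ⨾ times v u ⨾ times w u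

  printAtom : ∀ {d} → AtomT K d → G (d + e)
  printAtom at⟨ k , t , i , j ⟩ = (printEx t u₂ ⨾ printEx i u₁ ⨾ printEx j u₀ ⨾ emits (ones (toℕ k))) ⨾ emit false

  print : ∀ {d} → FT K d → G (d + e)
  print valid          = emits (enc tautology)
  print (pos a)        = emits (tag false false true false) ⨾ printAtom a
  print (neg a)        = emits (tag false false true true) ⨾ printAtom a
  print (dep₀ a)       = emits (tag false true false false) ⨾ emit false ⨾ printAtom a
  print (dep₃ a b c f) = emits (tag false true false false) ⨾
    (emit true ⨾ printAtom a ⨾ emit true ⨾ printAtom b ⨾ emit true ⨾ printAtom c ⨾ emit false) ⨾ printAtom f
  print (φ ∧ᵗ ψ)       = emits (tag false true true false) ⨾ print φ ⨾ print ψ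
  print (□ᵗ φ)         = emits (tag true false false true) ⨾ print φ
  print (◇ᵗ φ)         = emits (tag true false true false) ⨾ print φ
  print (□^ v φ)       = each (v ↑ˡ e) (emits (tag true false false true)) ⨾ print φ
  print (◇^ v φ)       = each (v ↑ˡ e) (emits (tag true false true false)) ⨾ print φ
  print (⋀ v φ ψ)      = for (v ↑ˡ e) (emits (tag false true true false) ⨾ print φ) (emits (tag false true true false) ⨾ print ψ)
                         ⨾ emits (enc tautology)

  module Correctness (τ : Env e) where

    W : Weights
    W = weights (reg τ u₂) (reg τ u₁) (reg τ u₀)

    infixr 6 _▹_
    _▹_ : ∀ {d} → Env d → Env e → Env (d + e)
    ρ ▹ τ = ρ Vec.++ τ

    reg-tail : ∀ {d} (ρ : Env d) u → reg (ρ ▹ τ) (d ↑ʳ u) ≡ reg τ u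
    reg-tail ρ u = cong length (lookup-++ʳ ρ τ u)

    ⟦copyTail⟧ : ∀ {d} (ρ : Env d) u → ⟦ copyTail {d} u ⟧ (ρ ▹ τ) ≡ ones (reg τ u)
    ⟦copyTail⟧ {d} ρ u = trans (⟦copy⟧ (d ↑ʳ u) (ρ ▹ τ)) (cong ones (reg-tail ρ u))

    ⟦times⟧ : ∀ {d} (ρ : Env d) v u → ⟦ times v u ⟧ (ρ ▹ τ) ≡ ones (reg ρ v * reg τ u)
    ⟦times⟧ ρ v u = trans
      (⟦each⟧-ones (v ↑ˡ e) (copyTail u) (ρ ▹ τ) (reg τ u) λ p r →
        trans (cong (λ σ → ⟦ copyTail u ⟧ (p ∷ σ)) ([]≔-++-↑ˡ ρ τ v)) (⟦copyTail⟧ (p ∷ ρ [ v ]≔ r) u))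
      (cong (λ x → ones (length x * reg τ u)) (lookup-++ˡ ρ τ v))

    ⟦printEx⟧ : ∀ {d} E u (ρ : Env d) → ⟦ printEx E u ⟧ (ρ ▹ τ) ≡ ones (value E ρ * reg τ u)
    ⟦printEx⟧ (con c) u ρ = ⟦copies⟧-ones (toℕ c) (reg τ u) (copyTail u) (ρ ▹ τ) (⟦copyTail⟧ ρ u)
    ⟦printEx⟧ (var v c) u ρ
      rewrite ⟦times⟧ ρ v u | ⟦copies⟧-ones (toℕ c) (reg τ u) (copyTail u) (ρ ▹ τ) (⟦copyTail⟧ ρ u) =
      trans (ones-+ (toℕ c * reg τ u) _) (cong ones (sym (*-distribʳ-+ (reg τ u) (toℕ c) (reg ρ v))))
    ⟦printEx⟧ (var² v w c) u ρ
      rewrite ⟦times⟧ ρ v u | ⟦times⟧ ρ w u | ⟦copies⟧-ones (toℕ c) (reg τ u) (copyTail u) (ρ ▹ τ) (⟦copyTail⟧ ρ u)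
            | ones-+ (reg ρ v * reg τ u) (reg ρ w * reg τ u) =
      trans (ones-+ (toℕ c * reg τ u) _) (cong ones
        (trans (cong (toℕ c * reg τ u +_) (sym (*-distribʳ-+ (reg τ u) (reg ρ v) (reg ρ w))))
               (sym (*-distribʳ-+ (reg τ u) (toℕ c) (reg ρ v + reg ρ w)))))

    ⟦printAtom⟧ : ∀ {d} a (ρ : Env d) → ⟦ printAtom a ⟧ (ρ ▹ τ) ≡ encAP (index W a ρ)
    ⟦printAtom⟧ at⟨ k , t , i , j ⟩ ρ
      rewrite ⟦printEx⟧ t u₂ ρ | ⟦printEx⟧ i u₁ ρ | ⟦printEx⟧ j u₀ ρ | ⟦emits⟧ (ones (toℕ k)) (ρ ▹ τ)
            | ones-+ (value j ρ * reg τ u₀) (toℕ k)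
            | ones-+ (value i ρ * reg τ u₁) (value j ρ * reg τ u₀ + toℕ k)
            | ones-+ (value t ρ * reg τ u₂) (value i ρ * reg τ u₁ + (value j ρ * reg τ u₀ + toℕ k)) =
      sym (encAP-ones _)

    sweep-boxes : ∀ f p r φ → (∀ p b r → f p b r ≡ tag true false false true) → sweep f p r ++ enc φ ≡ enc (boxes (length r) φ)
    sweep-boxes f p []      φ h = refl
    sweep-boxes f p (b ∷ r) φ h rewrite h p b r = cong (tag true false false true ++_) (sweep-boxes f (p ++ b ∷ []) r φ h)

    sweep-diamonds : ∀ f p r φ → (∀ p b r → f p b r ≡ tag true false true false) → sweep f p r ++ enc φ ≡ enc (diamonds (length r) φ)
    sweep-diamonds f p []      φ h = refl
    sweep-diamonds f p (b ∷ r) φ h rewrite h p b r = cong (tag true false true false ++_) (sweep-diamonds f (p ++ b ∷ []) r φ h)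

    sweep-conj : ∀ f φ p r → (∀ p b r → f p b r ≡ tag false true true false ++ enc (φ p b r)) →
                 sweep f p r ++ enc tautology ≡ enc (conj φ p r)
    sweep-conj f φ p []      h = refl
    sweep-conj f φ p (b ∷ r) h rewrite h p b r =
      cong (tag false true true false ++_) (trans (++-assoc (enc (φ p b r)) _ _) (cong (enc (φ p b r) ++_) (sweep-conj f φ (p ++ b ∷ []) r h)))

    ⟦print⟧ : ∀ {d} φ (ρ : Env d) → ⟦ print φ ⟧ (ρ ▹ τ) ≡ enc (sem W φ ρ)
    ⟦print⟧ valid ρ    = refl
    ⟦print⟧ (pos a) ρ  rewrite ⟦printAtom⟧ a ρ = refl
    ⟦print⟧ (neg a) ρ  rewrite ⟦printAtom⟧ a ρ = refl
    ⟦print⟧ (dep₀ a) ρ rewrite ⟦printAtom⟧ a ρ = refl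
    ⟦print⟧ (dep₃ a b c f) ρ rewrite ⟦printAtom⟧ a ρ | ⟦printAtom⟧ b ρ | ⟦printAtom⟧ c ρ | ⟦printAtom⟧ f ρ = refl
    ⟦print⟧ (φ ∧ᵗ ψ) ρ rewrite ⟦print⟧ φ ρ | ⟦print⟧ ψ ρ = refl
    ⟦print⟧ (□ᵗ φ) ρ   rewrite ⟦print⟧ φ ρ = refl
    ⟦print⟧ (◇ᵗ φ) ρ   rewrite ⟦print⟧ φ ρ = refl
    ⟦print⟧ (□^ v φ) ρ rewrite ⟦print⟧ φ ρ | lookup-++ˡ ρ τ v =
      sweep-boxes _ [] (Vec.lookup ρ v) (sem W φ ρ) λ { p false r → refl ; p true r → refl }
    ⟦print⟧ (◇^ v φ) ρ rewrite ⟦print⟧ φ ρ | lookup-++ˡ ρ τ v =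
      sweep-diamonds _ [] (Vec.lookup ρ v) (sem W φ ρ) λ { p false r → refl ; p true r → refl }
    ⟦print⟧ (⋀ v φ ψ) ρ rewrite lookup-++ˡ ρ τ v =
      sweep-conj _ _ [] (Vec.lookup ρ v) λ
        { p false r → cong (tag false true true false ++_) (trans (cong (λ σ → ⟦ print φ ⟧ (p ∷ σ)) ([]≔-++-↑ˡ ρ τ v)) (⟦print⟧ φ (p ∷ ρ [ v ]≔ r)))
        ; p true r  → cong (tag false true true false ++_) (trans (cong (λ σ → ⟦ print ψ ⟧ (p ∷ σ)) ([]≔-++-↑ˡ ρ τ v)) (⟦print⟧ ψ (p ∷ ρ [ v ]≔ r))) }

-- The formula

data Item : Set where
  it0 it1 itE : Item

-- Items spell out the doubled bits and the separator 01 of encTuple.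
itemSyms : Item → Sym × Sym
itemSyms it0 = b0 , b0
itemSyms it1 = b1 , b1
itemSyms itE = b0 , b1

itemCode : Item → Fin 5
itemCode it0 = zero
itemCode it1 = suc zero
itemCode itE = suc (suc zero)

cell : Sym → Fin 5
cell blank = zero
cell b0    = suc zero
cell b1    = suc (suc zero)

pattern #0 = zero
pattern #1 = suc zero
pattern #2 = suc (suc zero)
pattern #3 = suc (suc (suc zero))
pattern #4 = suc (suc (suc (suc zero)))
pattern #5 = suc (suc (suc (suc (suc zero))))

-- The registers on which the formula depends: the input x, three copies of N and two copies of P, in unary.
pattern rX  = #0
pattern rN₁ = #1
pattern rN₂ = #2
pattern rN₃ = #3
pattern rP  = #4
pattern rQ  = #5

module Formula (V : TM) where

  open TM V using (nStates; start; halting; accepting)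

  State : Set
  State = Fin (suc nStates)

  -- Halting states idle, as they do in `step`, so a tableau of fixed height accommodates runs of
  -- different lengths.
  next : State → Sym → State × Sym × Move
  next q s = if halting q then (q , s , stay) else TM.δ V q s

  data Target : Set where
    fstCell sndCell continue : Target

  -- write: the scanned cell is rewritten; goes, goes₀: the head moves (goes₀ from cell 0);
  -- keepʳ, keepˡ: cells to the right and to the left of the head persist.
  data Rule : Set where
    write goes goes₀ keepʳ keepˡ : Rule

  -- `item` and `stop` spell the encoded tuple on row 0, the latter closing a segment whose entries
  -- are used up; `pad` puts blanks behind it. `choose` makes each entry of the two existential
  -- words some item, and `tableau` describes the transitions.
  data Family : Set where
    item    : Fin 4 → Item → Target → Family
    stop    : Fin 4 → Target → Family
    choose  : Bool → Family
    pad     : Bool → Family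
    tableau : Rule → State → Sym → Family

  allSyms : List Sym
  allSyms = blank ∷ b0 ∷ b1 ∷ []

  sym∈ : ∀ s → s ∈ allSyms
  sym∈ blank = here refl
  sym∈ b0    = there (here refl)
  sym∈ b1    = there (there (here refl))

  allItems : List Item
  allItems = it0 ∷ it1 ∷ itE ∷ []

  item∈ : ∀ z → z ∈ allItems
  item∈ it0 = here refl
  item∈ it1 = there (here refl)
  item∈ itE = there (there (here refl))

  allTargets : List Target
  allTargets = fstCell ∷ sndCell ∷ continue ∷ []

  target∈ : ∀ r → r ∈ allTargets
  target∈ fstCell  = here refl
  target∈ sndCell  = there (here refl)
  target∈ continue = there (there (here refl))

  allRules : List Rule
  allRules = write ∷ goes ∷ goes₀ ∷ keepʳ ∷ keepˡ ∷ []

  rule∈ : ∀ r → r ∈ allRules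
  rule∈ write = here refl
  rule∈ goes  = there (here refl)
  rule∈ goes₀ = there (there (here refl))
  rule∈ keepʳ = there (there (there (here refl)))
  rule∈ keepˡ = there (there (there (there (here refl))))

  -- Abstract, because unfolding the list would unfold the conjunction over it.
  abstract

    bitFamilies itemFamilies stopFamilies tableauFamilies families : List Family
    bitFamilies     = choose true ∷ choose false ∷ pad true ∷ pad false ∷ []
    itemFamilies    = cartesianProductWith (λ m f → f m) (allFin 4) (cartesianProductWith (λ z r m → item m z r) allItems allTargets)
    stopFamilies    = cartesianProductWith stop (allFin 4) allTargets
    tableauFamilies = cartesianProductWith (λ q f → f q) (allFin (suc nStates))
                        (cartesianProductWith (λ r s q → tableau r q s) allRules allSyms)
    families        = bitFamilies ++ itemFamilies ++ stopFamilies ++ tableauFamilies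

    families∈ : ∀ φ → φ ∈ families
    families∈ (choose true)   = here refl
    families∈ (choose false)  = there (here refl)
    families∈ (pad true)      = there (there (here refl))
    families∈ (pad false)     = there (there (there (here refl)))
    families∈ (item m z r)    = ∈-++⁺ʳ bitFamilies (∈-++⁺ˡ (∈-cartesianProductWith⁺ (λ m f → f m) (∈-allFin m)
                                  (∈-cartesianProductWith⁺ (λ z r m → item m z r) (item∈ z) (target∈ r))))
    families∈ (stop m r)      = ∈-++⁺ʳ bitFamilies (∈-++⁺ʳ itemFamilies (∈-++⁺ˡ (∈-cartesianProductWith⁺ stop (∈-allFin m) (target∈ r))))
    families∈ (tableau r q s) = ∈-++⁺ʳ bitFamilies (∈-++⁺ʳ itemFamilies (∈-++⁺ʳ stopFamilies
      (∈-cartesianProductWith⁺ (λ q f → f q) (∈-allFin q) (∈-cartesianProductWith⁺ (λ r s q → tableau r q s) (rule∈ r) (sym∈ s)))))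

  nFamilies K : ℕ
  nFamilies = length families
  K = 3 + (suc nStates + nFamilies)

  pattern kT = #0
  pattern kC = #1
  pattern kZ = #2

  kH : State → Fin K
  kH q = suc (suc (suc (q ↑ˡ nFamilies)))

  kF : Fin nFamilies → Fin K
  kF p = suc (suc (suc (suc nStates ↑ʳ p)))

  -- Tᵃ t i s: cell i holds s at time t;  Hᵃ q t i: the head is at i in state q at time t;
  -- Zᵃ j m z: entry j of segment m is z;  Cᵃ j i m: the code of entry j of segment m starts at cell i.
  Tᵃ : ∀ {d} → Ex d → Ex d → Sym → AtomT K d
  Tᵃ t i s = at⟨ kT , t , i , con (cell s) ⟩

  Cᵃ : ∀ {d} → Ex d → Ex d → Fin 5 → AtomT K d
  Cᵃ j i m = at⟨ kC , j , i , con m ⟩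

  Zᵃ : ∀ {d} → Ex d → Fin 5 → Item → AtomT K d
  Zᵃ j m z = at⟨ kZ , j , con m , con (itemCode z) ⟩

  Hᵃ : ∀ {d} → State → Ex d → Ex d → AtomT K d
  Hᵃ q t i = at⟨ kH q , t , i , con #0 ⟩

  -- Stands for the instances prem₁ = prem₂ = sign → concl = true, for a, b, c below the three ranges.
  record Clause : Set where
    constructor mkClause
    field
      range₁ range₂ range₃ : Fin 6
      sign                 : Bool
      prem₁ prem₂ concl    : AtomT K 9

  a+ b+ : Fin 5 → Ex 9
  a+ = var #2
  b+ = var #1

  bc+ : Ex 9
  bc+ = var² #1 #0 #1

  segRange : Fin 4 → Fin 6
  segRange zero    = rX
  segRange (suc _) = rP

  segEnd : Fin 4 → Ex 9
  segEnd zero    = var (3 ↑ʳ rX) #0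
  segEnd (suc _) = var (3 ↑ʳ rQ) #0

  -- An item has three consequences and a clause only one conclusion, hence the three targets. A
  -- code occupies two cells; behind it starts the next entry of the segment or, after the
  -- separator, entry 0 of the next segment.
  written : Fin 4 → Item → Target → AtomT K 9
  written m z   fstCell  = Tᵃ (con #0) (b+ #0) (proj₁ (itemSyms z))
  written m z   sndCell  = Tᵃ (con #0) (b+ #1) (proj₂ (itemSyms z))
  written m itE continue = Cᵃ (con #0) (b+ #2) (suc m)
  written m z   continue = Cᵃ (a+ #1) (b+ #2) (Fin.inject₁ m)

  -- Coordinates cannot be decremented, so a left move leads from cell `b + 1` to cell `b`. A left
  -- move in cell 0 falls outside this scheme and is covered by `goes₀`.
  moved : State → State × Sym × Move → Sym → Clause
  moved q (q′ , _ , left)  s = mkClause rN₁ rN₂ rN₃ true (Hᵃ q (a+ #0) (b+ #1)) (Tᵃ (a+ #0) (b+ #1) s) (Hᵃ q′ (a+ #1) (b+ #0))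
  moved q (q′ , _ , stay)  s = mkClause rN₁ rN₂ rN₃ true (Hᵃ q (a+ #0) (b+ #0)) (Tᵃ (a+ #0) (b+ #0) s) (Hᵃ q′ (a+ #1) (b+ #0))
  moved q (q′ , _ , right) s = mkClause rN₁ rN₂ rN₃ true (Hᵃ q (a+ #0) (b+ #0)) (Tᵃ (a+ #0) (b+ #0) s) (Hᵃ q′ (a+ #1) (b+ #1))

  from₀ : Move → Fin 5
  from₀ left  = #0
  from₀ stay  = #0
  from₀ right = #1

  chosen : Bool → Fin 5
  chosen true  = #1
  chosen false = #3

  clause : Family → Clause
  clause (item m z r) = mkClause (segRange m) rN₂ rN₃ true (Cᵃ (a+ #0) (b+ #0) (Fin.inject₁ m)) (Zᵃ (a+ #0) (Fin.inject₁ m) z) (written m z r)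
  clause (stop m r) = mkClause rN₁ rN₂ rN₃ true (Cᵃ (segEnd m) (b+ #0) (Fin.inject₁ m)) (Cᵃ (segEnd m) (b+ #0) (Fin.inject₁ m)) (written m itE r)
  -- The only clause with negative premises: an entry that is neither `it0` nor `it1` is `itE`.
  clause (choose x) = mkClause rP rN₂ rN₃ false (Zᵃ (a+ #0) (chosen x) it0) (Zᵃ (a+ #0) (chosen x) it1) (Zᵃ (a+ #0) (chosen x) itE)
  clause (pad x) = mkClause rN₁ rN₂ rN₃ true (Cᵃ (con #0) (b+ #0) #4) (Cᵃ (con #0) (b+ #0) #4)
    (if x then Tᵃ (con #0) (b+ #0) blank else Cᵃ (con #0) (b+ #1) #4)
  clause (tableau write q s) = mkClause rN₁ rN₂ rN₃ true (Hᵃ q (a+ #0) (b+ #0)) (Tᵃ (a+ #0) (b+ #0) s)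
    (Tᵃ (a+ #1) (b+ #0) (proj₁ (proj₂ (next q s))))
  clause (tableau goes q s)  = moved q (next q s) s
  clause (tableau goes₀ q s) = mkClause rN₁ rN₂ rN₃ true (Hᵃ q (a+ #0) (con #0)) (Tᵃ (a+ #0) (con #0) s)
    (Hᵃ (proj₁ (next q s)) (a+ #1) (con (from₀ (proj₂ (proj₂ (next q s))))))
  -- That a cell differs from the scanned one is expressed by the distance `c + 1`, once to the
  -- right and once to the left; inequality thus takes no further atom.
  clause (tableau keepʳ q s) = mkClause rN₁ rN₂ rN₃ true (Hᵃ q (a+ #0) (b+ #0)) (Tᵃ (a+ #0) bc+ s) (Tᵃ (a+ #1) bc+ s)
  clause (tableau keepˡ q s) = mkClause rN₁ rN₂ rN₃ true (Hᵃ q (a+ #0) bc+) (Tᵃ (a+ #0) (b+ #0) s) (Tᵃ (a+ #1) (b+ #0) s)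

  ⋀⁼ : ∀ {d} → Fin d → FT K (suc d) → FT K d
  ⋀⁼ v φ = ⋀ v φ φ

  ⋀ᶠ : ∀ {n d} → (Fin n → FT K d) → FT K d
  ⋀ᶠ {zero}  f = valid
  ⋀ᶠ {suc n} f = f zero ∧ᵗ ⋀ᶠ (λ p → f (suc p))

  instances : Clause → FT K 9 → FT K 6
  instances γ φ = ⋀⁼ (range₁ γ) (⋀⁼ (suc (range₂ γ)) (⋀⁼ (suc (suc (range₃ γ))) φ))
    where open Clause

  family : Fin nFamilies → Clause
  family p = clause (lookup families p)

  flag : Fin nFamilies → AtomT K 9
  flag p = at⟨ kF p , a+ #0 , b+ #0 , var #0 #0 ⟩

  literal : Bool → AtomT K 9 → FT K 9
  literal true  a = pos a
  literal false a = neg a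

  flagged violated guarded : Fin nFamilies → FT K 9
  flagged p  = pos (flag p)
  violated p = ◇ᵗ (◇^ (3 ↑ʳ rQ) (literal (sign γ) (prem₁ γ) ∧ᵗ literal (sign γ) (prem₂ γ) ∧ᵗ neg (concl γ) ∧ᵗ neg (flag p)))
    where open Clause
          γ = family p
  guarded p  = dep₃ (prem₁ γ) (prem₂ γ) (concl γ) (flag p)
    where open Clause
          γ = family p

  every : (Fin nFamilies → FT K 9) → FT K 6
  every f = ⋀ᶠ (λ p → instances (family p) (f p))

  -- After `N` steps the head may be in any of the cells 0 to `N`, one more than the counter
  -- reaches; hence the second atom at `b + 1`. The time `N` is read from a register that this loop
  -- does not consume.
  rejects : State → FT K 6
  rejects q = if accepting q then valid else
    ⋀⁼ rN₁ (neg (Hᵃ q (var (suc rN₃) #0) (var #0 #0)) ∧ᵗ neg (Hᵃ q (var (suc rN₃) #0) (var #0 #1)))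

  -- Inside the loop `rP` holds what is left behind position `j`, that is `P - j - 1` entries. So
  -- one diamond at depth `j` followed by these boxes ends at the leaves.
  branch : Item → FT K 7
  branch z = ◇ᵗ (□^ (suc rP) (pos (Zᵃ (var #0 #0) #2 z)))

  -- Two dependence atoms per entry suffice for constancy, because `readItem` looks only at the
  -- atoms for `it0` and `it1`. In `branchingStep` the loop counter is the depth of the branching.
  constantStep branchingStep : FT K 7
  constantStep  = □^ (suc rQ) (dep₀ (Zᵃ (var #0 #0) #1 it0) ∧ᵗ dep₀ (Zᵃ (var #0 #0) #1 it1))
  branchingStep = □^ #0 (branch it0 ∧ᵗ branch it1 ∧ᵗ branch itE)

  leaf constant branching formula : FT K 6
  leaf = pos (Cᵃ (con #0) (con #0) #0) ∧ᵗ pos (Hᵃ start (con #0) (con #0)) ∧ᵗ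
         ⋀ rX (pos (Zᵃ (var #0 #0) #0 it0)) (pos (Zᵃ (var #0 #0) #0 it1)) ∧ᵗ
         ⋀ᶠ rejects ∧ᵗ every flagged
  constant = ⋀⁼ rP constantStep
  branching = ⋀⁼ rP branchingStep
  -- The outer diamond keeps the tree apart from the violating worlds, whose flags are down; the
  -- last conjunct has no such restriction and covers all worlds of that depth.
  formula = ◇ᵗ (branching ∧ᵗ constant ∧ᵗ □^ rQ leaf) ∧ᵗ every violated ∧ᵗ □ᵗ (□^ rQ (every guarded))

-- Computing the parameters of the formula in registers

pow : ∀ {d} → ℕ → Fin d → G d
pow zero    v = emit true
pow (suc k) v = lett (pow k v) (each zero (copy (suc (suc v))))

⟦pow⟧ : ∀ {d} k v (ρ : Env d) → ⟦ pow k v ⟧ ρ ≡ ones (reg ρ v ^ k)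
⟦pow⟧ zero    v ρ = refl
⟦pow⟧ (suc k) v ρ = trans
  (⟦each⟧-ones zero (copy (suc (suc v))) (⟦ pow k v ⟧ ρ ∷ ρ) (reg ρ v) (λ p r → ⟦copy⟧ (suc (suc v)) (p ∷ r ∷ ρ)))
  (cong ones (trans (cong (λ w → length w * reg ρ v) (⟦pow⟧ k v ρ))
    (trans (cong (_* reg ρ v) (length-replicate (reg ρ v ^ k))) (*-comm _ (reg ρ v)))))

polyG : ∀ {d} → ℕ → Fin d → G d
polyG c v = lett (pow c v) (copies c (copy zero)) ⨾ emits (ones c)

⟦polyG⟧ : ∀ {d} c v (ρ : Env d) → ⟦ polyG c v ⟧ ρ ≡ ones (poly c (reg ρ v))
⟦polyG⟧ c v ρ = trans
  (cong₂ _++_ (⟦copies⟧-ones c (reg ρ v ^ c) (copy zero) (⟦ pow c v ⟧ ρ ∷ ρ)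
                (trans (⟦copy⟧ zero (⟦ pow c v ⟧ ρ ∷ ρ)) (cong ones (trans (cong length (⟦pow⟧ c v ρ)) (length-replicate _)))))
              (⟦emits⟧ (ones c) ρ))
  (ones-+ (c * reg ρ v ^ c) c)

duplicate : ∀ {d} → Fin d → G d
duplicate v = for v (emit false) (emit true)

⟦duplicate⟧ : ∀ {d} (v : Fin d) ρ → ⟦ duplicate v ⟧ ρ ≡ Vec.lookup ρ v
⟦duplicate⟧ v ρ = go [] (Vec.lookup ρ v)
  where
  go : ∀ p r → sweep (λ p b r → if b then true ∷ [] else false ∷ []) p r ≡ r
  go p []          = refl
  go p (true ∷ r)  = cong (true ∷_) (go _ r)
  go p (false ∷ r) = cong (false ∷_) (go _ r)

⟦let⟧ : ∀ {d} (g : G d) h ρ {v w} → ⟦ g ⟧ ρ ≡ v → ⟦ h ⟧ (v ∷ ρ) ≡ w → ⟦ lett g h ⟧ ρ ≡ w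
⟦let⟧ g h ρ refl e = e

module Registers (K c e : ℕ) where

  cells bound base : List Bool → ℕ
  cells x = poly e (length x)
  bound x = poly c (length x)
  base x  = (cells x + cells x) + 5

  -- The first three are the weights of the atom numbering; the others are intermediate values that
  -- remain in scope.
  tailRegs : List Bool → Env 6
  tailRegs x = ones (base x * (base x * K)) ∷ ones (base x * K) ∷ ones K ∷ ones (base x) ∷ ones (cells x) ∷ x ∷ []

  -- A loop consumes its register, so three nested loops up to `N` require three copies. The second
  -- copy of the bound on the words is never looped over and gives the depth of the leaves inside
  -- all loops.
  mainRegs : List Bool → Env 6
  mainRegs x = x ∷ ones (cells x) ∷ ones (cells x) ∷ ones (cells x) ∷ ones (bound x) ∷ ones (bound x) ∷ []

  module Chain (h : G 12) where

    h₁₁ : G 11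
    h₁₁ = lett (duplicate (suc (suc (suc (suc (suc #5)))))) h
    h₁₀ : G 10
    h₁₀ = lett (copy #0) h₁₁
    h₉ : G 9
    h₉ = lett (copy #0) h₁₀
    h₈ : G 8
    h₈ = lett (copy (suc (suc #4))) h₉
    h₇ : G 7
    h₇ = lett (copy #0) h₈
    h₆ : G 6
    h₆ = lett (polyG c #5) h₇
    h₅ : G 5
    h₅ = lett (each #2 (copy (suc #0))) h₆
    h₄ : G 4
    h₄ = lett (each #1 (copy (suc #0))) h₅
    h₃ : G 3
    h₃ = lett (emits (ones K)) h₄
    h₂ : G 2
    h₂ = lett ((copy #0 ⨾ copy #0) ⨾ emits (ones 5)) h₃
    h₁ : G 1
    h₁ = lett (polyG e #0) h₂

  withRegisters : G 12 → G 1
  withRegisters h = Chain.h₁ h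

  private
    copied : ∀ {d} v (ρ : Env d) {n} → Vec.lookup ρ v ≡ ones n → ⟦ copy v ⟧ ρ ≡ ones n
    copied v ρ {n} e = trans (⟦copy⟧ v ρ) (cong ones (trans (cong length e) (length-replicate n)))

    multiplied : ∀ {d} v u (ρ : Env d) {m n} → Vec.lookup ρ v ≡ ones m → (∀ p r → ⟦ copy u ⟧ (p ∷ ρ [ v ]≔ r) ≡ ones n) →
                 ⟦ each v (copy u) ⟧ ρ ≡ ones (m * n)
    multiplied v u ρ {m} {n} e h = trans (⟦each⟧-ones v (copy u) ρ n h) (cong (λ x → ones (x * n)) (trans (cong length e) (length-replicate m)))

  ⟦withRegisters⟧ : ∀ h x → ⟦ withRegisters h ⟧ (x ∷ []) ≡ ⟦ h ⟧ (mainRegs x Vec.++ tailRegs x)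
  ⟦withRegisters⟧ h x =
    ⟦let⟧ (polyG e #0) h₂ ρ₁ (⟦polyG⟧ e #0 ρ₁) (
    ⟦let⟧ ((copy #0 ⨾ copy #0) ⨾ emits (ones 5)) h₃ ρ₂ (twice+5 ρ₁) (
    ⟦let⟧ (emits (ones K)) h₄ ρ₃ (⟦emits⟧ (ones K) ρ₃) (
    ⟦let⟧ (each #1 (copy (suc #0))) h₅ ρ₄ (multiplied #1 (suc #0) ρ₄ refl (λ p r → copied (suc #0) (p ∷ ρ₄ [ #1 ]≔ r) refl)) (
    ⟦let⟧ (each #2 (copy (suc #0))) h₆ ρ₅ (multiplied #2 (suc #0) ρ₅ refl (λ p r → copied (suc #0) (p ∷ ρ₅ [ #2 ]≔ r) refl)) (
    ⟦let⟧ (polyG c #5) h₇ ρ₆ (⟦polyG⟧ c #5 ρ₆) (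
    ⟦let⟧ (copy #0) h₈ ρ₇ (copied #0 ρ₇ refl) (
    ⟦let⟧ (copy (suc (suc #4))) h₉ ρ₈ (copied (suc (suc #4)) ρ₈ refl) (
    ⟦let⟧ (copy #0) h₁₀ ρ₉ (copied #0 ρ₉ refl) (
    ⟦let⟧ (copy #0) h₁₁ ρ₁₀ (copied #0 ρ₁₀ refl) (
    ⟦let⟧ (duplicate (suc (suc (suc (suc (suc #5)))))) h ρ₁₁ (⟦duplicate⟧ (suc (suc (suc (suc (suc #5))))) ρ₁₁) (
    refl)))))))))))
    where
    open Chain h
    ρ₁ : Env 1
    ρ₁ = x ∷ []
    ρ₂ : Env 2
    ρ₂ = ones (cells x) ∷ ρ₁
    ρ₃ : Env 3
    ρ₃ = ones (base x) ∷ ρ₂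
    ρ₄ : Env 4
    ρ₄ = ones K ∷ ρ₃
    ρ₅ : Env 5
    ρ₅ = ones (base x * K) ∷ ρ₄
    ρ₆ : Env 6
    ρ₆ = ones (base x * (base x * K)) ∷ ρ₅
    ρ₇ : Env 7
    ρ₇ = ones (bound x) ∷ ρ₆
    ρ₈ : Env 8
    ρ₈ = ones (bound x) ∷ ρ₇
    ρ₉ : Env 9
    ρ₉ = ones (cells x) ∷ ρ₈
    ρ₁₀ : Env 10
    ρ₁₀ = ones (cells x) ∷ ρ₉
    ρ₁₁ : Env 11
    ρ₁₁ = ones (cells x) ∷ ρ₁₀
    twice+5 : ∀ (ρ : Env 1) → ⟦ (copy #0 ⨾ copy #0) ⨾ emits (ones 5) ⟧ (ones (cells x) ∷ ρ) ≡ ones (base x)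
    twice+5 ρ rewrite copied {2} #0 (ones (cells x) ∷ ρ) {cells x} refl =
      trans (cong (_++ ones 5) (ones-+ (cells x) (cells x))) (ones-+ (cells x + cells x) 5)

-- From models to accepting runs

-- One pass through a loop over `r`; the value of its counter is the length of `pre`.
record Split (r : List Bool) : Set where
  constructor split
  field
    pre   : List Bool
    bit   : Bool
    post  : List Bool
    whole : r ≡ pre ++ bit ∷ post

open Split

enter : ∀ {d} (ρ : Env d) v → Split (Vec.lookup ρ v) → Env (suc d)
enter ρ v u = pre u ∷ ρ [ v ]≔ post u

module Teams (W : Frame) where
  open Frame W

  image : Team W → Team W
  image T = λ s′ → Σ S λ s → T s × R s s′

  descendants : ℕ → Team W → Team W
  descendants zero    T = T
  descendants (suc n) T = descendants n (image T)

  Path : ℕ → S → S → Set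
  Path zero    s s′ = s ≡ s′
  Path (suc n) s s′ = Σ S λ s₁ → R s s₁ × Path n s₁ s′

  path-descends : ∀ n {T s s′} → T s → Path n s s′ → descendants n T s′
  path-descends zero    t refl          = t
  path-descends (suc n) t (s₁ , r , p) = path-descends n (_ , t , r) p

  path-snoc : ∀ n {s s₁ s₂} → Path n s s₁ → R s₁ s₂ → Path (suc n) s s₂
  path-snoc zero    refl          r = _ , r , refl
  path-snoc (suc n) (s′ , r′ , p) r = s′ , r′ , path-snoc n p r

  boxes-elim : ∀ n {T φ} → Sat W T (boxes n φ) → Sat W (descendants n T) φ
  boxes-elim zero    sat = sat
  boxes-elim (suc n) sat = boxes-elim n sat

  boxes-intro : ∀ n {T φ} → Sat W (descendants n T) φ → Sat W T (boxes n φ)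
  boxes-intro zero    sat = sat
  boxes-intro (suc n) sat = boxes-intro n sat

  -- A single world is followed: of the team chosen by a diamond, only the member supplied as a
  -- successor of `s` is known to be reachable. The path is kept so that the end can also be placed
  -- in descendants of other teams.
  diamonds-elim : ∀ n {T φ s} → T s → Sat W T (diamonds n φ) →
                  Σ S λ s′ → Path n s s′ × Σ (Team W) λ T′ → T′ s′ × Sat W T′ φ
  diamonds-elim zero    t sat = _ , refl , _ , t , sat
  diamonds-elim (suc n) t (T₁ , sat , lift f) =
    let s₁ , t₁ , r = f _ t ; s′ , p , rest = diamonds-elim n t₁ sat in s′ , (s₁ , r , p) , rest

  conj-elim : ∀ {T f} p₀ p b q {r} → r ≡ p ++ b ∷ q → Sat W T (conj f p₀ r) → Sat W T (f (p₀ ++ p) b q)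
  conj-elim {T} {f} p₀ []      b q refl (sat , _) = subst (λ p → Sat W T (f p b q)) (sym (++-identityʳ p₀)) sat
  conj-elim {T} {f} p₀ (x ∷ p) b q refl (_ , sat) =
    subst (λ p → Sat W T (f p b q)) (++-assoc p₀ (x ∷ []) p) (conj-elim (p₀ ++ x ∷ []) p b q refl sat)

  tautology-sat : ∀ {T} → Sat W T tautology
  tautology-sat = lift λ { _ _ _ _ (e All.∷ _) → e }

  conj-intro : ∀ {T f} p₀ r → (∀ p b q → p₀ ++ r ≡ p ++ b ∷ q → Sat W T (f p b q)) → Sat W T (conj f p₀ r)
  conj-intro p₀ []      h = tautology-sat
  conj-intro p₀ (b ∷ r) h = h p₀ b r refl ,
    conj-intro (p₀ ++ b ∷ []) r λ p b′ q e → h p b′ q (trans (sym (++-assoc p₀ (b ∷ []) r)) e)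

  module _ {K : ℕ} (w : Weights) {T : Team W} where

    ⋀⁼-elim : ∀ {d} (φ : FT K (suc d)) ρ v u → Sat W T (sem w (⋀ v φ φ) ρ) → Sat W T (sem w φ (enter ρ v u))
    ⋀⁼-elim φ ρ v (split p false q e) = conj-elim [] p false q e
    ⋀⁼-elim φ ρ v (split p true  q e) = conj-elim [] p true q e

    ⋀-intro : ∀ {d} (φ ψ : FT K (suc d)) ρ v →
              (∀ u → Sat W T (if bit u then sem w ψ (enter ρ v u) else sem w φ (enter ρ v u))) → Sat W T (sem w (⋀ v φ ψ) ρ)
    ⋀-intro φ ψ ρ v h = conj-intro [] (Vec.lookup ρ v) λ p b q e → h (split p b q e)

    ⋀⁼-intro : ∀ {d} (φ : FT K (suc d)) ρ v → (∀ u → Sat W T (sem w φ (enter ρ v u))) → Sat W T (sem w (⋀ v φ φ) ρ)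
    ⋀⁼-intro φ ρ v h = ⋀-intro φ φ ρ v λ { u@(split _ false _ _) → h u ; u@(split _ true _ _) → h u }

splitAtIndex : ∀ r {a} → a < length r → Σ (Split r) λ u → length (pre u) ≡ a
splitAtIndex (b ∷ r) {zero}  lt       = split [] b r refl , refl
splitAtIndex (b ∷ r) {suc a} (s≤s lt) =
  let split p b′ q e , l = splitAtIndex r lt in split (b ∷ p) b′ q (cong (b ∷_) e) , cong suc l

-- Instances of clauses come indexed by splits of registers; here they are restated for numbers
-- below the lengths.
atIndices : ∀ {l₁ l₂ l₃} (Q : ℕ → ℕ → ℕ → Set) {a b c} → a < length l₁ → b < length l₂ → c < length l₃ →
            ((u : Split l₁) (v : Split l₂) (w : Split l₃) → Q (length (pre u)) (length (pre v)) (length (pre w))) → Q a b c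
atIndices {l₁} {l₂} {l₃} Q a< b< c< h with splitAtIndex l₁ a< | splitAtIndex l₂ b< | splitAtIndex l₃ c<
... | u , refl | v , refl | w , refl = h u v w

stream : List Bool → ℕ → Item
stream []          j       = itE
stream (true ∷ y)  zero    = it1
stream (false ∷ y) zero    = it0
stream (b ∷ y)     (suc j) = stream y j

-- A word of length at most `k` as `k` entries: the first `itE` ends it and later entries do not
-- count. Every stream decodes to such a word and every such word arises, so branching over entries
-- is quantification over words.
decode : ℕ → ℕ → (ℕ → Item) → List Bool
decodeItem : ℕ → ℕ → (ℕ → Item) → Item → List Bool
decode zero    j z = []
decode (suc k) j z = decodeItem k j z (z j)
decodeItem k j z it0 = false ∷ decode k (suc j) z
decodeItem k j z it1 = true ∷ decode k (suc j) z
decodeItem k j z itE = []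

decode-length : ∀ k j z → length (decode k j z) ≤ k
decode-length zero    j z = z≤n
decode-length (suc k) j z with z j
... | it0 = s≤s (decode-length k (suc j) z)
... | it1 = s≤s (decode-length k (suc j) z)
... | itE = z≤n

decode-suc : ∀ k j z z′ → (∀ i → z′ (suc i) ≡ z i) → decode k (suc j) z′ ≡ decode k j z
decode-suc zero    j z z′ h = refl
decode-suc (suc k) j z z′ h rewrite h j with z j
... | it0 = cong (false ∷_) (decode-suc k (suc j) z z′ h)
... | it1 = cong (true ∷_) (decode-suc k (suc j) z z′ h)
... | itE = refl

decode-stream : ∀ k y → length y ≤ k → decode k 0 (stream y) ≡ y
decode-stream zero    []          le       = refl
decode-stream (suc k) []          le       = refl
decode-stream (suc k) (true ∷ y)  (s≤s le) = cong (true ∷_) (trans (decode-suc k 0 (stream y) _ (λ _ → refl)) (decode-stream k y le))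
decode-stream (suc k) (false ∷ y) (s≤s le) = cong (false ∷_) (trans (decode-suc k 0 (stream y) _ (λ _ → refl)) (decode-stream k y le))

double : List Bool → List Bool
double = concatMap (λ b → b ∷ b ∷ [])

segment : List Bool → List Bool → List Bool
segment y rest = (double y ++ false ∷ true ∷ []) ++ rest

module Soundness (V : TM) (Wt : Weights) (x cN cP : List Bool) (N-positive : 0 < length cN) where
  open Formula V
  open Clause

  N P : ℕ
  N = length cN
  P = length cP

  ρ₀ : Env 6
  ρ₀ = x ∷ cN ∷ cN ∷ cN ∷ cP ∷ cP ∷ []

  idx : Fin K → ℕ → ℕ → ℕ → AP
  idx k t i j = t * Weights.w₂ Wt + (i * Weights.w₁ Wt + (j * Weights.w₀ Wt + toℕ k))

  env₁ : ∀ γ → Split (Vec.lookup ρ₀ (range₁ γ)) → Env 7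
  env₁ γ u = enter ρ₀ (range₁ γ) u

  env₂ : ∀ γ u → Split (Vec.lookup (env₁ γ u) (suc (range₂ γ))) → Env 8
  env₂ γ u v = enter (env₁ γ u) (suc (range₂ γ)) v

  env₃ : ∀ γ u v → Split (Vec.lookup (env₂ γ u v) (suc (suc (range₃ γ)))) → Env 9
  env₃ γ u v w = enter (env₂ γ u v) (suc (suc (range₃ γ))) w

  AllInstances : ∀ {ℓ} → Clause → (Env 9 → Set ℓ) → Set ℓ
  AllInstances γ C = ∀ u v w → C (env₃ γ u v w)

  -- No clause ranges over `rQ`, so inside its loops this register still measures the depth of the
  -- leaves. The ranges compute only once the family is known, hence the cases.
  keepsQ : ∀ φ → AllInstances (clause φ) (λ E → reg E (3 ↑ʳ rQ) ≡ P)
  keepsQ (item zero z r) _ _ _ = refl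
  keepsQ (item (suc m) z r) _ _ _ = refl
  keepsQ (stop m r) _ _ _ = refl
  keepsQ (choose c) _ _ _ = refl
  keepsQ (pad c) _ _ _ = refl
  keepsQ (tableau write q s) _ _ _ = refl
  keepsQ (tableau goes q s) with next q s
  ... | _ , _ , left  = λ _ _ _ → refl
  ... | _ , _ , right = λ _ _ _ → refl
  ... | _ , _ , stay  = λ _ _ _ → refl
  keepsQ (tableau goes₀ q s) _ _ _ = refl
  keepsQ (tableau keepʳ q s) _ _ _ = refl
  keepsQ (tableau keepˡ q s) _ _ _ = refl

  module Model (W : Frame) (T : Team W) {s₀ : Frame.S W} (t₀ : T s₀) (sat : Sat W T (sem Wt formula ρ₀)) where
    open Frame W
    open Teams W

    T′ : Team W
    T′ = proj₁ (proj₁ sat)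

    main : Sat W T′ (sem Wt (branching ∧ᵗ constant ∧ᵗ □^ rQ leaf) ρ₀)
    main = proj₁ (proj₂ (proj₁ sat))

    -- The team `T′` may contain worlds that are not successors of `T`. This one lies in `T′` and in
    -- `image T`, and all leaves considered are reached from it.
    s₁ : S
    s₁ = proj₁ (lower (proj₂ (proj₂ (proj₁ sat))) s₀ t₀)

    s₁∈T′ : T′ s₁
    s₁∈T′ = proj₁ (proj₂ (lower (proj₂ (proj₂ (proj₁ sat))) s₀ t₀))

    s₁∈image : image T s₁
    s₁∈image = s₀ , t₀ , proj₂ (proj₂ (lower (proj₂ (proj₂ (proj₁ sat))) s₀ t₀))

    leafSat : Sat W (descendants P T′) (sem Wt leaf ρ₀)
    leafSat = boxes-elim P (proj₂ (proj₂ main))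

    guardedSat : Sat W (descendants P (image T)) (sem Wt (every guarded) ρ₀)
    guardedSat = boxes-elim P (proj₂ (proj₂ sat))

    ⋀ᶠ-elim : ∀ {n d T} (f : Fin n → FT K d) ρ p → Sat W T (sem Wt (⋀ᶠ f) ρ) → Sat W T (sem Wt (f p) ρ)
    ⋀ᶠ-elim f ρ zero    (sat , _) = sat
    ⋀ᶠ-elim f ρ (suc p) (_ , sat) = ⋀ᶠ-elim (λ p → f (suc p)) ρ p sat

    instances-elim : ∀ {T} γ φ → Sat W T (sem Wt (instances γ φ) ρ₀) → AllInstances γ (λ E → Sat W T (sem Wt φ E))
    instances-elim {T} γ φ sat u v w =
      ⋀⁼-elim Wt {T = T} φ (env₂ γ u v) (suc (suc (range₃ γ))) w
        (⋀⁼-elim Wt {T = T} (⋀⁼ (suc (suc (range₃ γ))) φ) (env₁ γ u) (suc (range₂ γ)) v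
          (⋀⁼-elim Wt {T = T} (⋀⁼ (suc (range₂ γ)) (⋀⁼ (suc (suc (range₃ γ))) φ)) ρ₀ (range₁ γ) u sat))

    literal-elim : ∀ {T w} s a E → T w → Sat W T (sem Wt (literal s a) E) → π w (index Wt a E) ≡ s
    literal-elim true  a E t (lift h) = h _ t
    literal-elim false a E t (lift h) = h _ t

    Forced : S → Clause → Env 9 → Set
    Forced w γ E = π w (index Wt (prem₁ γ) E) ≡ sign γ → π w (index Wt (prem₂ γ) E) ≡ sign γ → π w (index Wt (concl γ) E) ≡ true

    -- A world of the guarded team that violates the clause has its flag down, while the flags of leaves are up;
    -- by the dependence atom no leaf can agree with that world on the three atoms of the clause.
    flags-force : ∀ {w} → descendants P T′ w → descendants P (image T) w → ∀ p E →
      reg E (3 ↑ʳ rQ) ≡ P →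
      Sat W (descendants P T′) (sem Wt (flagged p) E) →
      Sat W T (sem Wt (violated p) E) →
      Sat W (descendants P (image T)) (sem Wt (guarded p) E) →
      Forced w (family p) E
    flags-force {w} w∈ w∈′ p E eQ (lift up) viol (lift determines) h₁ h₂ with π w (index Wt (concl (family p)) E) in h₃
    ... | true  = refl
    ... | false = ⊥-elim (contra (trans (sym (up w w∈)) (trans (determines w e w∈′ e∈ agree) (lower (proj₂ (proj₂ (proj₂ esat))) e te))))
      where
      γ = family p
      viol′ : Sat W T (diamonds (suc P) (sem Wt (literal (sign γ) (prem₁ γ) ∧ᵗ literal (sign γ) (prem₂ γ) ∧ᵗ neg (concl γ) ∧ᵗ neg (flag p)) E))
      viol′ = subst (λ n → Sat W T (diamonds (suc n) (sem Wt (literal (sign γ) (prem₁ γ) ∧ᵗ literal (sign γ) (prem₂ γ) ∧ᵗ neg (concl γ) ∧ᵗ neg (flag p)) E))) eQ viol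
      found = diamonds-elim (suc P) t₀ viol′
      e = proj₁ found
      e∈ : descendants P (image T) e
      e∈ = path-descends (suc P) t₀ (proj₁ (proj₂ found))
      te = proj₁ (proj₂ (proj₂ (proj₂ found)))
      esat = proj₂ (proj₂ (proj₂ (proj₂ found)))
      agree : agreeOn _ (π w) (π e)
      agree = trans h₁ (sym (literal-elim (sign γ) (prem₁ γ) E te (proj₁ esat))) All.∷
              trans h₂ (sym (literal-elim (sign γ) (prem₂ γ) E te (proj₁ (proj₂ esat)))) All.∷
              trans h₃ (sym (lower (proj₁ (proj₂ (proj₂ esat))) e te)) All.∷ All.[]
      contra : true ≡ false → ⊥
      contra ()

    forced : ∀ {w} → descendants P T′ w → descendants P (image T) w → ∀ φ → AllInstances (clause φ) (Forced w (clause φ))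
    forced {w} w∈ w∈′ φ = subst (λ φ → AllInstances (clause φ) (Forced w (clause φ))) (sym (lookup-index (families∈ φ))) at-index
      where
      p = Any.index (families∈ φ)
      at-index : AllInstances (family p) (Forced w (family p))
      at-index u v w = flags-force w∈ w∈′ p _ (keepsQ (lookup families p) u v w)
        (instances-elim (family p) (flagged p) (⋀ᶠ-elim (λ p → instances (family p) (flagged p)) ρ₀ p (proj₂ (proj₂ (proj₂ (proj₂ leafSat))))) u v w)
        (instances-elim (family p) (violated p) (⋀ᶠ-elim (λ p → instances (family p) (violated p)) ρ₀ p (proj₁ (proj₂ sat))) u v w)
        (instances-elim (family p) (guarded p) (⋀ᶠ-elim (λ p → instances (family p) (guarded p)) ρ₀ p guardedSat) u v w)

    branches : ∀ j k → j + suc k ≡ P → ∀ z → Sat W (descendants j T′) (◇ (boxes k (atom (idx kZ j 2 (toℕ (itemCode z))))))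
    branches j k e z with splitAtIndex cP (≤-trans (≤-trans (≤-reflexive (+-comm 1 j)) (+-monoʳ-≤ j (s≤s z≤n))) (≤-reflexive e))
    ... | u , refl = subst B (suc-injective (+-cancelˡ-≡ (length (pre u)) _ _ (trans (sym (length-++ (pre u))) (trans (cong length (sym (whole u))) (sym e)))))
        (pick z (boxes-elim (length (pre u)) (⋀⁼-elim Wt branchingStep ρ₀ rP u (proj₁ main))))
      where
      C : ℕ → Item → Set₁
      C k z = Sat W (descendants j T′) (◇ (boxes k (atom (idx kZ j 2 (toℕ (itemCode z))))))
      B : ℕ → Set₁
      B k = C k z
      pick : ∀ z → C (length (post u)) it0 × C (length (post u)) it1 × C (length (post u)) itE → C (length (post u)) z
      pick it0 (h , _ , _) = h
      pick it1 (_ , h , _) = h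
      pick itE (_ , _ , h) = h

    -- Following the diamond for u j at every level j leads to a leaf at which segment 2 is u.
    walk : ∀ (u : ℕ → Item) k j s → j + k ≡ P → Path j s₁ s →
           Σ S λ w → Path k s w × Path P s₁ w × (∀ i → j ≤ i → i < P → π w (idx kZ i 2 (toℕ (itemCode (u i)))) ≡ true)
    walk u zero    j s e path = s , refl , subst (λ n → Path n s₁ s) (trans (sym (+-identityʳ j)) e) path ,
      λ i j≤i i<P → ⊥-elim (<-irrefl refl (≤-trans i<P (≤-trans (≤-reflexive (trans (sym e) (+-identityʳ j))) j≤i)))
    walk u (suc k) j s e path with branches j k e (u j)
    ... | T″ , sat″ , lift f with f s (path-descends j s₁∈T′ path)
    ... | s₂ , t₂ , r with walk u k (suc j) s₂ (trans (sym (+-suc j k)) e) (path-snoc j path r)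
    ... | w , rest , whole , good = w , (s₂ , r , rest) , whole , good′
      where
      good′ : ∀ i → j ≤ i → i < P → π w (idx kZ i 2 (toℕ (itemCode (u i)))) ≡ true
      good′ i j≤i i<P with m≤n⇒m<n∨m≡n j≤i
      ... | inj₁ j<i  = good i j<i i<P
      ... | inj₂ refl = lower (boxes-elim k sat″) w (path-descends k t₂ rest)

    leafFor : (u : ℕ → Item) → S
    leafFor u = proj₁ (walk u P 0 s₁ refl refl)

    leafFor-reads : ∀ u i → i < P → π (leafFor u) (idx kZ i 2 (toℕ (itemCode (u i)))) ≡ true
    leafFor-reads u i = proj₂ (proj₂ (proj₂ (walk u P 0 s₁ refl refl))) i z≤n

    leafFor∈ : ∀ u {U} → U s₁ → descendants P U (leafFor u)
    leafFor∈ u t = path-descends P t (proj₁ (proj₂ (walk u P 0 s₁ refl refl)))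

    constants : ∀ u u′ j → j < P →
                (π (leafFor u) (idx kZ j 1 0) ≡ π (leafFor u′) (idx kZ j 1 0)) ×
                (π (leafFor u) (idx kZ j 1 1) ≡ π (leafFor u′) (idx kZ j 1 1))
    constants u u′ j j< with splitAtIndex cP j<
    ... | v , refl with boxes-elim P (⋀⁼-elim Wt constantStep ρ₀ rP v (proj₁ (proj₂ main)))
    ... | lift h , lift h′ = h _ _ (leafFor∈ u s₁∈T′) (leafFor∈ u′ s₁∈T′) All.[] ,
                             h′ _ _ (leafFor∈ u s₁∈T′) (leafFor∈ u′ s₁∈T′) All.[]

-- Runs of the verifier

run-suc : ∀ M n c → run M (suc n) c ≡ step M (run M n c)
run-suc M zero    c = refl
run-suc M (suc n) c = run-suc M n (step M c)

step-halted : ∀ M c → Halted M c → step M c ≡ c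
step-halted M (cfg q h t) halted with TM.halting M q
step-halted M (cfg q h t) refl | true = refl

run-halted : ∀ M n c → Halted M c → run M n c ≡ c
run-halted M zero    c halted = refl
run-halted M (suc n) c halted = trans (cong (run M n) (step-halted M c halted)) (run-halted M n c halted)

run-+ : ∀ M m n c → run M (m + n) c ≡ run M n (run M m c)
run-+ M zero    n c = refl
run-+ M (suc m) n c = run-+ M m n (step M c)

-- This allows the tableau to have `N` rows for all choices of the words, although the time bound
-- varies with the length of the tuple.
after-halted : ∀ M x m n → m ≤ n → Halted M (after M x m) → after M x n ≡ after M x m
after-halted M x m n le halted = trans (cong (after M x) (sym (m+[n∸m]≡n le)))
  (trans (run-+ M m (n ∸ m) (initial M x)) (run-halted M (n ∸ m) (after M x m) halted))

≡ᵇ-refl : ∀ n → (n ≡ᵇ n) ≡ true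
≡ᵇ-refl zero    = refl
≡ᵇ-refl (suc n) = ≡ᵇ-refl n

≡ᵇ-sound : ∀ m n → (m ≡ᵇ n) ≡ true → m ≡ n
≡ᵇ-sound zero    zero    e = refl
≡ᵇ-sound (suc m) (suc n) e = cong suc (≡ᵇ-sound m n e)

module Stepping (V : TM) where
  open Formula V using (next)

  open Config

  step-next : ∀ c → let q′ , s , m = next (state c) (tape c (head c)) in
    state (step V c) ≡ q′ × head (step V c) ≡ move m (head c) ×
    (∀ i → tape (step V c) i ≡ (if i ≡ᵇ head c then s else tape c i))
  step-next (cfg q h t) with TM.halting V q
  ... | false = refl , refl , λ i → refl
  ... | true  = refl , refl , same
    where
    same : ∀ i → t i ≡ (if i ≡ᵇ h then t h else t i)
    same i with i ≡ᵇ h in e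
    ... | true  = cong t (≡ᵇ-sound i h e)
    ... | false = refl

stream-at : ∀ p b q → stream (p ++ b ∷ q) (length p) ≡ (if b then it1 else it0)
stream-at []          true  q = refl
stream-at []          false q = refl
stream-at (true ∷ p)  b     q = stream-at p b q
stream-at (false ∷ p) b     q = stream-at p b q

-- The accepting run read off at a leaf

module Reading (V : TM) (Wt : Weights) (x cN cP : List Bool) (N-positive : 0 < length cN)
  (W : Frame) (T : Team W) {s₀ : Frame.S W} (t₀ : T s₀) (sat : Sat W T (sem Wt (Formula.formula V) (x ∷ cN ∷ cN ∷ cN ∷ cP ∷ cP ∷ []))) where
  open Formula V

  open Soundness V Wt x cN cP N-positive
  open Model W T t₀ sat
  open Teams W
  open Frame W
  open Config

  module AtLeaf (u : ℕ → Item) where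

    w : S
    w = leafFor u

    Hold : Fin K → ℕ → ℕ → ℕ → Set
    Hold k t i j = π w (idx k t i j) ≡ true

    fact : ∀ φ → AllInstances (clause φ) (Forced w (clause φ))
    fact = forced (leafFor∈ u s₁∈T′) (leafFor∈ u s₁∈image)

    HoldT : ℕ → ℕ → Sym → Set
    HoldT t i s = Hold kT t i (toℕ (cell s))

    HoldC : ℕ → ℕ → Fin 5 → Set
    HoldC j i m = Hold kC j i (toℕ m)

    HoldZ : ℕ → Fin 5 → Item → Set
    HoldZ j m z = Hold kZ j (toℕ m) (toℕ (itemCode z))

    HoldH : State → ℕ → ℕ → Set
    HoldH q t i = Hold (kH q) t i 0

    Written : Fin 4 → Item → Target → ℕ → ℕ → Set
    Written m z   fstCell  j i = HoldT 0 i (proj₁ (itemSyms z))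
    Written m z   sndCell  j i = HoldT 0 (suc i) (proj₂ (itemSyms z))
    Written m itE continue j i = HoldC 0 (2 + i) (suc m)
    Written m z   continue j i = HoldC (suc j) (2 + i) (Fin.inject₁ m)

    segLength : Fin 4 → ℕ
    segLength m = reg ρ₀ (segRange m)

    item-fact : ∀ m z r {j i} → j < segLength m → i < N → HoldC j i (Fin.inject₁ m) → HoldZ j (Fin.inject₁ m) z → Written m z r j i
    item-fact m z r {j} {i} j< i< = go m z r j<
      where
      Q : Fin 4 → Item → Target → ℕ → ℕ → ℕ → Set
      Q m z r a b c = HoldC a b (Fin.inject₁ m) → HoldZ a (Fin.inject₁ m) z → Written m z r a b
      go : ∀ m z r → j < segLength m → Q m z r j i 0
      -- The cases share one argument; they are separated so that `segRange` and `written` compute.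
      go zero z fstCell j<   = atIndices (Q zero z fstCell) j< i< N-positive (fact (item zero z fstCell))
      go zero z sndCell j<   = atIndices (Q zero z sndCell) j< i< N-positive (fact (item zero z sndCell))
      go zero it0 continue j< = atIndices (Q zero it0 continue) j< i< N-positive (fact (item zero it0 continue))
      go zero it1 continue j< = atIndices (Q zero it1 continue) j< i< N-positive (fact (item zero it1 continue))
      go zero itE continue j< = atIndices (Q zero itE continue) j< i< N-positive (fact (item zero itE continue))
      go (suc m) z fstCell j<   = atIndices (Q (suc m) z fstCell) j< i< N-positive (fact (item (suc m) z fstCell))
      go (suc m) z sndCell j<   = atIndices (Q (suc m) z sndCell) j< i< N-positive (fact (item (suc m) z sndCell))
      go (suc m) it0 continue j< = atIndices (Q (suc m) it0 continue) j< i< N-positive (fact (item (suc m) it0 continue))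
      go (suc m) it1 continue j< = atIndices (Q (suc m) it1 continue) j< i< N-positive (fact (item (suc m) it1 continue))
      go (suc m) itE continue j< = atIndices (Q (suc m) itE continue) j< i< N-positive (fact (item (suc m) itE continue))

    stop-fact : ∀ m r {i} → i < N → HoldC (segLength m) i (Fin.inject₁ m) → Written m itE r (segLength m) i
    stop-fact m r {i} i< = go m r
      where
      Q : Fin 4 → Target → ℕ → ℕ → ℕ → Set
      Q m r a b c = HoldC (segLength m) b (Fin.inject₁ m) → Written m itE r (segLength m) b
      go : ∀ m r → Q m r 0 i 0
      go zero fstCell     = atIndices (Q zero fstCell) N-positive i< N-positive λ u v w h → fact (stop zero fstCell) u v w h h
      go zero sndCell     = atIndices (Q zero sndCell) N-positive i< N-positive λ u v w h → fact (stop zero sndCell) u v w h h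
      go zero continue    = atIndices (Q zero continue) N-positive i< N-positive λ u v w h → fact (stop zero continue) u v w h h
      go (suc m) fstCell  = atIndices (Q (suc m) fstCell) N-positive i< N-positive λ u v w h → fact (stop (suc m) fstCell) u v w h h
      go (suc m) sndCell  = atIndices (Q (suc m) sndCell) N-positive i< N-positive λ u v w h → fact (stop (suc m) sndCell) u v w h h
      go (suc m) continue = atIndices (Q (suc m) continue) N-positive i< N-positive λ u v w h → fact (stop (suc m) continue) u v w h h

    pad-blank : ∀ {i} → i < N → HoldC 0 i #4 → HoldT 0 i blank
    pad-blank i< = atIndices (λ a b c → HoldC 0 b #4 → HoldT 0 b blank) N-positive i< N-positive
      λ u v w h → fact (pad true) u v w h h

    pad-continue : ∀ {i} → i < N → HoldC 0 i #4 → HoldC 0 (suc i) #4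
    pad-continue i< = atIndices (λ a b c → HoldC 0 b #4 → HoldC 0 (suc b) #4) N-positive i< N-positive
      λ u v w h → fact (pad false) u v w h h

    choose-fact : ∀ c {j} → j < P → π w (idx kZ j (toℕ (chosen c)) 0) ≡ false → π w (idx kZ j (toℕ (chosen c)) 1) ≡ false →
                  HoldZ j (chosen c) itE
    choose-fact c j< = atIndices
      (λ a _ _ → π w (idx kZ a (toℕ (chosen c)) 0) ≡ false → π w (idx kZ a (toℕ (chosen c)) 1) ≡ false → HoldZ a (chosen c) itE)
      j< N-positive N-positive (fact (choose c))

    -- Row 0 is claimed only below `N`. This is enough, as a head starting in cell 0 scans no other
    -- cell during the first `N` steps.
    TapeFrom : ℕ → List Bool → Set
    TapeFrom i []      = ∀ k → i + k < N → HoldT 0 (i + k) blank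
    TapeFrom i (b ∷ ℓ) = (i < N → HoldT 0 i (toSym b)) × TapeFrom (suc i) ℓ

    tape-beyond : ∀ i ℓ → N ≤ i → TapeFrom i ℓ
    tape-beyond i []      le k lt = ⊥-elim (<-irrefl refl (≤-trans lt (≤-trans le (m≤m+n i k))))
    tape-beyond i (b ∷ ℓ) le = (λ lt → ⊥-elim (<-irrefl refl (≤-trans lt le))) , tape-beyond (suc i) ℓ (≤-trans le (n≤1+n i))

    tape-read : ∀ i ℓ → TapeFrom i ℓ → ∀ k → i + k < N → HoldT 0 (i + k) (inputTape ℓ k)
    tape-read i []      h       k lt = h k lt
    tape-read i (b ∷ ℓ) (h , _) zero lt = subst (λ n → HoldT 0 n (toSym b)) (sym (+-identityʳ i)) (h (subst (_< N) (+-identityʳ i) lt))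
    tape-read i (b ∷ ℓ) (_ , h) (suc k) lt = subst (λ n → HoldT 0 n (inputTape ℓ k)) (sym (+-suc i k))
      (tape-read (suc i) ℓ h k (subst (_< N) (+-suc i k) lt))

    tape-blank : ∀ i → HoldC 0 i #4 → TapeFrom i []
    tape-blank i h zero    lt = subst (λ n → HoldT 0 n blank) (sym (+-identityʳ i)) (pad-blank (subst (_< N) (+-identityʳ i) lt) h)
    tape-blank i h (suc k) lt = subst (λ n → HoldT 0 n blank) (sym (+-suc i k))
      (tape-blank (suc i) (pad-continue (≤-trans (s≤s (m≤m+n i (suc k))) lt) h) k (subst (_< N) (+-suc i k) lt))

    -- The atom `HoldC` is handed on from code to code, two cells at a time, by induction on the
    -- number `k` of entries left. The segment ends at its first `itE` or, when no entry is left, by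
    -- the `stop` clauses. Past cell `N` there is nothing to prove.
    tape-segment : ∀ m (z : ℕ → Item) rest → (∀ j → j < segLength m → HoldZ j (Fin.inject₁ m) (z j)) →
                   (∀ i → HoldC 0 i (suc m) → TapeFrom i rest) →
                   ∀ k j i → j + k ≡ segLength m → HoldC j i (Fin.inject₁ m) → TapeFrom i (segment (decode k j z) rest)
    tape-segment m z rest hz after′ k j i e h with i <? N
    ... | no  i≮ = tape-beyond i _ (≮⇒≥ i≮)
    ... | yes i< = go k e
      where
      go : ∀ k → j + k ≡ segLength m → TapeFrom i (segment (decode k j z) rest)
      go zero e = (λ _ → stop-fact m fstCell i< h′) , (λ _ → stop-fact m sndCell i< h′) , after′ _ (stop-fact m continue i< h′)
        where
        h′ = subst (λ j → HoldC j i (Fin.inject₁ m)) (trans (sym (+-identityʳ j)) e) h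
      go (suc k) e = step′ (z j) (hz j j<)
        where
        j< : j < segLength m
        j< = ≤-trans (s≤s (m≤m+n j k)) (≤-reflexive (trans (sym (+-suc j k)) e))
        step′ : ∀ v → HoldZ j (Fin.inject₁ m) v → TapeFrom i (segment (decodeItem k j z v) rest)
        step′ it0 hv = (λ _ → item-fact m it0 fstCell j< i< h hv) , (λ _ → item-fact m it0 sndCell j< i< h hv) ,
          tape-segment m z rest hz after′ k (suc j) (2 + i) (trans (sym (+-suc j k)) e) (item-fact m it0 continue j< i< h hv)
        step′ it1 hv = (λ _ → item-fact m it1 fstCell j< i< h hv) , (λ _ → item-fact m it1 sndCell j< i< h hv) ,
          tape-segment m z rest hz after′ k (suc j) (2 + i) (trans (sym (+-suc j k)) e) (item-fact m it1 continue j< i< h hv)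
        step′ itE hv = (λ _ → item-fact m itE fstCell j< i< h hv) , (λ _ → item-fact m itE sndCell j< i< h hv) ,
          after′ _ (item-fact m itE continue j< i< h hv)
    -- A leaf may hold several item atoms for one entry, so a priority is fixed. The third atom is
    -- not consulted: it is forced by `choose` when the first two fail.
    readItem : Fin 5 → ℕ → Item
    readItem m j = if π w (idx kZ j (toℕ m) 0) then it0 else if π w (idx kZ j (toℕ m) 1) then it1 else itE

    readItem-holds : ∀ c j → j < P → HoldZ j (chosen c) (readItem (chosen c) j)
    readItem-holds c j j< with π w (idx kZ j (toℕ (chosen c)) 0) in e₀
    ... | true  = e₀
    ... | false with π w (idx kZ j (toℕ (chosen c)) 1) in e₁
    ... | true  = e₁
    ... | false = choose-fact c j< e₀ e₁

    starts : HoldC 0 0 #0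
    starts = lower (proj₁ leafSat) w (leafFor∈ u s₁∈T′)

    starts-head : HoldH (TM.start V) 0 0
    starts-head = lower (proj₁ (proj₂ leafSat)) w (leafFor∈ u s₁∈T′)

    input-holds : ∀ j → j < length x → HoldZ j #0 (stream x j)
    input-holds j j< with splitAtIndex x j<
    ... | split p b q e , refl = subst (HoldZ (length p) #0) (sym (trans (cong (λ x → stream x (length p)) e) (stream-at p b q)))
      (by-bit b (conj-elim [] p b q e (proj₁ (proj₂ (proj₂ leafSat)))))
      where
      by-bit : ∀ b → Sat W (descendants P T′) (if b then sem Wt (pos (Zᵃ (var #0 #0) #0 it1)) (p ∷ ρ₀ [ rX ]≔ q)
                                                    else sem Wt (pos (Zᵃ (var #0 #0) #0 it0)) (p ∷ ρ₀ [ rX ]≔ q)) →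
               HoldZ (length p) #0 (if b then it1 else it0)
      by-bit false (lift h) = h w (leafFor∈ u s₁∈T′)
      by-bit true  (lift h) = h w (leafFor∈ u s₁∈T′)

    never-rejects : ∀ q i → i ≤ N → HoldH q N i → TM.accepting V q ≡ true
    never-rejects q i i≤ h with TM.accepting V q | ⋀ᶠ-elim rejects ρ₀ q (proj₁ (proj₂ (proj₂ (proj₂ leafSat))))
    ... | true  | _ = refl
    ... | false | sat′ = ⊥-elim (contra (trans (sym h) (refuted i i≤)))
      where
      contra : true ≡ false → ⊥
      contra ()
      Q : ℕ → Set
      Q a = (π w (idx (kH q) N a 0) ≡ false) × (π w (idx (kH q) N (suc a) 0) ≡ false)
      both : ∀ a → a < N → Q a
      both a a< with splitAtIndex cN a<
      ... | v , refl with ⋀⁼-elim Wt (neg (Hᵃ q (var (suc rN₃) #0) (var #0 #0)) ∧ᵗ neg (Hᵃ q (var (suc rN₃) #0) (var #0 #1))) ρ₀ rN₁ v sat′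
      ... | lift h₁ , lift h₂ = h₁ w (leafFor∈ u s₁∈T′) , h₂ w (leafFor∈ u s₁∈T′)
      refuted : ∀ i → i ≤ N → π w (idx (kH q) N i 0) ≡ false
      refuted zero    _  = proj₁ (both 0 N-positive)
      refuted (suc i) lt = proj₂ (both i lt)

    write-fact : ∀ q s {t i} → t < N → i < N → HoldH q t i → HoldT t i s → HoldT (suc t) i (proj₁ (proj₂ (next q s)))
    write-fact q s t< i< = atIndices (λ a b _ → HoldH q a b → HoldT a b s → HoldT (suc a) b (proj₁ (proj₂ (next q s))))
      t< i< N-positive (fact (tableau write q s))

    keepʳ-fact : ∀ q s {t i k} → t < N → i < N → k < N → HoldH q t i → HoldT t (suc (i + k)) s → HoldT (suc t) (suc (i + k)) s
    keepʳ-fact q s t< i< k< = atIndices (λ a b c → HoldH q a b → HoldT a (suc (b + c)) s → HoldT (suc a) (suc (b + c)) s)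
      t< i< k< (fact (tableau keepʳ q s))

    keepˡ-fact : ∀ q s {t i k} → t < N → i < N → k < N → HoldH q t (suc (i + k)) → HoldT t i s → HoldT (suc t) i s
    keepˡ-fact q s t< i< k< = atIndices (λ a b c → HoldH q a (suc (b + c)) → HoldT a b s → HoldT (suc a) b s)
      t< i< k< (fact (tableau keepˡ q s))

    goes₀-fact : ∀ q s {t} → t < N → HoldH q t 0 → HoldT t 0 s → HoldH (proj₁ (next q s)) (suc t) (move (proj₂ (proj₂ (next q s))) 0)
    goes₀-fact q s {t} t< h h′ = subst (λ i → HoldH (proj₁ (next q s)) (suc t) i) (from₀-move (proj₂ (proj₂ (next q s))))
      (atIndices (λ a _ _ → HoldH q a 0 → HoldT a 0 s → HoldH (proj₁ (next q s)) (suc a) (toℕ (from₀ (proj₂ (proj₂ (next q s))))))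
        t< N-positive N-positive (fact (tableau goes₀ q s)) h h′)
      where
      from₀-move : ∀ m → toℕ (from₀ m) ≡ move m 0
      from₀-move left  = refl
      from₀-move right = refl
      from₀-move stay  = refl

    goes-fact : ∀ q s {t i} → t < N → suc i < N → HoldH q t (suc i) → HoldT t (suc i) s →
                HoldH (proj₁ (next q s)) (suc t) (move (proj₂ (proj₂ (next q s))) (suc i))
    goes-fact q s {t} {i} t< i< = go (next q s) (fact (tableau goes q s))
      where
      go : ∀ o → AllInstances (moved q o s) (Forced w (moved q o s)) → HoldH q t (suc i) → HoldT t (suc i) s →
           HoldH (proj₁ o) (suc t) (move (proj₂ (proj₂ o)) (suc i))
      go (q′ , _ , left)  f = atIndices (λ a b _ → HoldH q a (suc b) → HoldT a (suc b) s → HoldH q′ (suc a) b) t< (≤-trans (n≤1+n _) i<) N-positive f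
      go (q′ , _ , stay)  f = atIndices (λ a b _ → HoldH q a b → HoldT a b s → HoldH q′ (suc a) b) t< i< N-positive f
      go (q′ , _ , right) f = atIndices (λ a b _ → HoldH q a b → HoldT a b s → HoldH q′ (suc a) (suc b)) t< i< N-positive f

    head-fact : ∀ q s {t i} → t < N → i < N → HoldH q t i → HoldT t i s →
                HoldH (proj₁ (next q s)) (suc t) (move (proj₂ (proj₂ (next q s))) i)
    head-fact q s {i = zero}  t< i< = goes₀-fact q s t<
    head-fact q s {i = suc i} t< i< = goes-fact q s t< i<

    -- The atoms of the actual configuration hold, possibly among others. The bound on the head
    -- keeps the scanned cell below `N` as long as `t < N`, where the clauses apply.
    Tracks : ℕ → Config V → Set
    Tracks t c = HoldH (state c) t (head c) × (∀ i → i < N → HoldT t i (tape c i)) × head c ≤ t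

    move-≤ : ∀ m h → move m h ≤ suc h
    move-≤ left  h = ≤-trans (m∸n≤m h 1) (n≤1+n h)
    move-≤ right h = ≤-refl
    move-≤ stay  h = n≤1+n h

    tracks-step : ∀ t c → t < N → Tracks t c → Tracks (suc t) (step V c)
    tracks-step t c t< (hh , ht , le) with Stepping.step-next V c
    ... | qe , he , te =
      subst₂ (λ q i → HoldH q (suc t) i) (sym qe) (sym he) (head-fact q s t< h< hh (ht h h<)) ,
      (λ i i< → subst (HoldT (suc t) i) (sym (te i)) (cells i i<)) ,
      ≤-trans (≤-reflexive he) (≤-trans (move-≤ (proj₂ (proj₂ (next q s))) h) (s≤s le))
      where
      q = state c
      h = head c
      s = tape c h
      h< : h < N
      h< = ≤-trans (s≤s le) t<
      cells : ∀ i → i < N → HoldT (suc t) i (if i ≡ᵇ h then proj₁ (proj₂ (next q s)) else tape c i)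
      cells i i< with i ≡ᵇ h in e
      ... | true  = subst (λ i → HoldT (suc t) i (proj₁ (proj₂ (next q s)))) (sym (≡ᵇ-sound i h e)) (write-fact q s t< h< hh (ht h h<))
      ... | false with <-cmp i h
      ... | tri≈ _ refl _ = ⊥-elim (contra (trans (sym (≡ᵇ-refl i)) e))
        where
        contra : true ≡ false → ⊥
        contra ()
      -- The distance to the head, less one, is the third counter of the keeping clauses; it is
      -- below `N` because the head is.
      ... | tri< i<h _ _ = let k , ke = m≤n⇒∃[o]m+o≡n i<h in
        keepˡ-fact q (tape c i) t< i< (≤-trans (s≤s (≤-trans (m≤n+m k (suc i)) (≤-reflexive ke))) h<)
          (subst (HoldH q t) (sym ke) hh) (ht i i<)
      ... | tri> _ _ h<i = let k , ke = m≤n⇒∃[o]m+o≡n h<i in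
        subst (λ j → HoldT t j (tape c i) → HoldT (suc t) j (tape c i)) ke
          (keepʳ-fact q (tape c i) t< h< (≤-trans (s≤s (≤-trans (m≤n+m k (suc h)) (≤-reflexive ke))) i<) hh) (ht i i<)

    tracks : ∀ y → (∀ i → i < N → HoldT 0 i (inputTape y i)) → ∀ t → t ≤ N → Tracks t (after V y t)
    tracks y h zero    le = starts-head , h , z≤n
    tracks y h (suc t) le = subst (Tracks (suc t)) (sym (run-suc V t (initial V y))) (tracks-step t (after V y t) le (tracks y h t (≤-trans (n≤1+n t) le)))

    accepts : ∀ y → TapeFrom 0 y → Accepted V (after V y N)
    accepts y h with tracks y (tape-read 0 y h) N ≤-refl
    ... | hh , _ , le = never-rejects _ _ le hh

  -- Any leaf would serve as reference, since by `constants` all leaves of this form agree on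
  -- segment 1.
  y₁ : List Bool
  y₁ = decode P 0 (AtLeaf.readItem (λ _ → itE) #1)

  y₃ : List Bool → List Bool
  y₃ y₂ = decode P 0 (AtLeaf.readItem (stream y₂) #3)

  decode-cong : ∀ k j z z′ → (∀ i → i < j + k → z i ≡ z′ i) → decode k j z ≡ decode k j z′
  decode-cong zero    j z z′ h = refl
  decode-cong (suc k) j z z′ h rewrite h j (≤-trans (s≤s (m≤m+n j k)) (≤-reflexive (sym (+-suc j k)))) with z′ j
  ... | it0 = cong (false ∷_) (decode-cong k (suc j) z z′ (λ i lt → h i (≤-trans lt (≤-reflexive (sym (+-suc j k))))))
  ... | it1 = cong (true ∷_) (decode-cong k (suc j) z z′ (λ i lt → h i (≤-trans lt (≤-reflexive (sym (+-suc j k))))))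
  ... | itE = refl

  -- The leaf reached along the entries of `y₂` spells the whole tuple: `x` and `y₂` are recovered
  -- from their streams, `y₁` agrees with the reference leaf, and `y₃ y₂` is by definition what this
  -- leaf says.
  accepts-all : ∀ y₂ → length y₂ ≤ P → Accepted V (after V (encTuple (x ∷ y₁ ∷ y₂ ∷ y₃ y₂ ∷ [])) N)
  accepts-all y₂ le = accepts (encTuple (x ∷ y₁ ∷ y₂ ∷ y₃ y₂ ∷ []))
    (subst₂ (λ a b → TapeFrom 0 (segment a (segment b (segment y₂ (segment (y₃ y₂) [])))))
      (decode-stream (length x) x ≤-refl) same₁
      (tape-segment #0 (stream x) _ input-holds (λ i →
        tape-segment #1 (readItem #1) _ (readItem-holds true) (λ i →
          subst (λ y → TapeFrom _ (segment y (segment (y₃ y₂) []))) (decode-stream P y₂ le) ∘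
          tape-segment #2 (stream y₂) _ (leafFor-reads (stream y₂)) (λ i →
            tape-segment #3 (readItem #3) _ (readItem-holds false) tape-blank P 0 i refl) P 0 _ refl)
          P 0 i refl) (length x) 0 0 refl starts))
    where
    open AtLeaf (stream y₂)
    same₁ : decode P 0 (readItem #1) ≡ y₁
    same₁ = decode-cong P 0 _ _ λ i i< → let c₀ , c₁ = constants (stream y₂) (λ _ → itE) i i< in
      cong₂ (λ b b′ → if b then it0 else if b′ then it1 else itE) c₀ c₁

-- From accepting runs to models

quotient-unique : ∀ q r m .{{_ : NonZero m}} → r < m → (q * m + r) / m ≡ q
quotient-unique q r m r< = begin
  (q * m + r) / m       ≡⟨ cong (_/ m) (+-comm (q * m) r) ⟩
  (r + q * m) / m       ≡⟨ +-distrib-/-∣ʳ r (n∣m*n q) ⟩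
  r / m + q * m / m     ≡⟨ cong₂ _+_ (m<n⇒m/n≡0 r<) (m*n/n≡m q m) ⟩
  q ∎
  where open ≡-Reasoning

remainder-unique : ∀ q r m .{{_ : NonZero m}} → r < m → (q * m + r) % m ≡ r
remainder-unique q r m r< = trans (cong (_% m) (+-comm (q * m) r)) (trans ([m+kn]%n≡m%n r q m) (m<n⇒m%n≡m r<))

Table : ℕ → Set
Table K = Fin K → ℕ → ℕ → ℕ → Bool

eval : ∀ {K d} → Table K → AtomT K d → Env d → Bool
eval β at⟨ k , t , i , j ⟩ ρ = β k (value t ρ) (value i ρ) (value j ρ)

module Decoding (B′ K′ : ℕ) where

  B K : ℕ
  B = suc B′
  K = suc K′

  positional : Weights
  positional = weights (B * (B * K)) (B * K) K

  fetch : Table K → AP → Bool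
  fetch β n = β (fromℕ< (m%n<n n K)) (n / K / B / B) (n / K / B % B) (n / K % B)

  -- In Horner form the number is `((t * B + i) * B + j) * K + k`, and `fetch` divides the digits
  -- off again. As the leading digit, `t` may be of any size.
  fetch-index : ∀ (β : Table K) k t i j → i < B → j < B →
                fetch β (t * (B * (B * K)) + (i * (B * K) + (j * K + toℕ k))) ≡ β k t i j
  fetch-index β k t i j i< j< = begin
    fetch β n ≡⟨ cong (λ l → β l (n / K / B / B) (n / K / B % B) (n / K % B)) kind≡ ⟩
    β k (n / K / B / B) (n / K / B % B) (n / K % B) ≡⟨ cong (λ m → β k (m / B / B) (m / B % B) (m % B)) n/K ⟩
    β k (((t * B + i) * B + j) / B / B) (((t * B + i) * B + j) / B % B) (((t * B + i) * B + j) % B)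
      ≡⟨ cong₂ (λ m j → β k (m / B) (m % B) j) (quotient-unique (t * B + i) j B j<) (remainder-unique (t * B + i) j B j<) ⟩
    β k ((t * B + i) / B) ((t * B + i) % B) j ≡⟨ cong₂ (λ t i → β k t i j) (quotient-unique t i B i<) (remainder-unique t i B i<) ⟩
    β k t i j ∎
    where
    open ≡-Reasoning
    n = t * (B * (B * K)) + (i * (B * K) + (j * K + toℕ k))
    e : ∀ t i j k B K → t * (B * (B * K)) + (i * (B * K) + (j * K + k)) ≡ ((t * B + i) * B + j) * K + k
    e = solve-∀
    n≡ : n ≡ ((t * B + i) * B + j) * K + toℕ k
    n≡ = e t i j (toℕ k) B K
    n/K : n / K ≡ (t * B + i) * B + j
    n/K = trans (cong (_/ K) n≡) (quotient-unique ((t * B + i) * B + j) (toℕ k) K (toℕ<n k))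
    kind≡ : fromℕ< (m%n<n n K) ≡ k
    kind≡ = toℕ-injective (trans (toℕ-fromℕ< (m%n<n n K))
      (trans (cong (_% K) n≡) (remainder-unique ((t * B + i) * B + j) (toℕ k) K (toℕ<n k))))

  module _ {M : ℕ} (B≡ : B ≡ (M + M) + 5) where

    value-< : ∀ {d} (E : Ex d) ρ → Small M ρ → value E ρ < B
    value-< E ρ sm = subst (value E ρ <_) (sym B≡) (≤-trans (s≤s (bound E)) (≤-reflexive (trans (cong suc (+-comm 4 (M + M))) (sym (+-suc (M + M) 4)))))
      where
      bound : ∀ E → value E ρ ≤ 4 + (M + M)
      bound (con c)      = ≤-trans (toℕ≤pred[n] c) (m≤m+n 4 _)
      bound (var v c)    = +-mono-≤ (toℕ≤pred[n] c) (≤-trans (sm v) (m≤m+n M M))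
      bound (var² v w c) = +-mono-≤ (toℕ≤pred[n] c) (+-mono-≤ (sm v) (sm w))

    fetch-atom : ∀ {d} β (a : AtomT K d) ρ → Small M ρ → fetch β (index positional a ρ) ≡ eval β a ρ
    fetch-atom β at⟨ k , t , i , j ⟩ ρ sm = fetch-index β k (value t ρ) (value i ρ) (value j ρ) (value-< i ρ sm) (value-< j ρ sm)

take-split : ∀ (p : List Bool) b q → take (length p) (p ++ b ∷ q) ≡ p
take-split []      b q = refl
take-split (c ∷ p) b q = cong (c ∷_) (take-split p b q)

drop-split : ∀ (p : List Bool) b q → drop (suc (length p)) (p ++ b ∷ q) ≡ q
drop-split []      b q = refl
drop-split (c ∷ p) b q = drop-split p b q

≢⇒≡ᵇ : ∀ {m n} → m ≢ n → (m ≡ᵇ n) ≡ false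
≢⇒≡ᵇ {m} {n} ne with m ≡ᵇ n in e
... | true  = ⊥-elim (ne (≡ᵇ-sound m n e))
... | false = refl

same : Bool → Bool → Bool
same true  b = b
same false b = not b

same-refl : ∀ b → same b b ≡ true
same-refl true  = refl
same-refl false = refl

same-sound : ∀ a b → same a b ≡ true → a ≡ b
same-sound true  true  e = refl
same-sound false false e = refl

-- Assignments and violated clauses

module Assignments (V : TM) where
  open Formula V
  open TM V using (nStates)
  open Clause

  Relation : Set
  Relation = ℕ → ℕ → ℕ → Bool

  -- Everything but the flags, whose values are determined by the other atoms of the same world.
  record Asg : Set where
    field
      T C Z : Relation
      H     : State → Relation

  open Asg

  assign : Asg → (Fin nFamilies → Relation) → Table K
  assign A f zero                = T A
  assign A f (suc zero)          = C A
  assign A f (suc (suc zero))    = Z A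
  assign A f (suc (suc (suc k))) = [ H A , f ]′ (splitAt (suc nStates) k)

  eval-H : ∀ A f {d} q t i (E : Env d) → eval (assign A f) (Hᵃ q t i) E ≡ H A q (value t E) (value i E) 0
  eval-H A f q t i E = cong (λ o → [ H A , f ]′ o (value t E) (value i E) 0) (splitAt-↑ˡ (suc nStates) q nFamilies)

  eval-flag : ∀ A f p E → eval (assign A f) (flag p) E ≡ f p (reg E #2) (reg E #1) (reg E #0)
  eval-flag A f p E = cong (λ o → [ H A , f ]′ o (reg E #2) (reg E #1) (reg E #0)) (splitAt-↑ʳ (suc nStates) nFamilies p)

  -- The atoms of clauses are not flags. This makes it possible to define the flags by evaluating
  -- clauses without circularity.
  record Plain (a : AtomT K 9) : Set where
    constructor isPlain
    field flag-free : ∀ A f g E → eval (assign A f) a E ≡ eval (assign A g) a E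

  plain-T : ∀ {t i j} → Plain at⟨ kT , t , i , j ⟩
  plain-T = isPlain λ A f g E → refl

  plain-C : ∀ {t i j} → Plain at⟨ kC , t , i , j ⟩
  plain-C = isPlain λ A f g E → refl

  plain-Z : ∀ {t i j} → Plain at⟨ kZ , t , i , j ⟩
  plain-Z = isPlain λ A f g E → refl

  plain-H : ∀ q {t i} → Plain at⟨ kH q , t , i , con #0 ⟩
  plain-H q {t} {i} = isPlain λ A f g E → trans (eval-H A f q t i E) (sym (eval-H A g q t i E))

  plain-written : ∀ m z r → Plain (written m z r)
  plain-written m z   fstCell  = plain-T
  plain-written m z   sndCell  = plain-T
  plain-written m it0 continue = plain-C
  plain-written m it1 continue = plain-C
  plain-written m itE continue = plain-C

  plain : ∀ φ → Plain (prem₁ (clause φ)) × Plain (prem₂ (clause φ)) × Plain (concl (clause φ))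
  plain (item m z r) = plain-C , plain-Z , plain-written m z r
  plain (stop m r)   = plain-C , plain-C , plain-written m itE r
  plain (choose c)   = plain-Z , plain-Z , plain-Z
  plain (pad true)   = plain-C , plain-C , plain-T
  plain (pad false)  = plain-C , plain-C , plain-C
  plain (tableau write q s) = plain-H q , plain-T , plain-T
  plain (tableau goes q s) with next q s
  ... | q′ , _ , left  = plain-H q , plain-T , plain-H q′
  ... | q′ , _ , stay  = plain-H q , plain-T , plain-H q′
  ... | q′ , _ , right = plain-H q , plain-T , plain-H q′
  plain (tableau goes₀ q s) = plain-H q , plain-T , plain-H (proj₁ (next q s))
  plain (tableau keepʳ q s) = plain-H q , plain-T , plain-T
  plain (tableau keepˡ q s) = plain-H q , plain-T , plain-T

  -- Violating assignments exist, so that the subformulas violated p can be satisfied.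
  Violable : Clause → Env 9 → Set
  Violable γ E = Σ Asg λ A → ∀ f → eval (assign A f) (prem₁ γ) E ≡ sign γ × eval (assign A f) (prem₂ γ) E ≡ sign γ ×
                                   eval (assign A f) (concl γ) E ≡ false

  always never : Relation
  always _ _ _ = true
  never  _ _ _ = false

  not₁ not₂ : ℕ → Relation
  not₁ n t _ _ = not (t ≡ᵇ n)
  not₂ n _ i _ = not (i ≡ᵇ n)

  noT : Asg
  noT = record { T = never ; C = always ; Z = always ; H = λ _ → always }

  -- True except in one row of cells, at one code position or in one row of heads. Where the
  -- conclusion has a later time or cell than the premises, such an exception falsifies it alone;
  -- conclusions about row 0 are falsified by `noT`.
  notAtT notAtC notAtH : ℕ → Asg
  notAtT n = record { T = not₁ n ; C = always ; Z = always ; H = λ _ → always }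
  notAtC n = record { T = always ; C = not₂ n ; Z = always ; H = λ _ → always }
  notAtH n = record { T = always ; C = always ; Z = always ; H = λ _ → not₁ n }

  other : ∀ k n → not (n ≡ᵇ suc k + n) ≡ true
  other k n = cong not (≢⇒≡ᵇ (m≢1+n+m n))

  own : ∀ n → not (n ≡ᵇ n) ≡ false
  own n = cong not (≡ᵇ-refl n)

  violable-moved : ∀ q o s E → Violable (moved q o s) E
  violable-moved q (q′ , _ , left)  s E = notAtH (suc (reg E #2)) , λ f → let A₀ = notAtH (suc (reg E #2)) in
    trans (eval-H A₀ f q (a+ #0) (b+ #1) E) (other 0 (reg E #2)) , refl , trans (eval-H A₀ f q′ (a+ #1) (b+ #0) E) (own (suc (reg E #2)))
  violable-moved q (q′ , _ , stay)  s E = notAtH (suc (reg E #2)) , λ f → let A₀ = notAtH (suc (reg E #2)) in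
    trans (eval-H A₀ f q (a+ #0) (b+ #0) E) (other 0 (reg E #2)) , refl , trans (eval-H A₀ f q′ (a+ #1) (b+ #0) E) (own (suc (reg E #2)))
  violable-moved q (q′ , _ , right) s E = notAtH (suc (reg E #2)) , λ f → let A₀ = notAtH (suc (reg E #2)) in
    trans (eval-H A₀ f q (a+ #0) (b+ #0) E) (other 0 (reg E #2)) , refl , trans (eval-H A₀ f q′ (a+ #1) (b+ #1) E) (own (suc (reg E #2)))

  violable : ∀ φ E → Violable (clause φ) E
  violable (item m z fstCell) E   = noT , λ f → refl , refl , refl
  violable (item m z sndCell) E   = noT , λ f → refl , refl , refl
  violable (item m it0 continue) E = notAtC (2 + reg E #1) , λ f → other 1 (reg E #1) , refl , own (2 + reg E #1)
  violable (item m it1 continue) E = notAtC (2 + reg E #1) , λ f → other 1 (reg E #1) , refl , own (2 + reg E #1)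
  violable (item m itE continue) E = notAtC (2 + reg E #1) , λ f → other 1 (reg E #1) , refl , own (2 + reg E #1)
  violable (stop m fstCell) E      = noT , λ f → refl , refl , refl
  violable (stop m sndCell) E      = noT , λ f → refl , refl , refl
  violable (stop m continue) E     = notAtC (2 + reg E #1) , λ f → other 1 (reg E #1) , other 1 (reg E #1) , own (2 + reg E #1)
  violable (choose c) E            = record { T = never ; C = never ; Z = never ; H = λ _ → never } , λ f → refl , refl , refl
  violable (pad true) E            = noT , λ f → refl , refl , refl
  violable (pad false) E           = notAtC (suc (reg E #1)) , λ f → other 0 (reg E #1) , other 0 (reg E #1) , own (suc (reg E #1))
  violable (tableau write q s) E   = notAtT (suc (reg E #2)) , λ f → let A₀ = notAtT (suc (reg E #2)) in eval-H A₀ f q (a+ #0) (b+ #0) E , other 0 (reg E #2) , own (suc (reg E #2))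
  violable (tableau goes q s) E    = violable-moved q (next q s) s E
  violable (tableau goes₀ q s) E   = notAtH (suc (reg E #2)) , λ f → let A₀ = notAtH (suc (reg E #2)) in
    trans (eval-H A₀ f q (a+ #0) (con #0) E) (other 0 (reg E #2)) , refl ,
    trans (eval-H A₀ f (proj₁ (next q s)) (a+ #1) (con (from₀ (proj₂ (proj₂ (next q s))))) E) (own (suc (reg E #2)))
  violable (tableau keepʳ q s) E   = notAtT (suc (reg E #2)) , λ f → let A₀ = notAtT (suc (reg E #2)) in eval-H A₀ f q (a+ #0) (b+ #0) E , other 0 (reg E #2) , own (suc (reg E #2))
  violable (tableau keepˡ q s) E   = notAtT (suc (reg E #2)) , λ f → let A₀ = notAtT (suc (reg E #2)) in eval-H A₀ f q (a+ #0) bc+ E , other 0 (reg E #2) , own (suc (reg E #2))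

-- The tree of worlds

module Completeness (V : TM) (x cN cP : List Bool) (N-positive : 0 < length cN)
  (x≤ : length x ≤ length cN) (P≤ : length cP ≤ length cN)
  (B′ : ℕ) (B≡ : suc B′ ≡ (length cN + length cN) + 5) where

  open Formula V
  open TM V using (nStates; start; accepting)
  open Clause
  open Assignments V
  open Asg
  open Plain
  open Decoding B′ (2 + (suc nStates + nFamilies)) using (positional; fetch; fetch-atom)
  open Soundness V positional x cN cP N-positive using (N; P; ρ₀; env₁; env₂; env₃; AllInstances; keepsQ)

  -- A flag is indexed by three counters, whereas its clause is evaluated in an environment of
  -- words. Cutting the registers at the counters recovers that environment.
  canonStep : ∀ {d} → Env d → Fin d → ℕ → Env (suc d)
  canonStep ρ v a = take a (Vec.lookup ρ v) ∷ ρ [ v ]≔ drop (suc a) (Vec.lookup ρ v)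

  canonStep-enter : ∀ {d} (ρ : Env d) v u → canonStep ρ v (length (pre u)) ≡ enter ρ v u
  canonStep-enter ρ v (split p b q e) rewrite e | take-split p b q | drop-split p b q = refl

  canon : Clause → ℕ → ℕ → ℕ → Env 9
  canon γ a b c = canonStep (canonStep (canonStep ρ₀ (range₁ γ) a) (suc (range₂ γ)) b) (suc (suc (range₃ γ))) c

  record Instance (γ : Clause) (E : Env 9) : Set where
    field
      small     : Small N E
      canonical : canon γ (reg E #2) (reg E #1) (reg E #0) ≡ E

  open Instance

  small-enter : ∀ {d} (ρ : Env d) v u → Small N ρ → Small N (enter ρ v u)
  small-enter ρ v (split p b q e) sm = small-∷ (≤-trans (m≤m+n (length p) _) all≤)
    (small-≔ ρ v q sm (≤-trans (n≤1+n _) (≤-trans (m≤n+m _ (length p)) all≤)))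
    where
    all≤ : length p + suc (length q) ≤ N
    all≤ = ≤-trans (≤-reflexive (trans (sym (length-++ p)) (cong length (sym e)))) (sm v)

  small₀ : Small N ρ₀
  small₀ #0 = x≤
  small₀ #1 = ≤-refl
  small₀ #2 = ≤-refl
  small₀ #3 = ≤-refl
  small₀ #4 = P≤
  small₀ #5 = P≤

  instance-of : ∀ γ → AllInstances γ (Instance γ)
  instance-of γ u v w = record
    { small = small-enter (env₂ γ u v) (suc (suc (range₃ γ))) w (small-enter (env₁ γ u) (suc (range₂ γ)) v (small-enter ρ₀ (range₁ γ) u small₀))
    ; canonical = trans
        (cong (λ E → canonStep E (suc (suc (range₃ γ))) (length (pre w)))
          (trans (cong (λ E → canonStep E (suc (range₂ γ)) (length (pre v))) (canonStep-enter ρ₀ (range₁ γ) u))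
                 (canonStep-enter (env₁ γ u) (suc (range₂ γ)) v)))
        (canonStep-enter (env₂ γ u v) (suc (suc (range₃ γ))) w)
    }

  violation : Bool → Bool → Bool → Bool → Bool
  violation s b₁ b₂ b₃ = same b₁ s ∧ (same b₂ s ∧ not b₃)

  noFlags : Fin nFamilies → Relation
  noFlags _ = always

  violates : Asg → Clause → Env 9 → Bool
  violates A γ E = violation (sign γ) (eval (assign A noFlags) (prem₁ γ) E) (eval (assign A noFlags) (prem₂ γ) E)
                                      (eval (assign A noFlags) (concl γ) E)

  flags : Asg → Fin nFamilies → Relation
  flags A p a b c = not (violates A (family p) (canon (family p) a b c))

  full : Asg → Table K
  full A = assign A (flags A)

  label : Asg → AP → Bool
  label A = fetch (full A)

  label-atom : ∀ {d} A (a : AtomT K d) E → Small N E → label A (index positional a E) ≡ eval (full A) a E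
  label-atom A a E sm = fetch-atom B≡ (full A) a E sm

  label-plain : ∀ A {a E} → Plain a → Small N E → label A (index positional a E) ≡ eval (assign A noFlags) a E
  label-plain A {a} {E} pl sm = trans (label-atom A a E sm) (flag-free pl A (flags A) noFlags E)

  label-flag′ : ∀ A p E → Instance (family p) E → label A (index positional (flag p) E) ≡ not (violates A (family p) E)
  label-flag′ A p E ins = trans (label-atom A (flag p) E (small ins)) (trans (eval-flag A (flags A) p E)
    (cong (λ E → not (violates A (family p) E)) (canonical ins)))

  label-flag : ∀ A p E → Instance (family p) E → label A (index positional (flag p) E) ≡
    not (violation (sign (family p)) (label A (index positional (prem₁ (family p)) E)) (label A (index positional (prem₂ (family p)) E))
                   (label A (index positional (concl (family p)) E)))
  label-flag A p E ins = trans (label-flag′ A p E ins) (cong not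
    (trans (cong₂ (λ b₁ b₂ → violation (sign γ) b₁ b₂ (eval (assign A noFlags) (concl γ) E))
                  (sym (label-plain A (proj₁ pl) (small ins))) (sym (label-plain A (proj₁ (proj₂ pl)) (small ins))))
           (cong (violation (sign γ) (label A (index positional (prem₁ γ) E)) (label A (index positional (prem₂ γ) E)))
                 (sym (label-plain A (proj₂ (proj₂ pl)) (small ins))))))
    where
    γ = family p
    pl = plain (lookup families p)

  Respects : Asg → Clause → Env 9 → Set
  Respects A γ E = eval (assign A noFlags) (prem₁ γ) E ≡ sign γ → eval (assign A noFlags) (prem₂ γ) E ≡ sign γ →
                   eval (assign A noFlags) (concl γ) E ≡ true

  respects⇒unviolated : ∀ s b₁ b₂ b₃ → (b₁ ≡ s → b₂ ≡ s → b₃ ≡ true) → violation s b₁ b₂ b₃ ≡ false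
  respects⇒unviolated s b₁ b₂ b₃ h with same b₁ s in e₁
  ... | false = refl
  ... | true with same b₂ s in e₂
  ... | false = refl
  ... | true rewrite h (same-sound b₁ s e₁) (same-sound b₂ s e₂) = refl

  -- What the leaves must satisfy, one assignment for each stream `σ` of universal choices. The
  -- field `guessed` says that the first word does not depend on these choices.
  record Suitable (A : (ℕ → Item) → Asg) : Set where
    field
      respects  : ∀ σ φ → AllInstances (clause φ) (Respects (A σ) (clause φ))
      starting  : ∀ σ → C (A σ) 0 0 0 ≡ true
      initially : ∀ σ → H (A σ) start 0 0 0 ≡ true
      input     : ∀ σ p b q → x ≡ p ++ b ∷ q → Z (A σ) (length p) 0 (if b then 1 else 0) ≡ true
      accepted  : ∀ σ q i → accepting q ≡ false → H (A σ) q N i 0 ≡ false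
      guessed   : ∀ σ σ′ j z → Z (A σ) j 1 z ≡ Z (A σ′) j 1 z
      branched  : ∀ σ j z → σ j ≡ z → Z (A σ) j 2 (toℕ (itemCode z)) ≡ true

  -- A world at depth `k` of the tree carries a whole stream of which only the first `k` entries are
  -- settled; an edge keeps these and may change the others. Each `extra` world is its own successor
  -- and so provides a chain of any length.
  data World : Set where
    root  : World
    main  : ℕ → (ℕ → Item) → World
    extra : Asg → World

  update : (ℕ → Item) → ℕ → Item → ℕ → Item
  update σ j z i = if i ≡ᵇ j then z else σ i

  update-same : ∀ σ j z → update σ j z j ≡ z
  update-same σ j z rewrite ≡ᵇ-refl j = refl

  update-below : ∀ σ j z i → i < j → update σ j z i ≡ σ i
  update-below σ j z i i<j rewrite ≢⇒≡ᵇ (<⇒≢ i<j) = refl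

  module Build (A : (ℕ → Item) → Asg) (suitable : Suitable A) where
    open Suitable suitable

    assignment : World → Asg
    assignment root       = noT
    assignment (main _ σ) = A σ
    assignment (extra A′) = A′

    Edge : World → World → Set
    Edge root       (main k σ)   = k ≡ 0
    Edge root       (extra A′)   = ⊤
    Edge (main k σ) (main k′ σ′) = k′ ≡ suc k × (∀ i → i < k → σ′ i ≡ σ i)
    Edge (extra A′) (extra A″)   = A′ ≡ A″
    Edge _          _            = ⊥

    frame : Frame
    frame = record { S = World ; R = Edge ; π = λ s → label (assignment s) ; inhabitant = root }

    open Teams frame

    ⋀ᶠ-intro : ∀ {n d T} (f : Fin n → FT K d) ρ → (∀ p → Sat frame T (sem positional (f p) ρ)) → Sat frame T (sem positional (⋀ᶠ f) ρ)
    ⋀ᶠ-intro {zero}  f ρ h = tautology-sat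
    ⋀ᶠ-intro {suc n} f ρ h = h zero , ⋀ᶠ-intro (λ p → f (suc p)) ρ (λ p → h (suc p))

    instances-intro : ∀ {T} γ φ → AllInstances γ (λ E → Sat frame T (sem positional φ E)) → Sat frame T (sem positional (instances γ φ) ρ₀)
    instances-intro {T} γ φ h =
      ⋀⁼-intro positional {T = T} (⋀⁼ (suc (range₂ γ)) (⋀⁼ (suc (suc (range₃ γ))) φ)) ρ₀ (range₁ γ) λ u →
      ⋀⁼-intro positional {T = T} (⋀⁼ (suc (suc (range₃ γ))) φ) (env₁ γ u) (suc (range₂ γ)) λ v →
      ⋀⁼-intro positional {T = T} φ (env₂ γ u v) (suc (suc (range₃ γ))) λ w → h u v w

    every-intro : ∀ {T} f → (∀ p E → Instance (family p) E → reg E (3 ↑ʳ rQ) ≡ P → Sat frame T (sem positional (f p) E)) →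
                  Sat frame T (sem positional (every f) ρ₀)
    every-intro f h = ⋀ᶠ-intro (λ p → instances (family p) (f p)) ρ₀ λ p → instances-intro (family p) (f p)
      λ u v w → h p _ (instance-of (family p) u v w) (keepsQ (lookup families p) u v w)

    guarded-sat : ∀ T → Sat frame T (sem positional (every guarded) ρ₀)
    guarded-sat T = every-intro {T} guarded λ p E ins _ → lift λ { s s′ _ _ (h₁ All.∷ h₂ All.∷ h₃ All.∷ All.[]) →
      trans (label-flag (assignment s) p E ins) (trans (cong not
        (trans (cong₂ (λ b₁ b₂ → violation (sign (family p)) b₁ b₂ (label (assignment s) (index positional (concl (family p)) E))) h₁ h₂)
               (cong (violation (sign (family p)) (label (assignment s′) (index positional (prem₁ (family p)) E))
                                                  (label (assignment s′) (index positional (prem₂ (family p)) E))) h₃)))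
        (sym (label-flag (assignment s′) p E ins))) }

    literal-sat : ∀ {T} s a E → (∀ w → T w → label (assignment w) (index positional a E) ≡ s) → Sat frame T (sem positional (literal s a) E)
    literal-sat true  a E h = lift h
    literal-sat false a E h = lift h

    extra-diamonds : ∀ A′ n φ → Sat frame (_≡ extra A′) φ → Sat frame (_≡ extra A′) (diamonds n φ)
    extra-diamonds A′ zero    φ sat = sat
    extra-diamonds A′ (suc n) φ sat = (_≡ extra A′) , extra-diamonds A′ n φ sat , lift λ { _ refl → extra A′ , refl , refl }

    violated-sat : Sat frame (_≡ root) (sem positional (every violated) ρ₀)
    violated-sat = every-intro {_≡ root} violated λ p E ins _ →
      let γ = family p
          A′ , h = violable (lookup families p) E
          pl₁ , pl₂ , pl₃ = plain (lookup families p)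
          l₁ = trans (label-plain A′ pl₁ (small ins)) (proj₁ (h noFlags))
          l₂ = trans (label-plain A′ pl₂ (small ins)) (proj₁ (proj₂ (h noFlags)))
          l₃ = trans (label-plain A′ pl₃ (small ins)) (proj₂ (proj₂ (h noFlags)))
          down = trans (label-flag A′ p E ins) (cong not (trans
                   (cong₂ (λ b₁ b₂ → violation (sign γ) b₁ b₂ (label A′ (index positional (concl γ) E))) l₁ l₂)
                   (trans (cong (violation (sign γ) (sign γ) (sign γ)) l₃) (all-violated (sign γ)))))
      in (_≡ extra A′) ,
         extra-diamonds A′ (reg E (3 ↑ʳ rQ)) _
           (literal-sat (sign γ) (prem₁ γ) E (λ { _ refl → l₁ }) , literal-sat (sign γ) (prem₂ γ) E (λ { _ refl → l₂ }) ,
            lift (λ { _ refl → l₃ }) , lift (λ { _ refl → down })) ,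
         lift λ { _ refl → extra A′ , refl , tt }
      where
      all-violated : ∀ s → violation s s s false ≡ true
      all-violated true  = refl
      all-violated false = refl

    Level : ℕ → ((ℕ → Item) → Set) → World → Set
    Level k Q s = Σ (ℕ → Item) λ σ → s ≡ main k σ × Q σ

    -- `Q` depends only on the first `k` entries. From level `k` on these are settled, so `Q` is
    -- inherited by all deeper levels.
    Stable : ℕ → ((ℕ → Item) → Set) → Set
    Stable k Q = ∀ {k′ σ σ′} → k ≤ k′ → (∀ i → i < k′ → σ′ i ≡ σ i) → Q σ → Q σ′

    levels : ∀ n {k₀ k Q T} → Stable k₀ Q → k₀ ≤ k → (∀ s → T s → Level k Q s) → ∀ s → descendants n T s → Level (n + k) Q s
    levels zero    st k₀≤ h = h
    levels (suc n) {k₀} {k} {Q} {T} st k₀≤ h s d =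
      subst (λ k → Level k Q s) (+-suc n k) (levels n st (≤-trans k₀≤ (n≤1+n k)) below s d)
      where
      below : ∀ s → image T s → Level (suc k) Q s
      below s (s′ , t , r) with h s′ t
      below (main k″ σ′) (_ , t , refl , agree) | σ , refl , q = σ′ , refl , st k₀≤ agree q

    σ₀ : ℕ → Item
    σ₀ _ = itE

    T₀ : Team frame
    T₀ = _≡ main 0 σ₀

    Anything : (ℕ → Item) → Set
    Anything _ = ⊤

    below-root : ∀ n s → descendants n T₀ s → Level n Anything s
    below-root n s d = subst (λ k → Level k Anything s) (+-identityʳ n)
      (levels n {0} {0} {Anything} {T₀} (λ _ _ _ → tt) z≤n (λ { _ refl → σ₀ , refl , tt }) s d)

    branch-sat : ∀ u z →
                 Sat frame (descendants (length (pre u)) T₀) (sem positional (branch z) (enter ρ₀ rP u))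
    branch-sat u z = T′ , boxes-intro (length (post u)) (lift λ s d → read s (levels (length (post u)) {suc j} {suc j} {λ σ → σ j ≡ z} {T′}
        (λ k≤ agree e → trans (agree j k≤) e) ≤-refl (λ s t → t) s d)) , lift successor
      where
      j = length (pre u)
      T′ : Team frame
      T′ = Level (suc j) (λ σ → σ j ≡ z)
      read : ∀ {k} s → Level k (λ σ → σ j ≡ z) s → label (assignment s) (index positional (Zᵃ {7} (var #0 #0) #2 z) (enter ρ₀ rP u)) ≡ true
      read s (σ , refl , e′) = trans (label-plain₇ (A σ)) (branched σ j z e′)
        where
        label-plain₇ : ∀ A′ → label A′ (index positional (Zᵃ {7} (var #0 #0) #2 z) (enter ρ₀ rP u)) ≡ Z A′ j 2 (toℕ (itemCode z))
        label-plain₇ A′ = label-atom A′ (Zᵃ (var #0 #0) #2 z) (enter ρ₀ rP u) (small-enter ρ₀ rP u small₀)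
      successor : ∀ s → descendants j T₀ s → Σ World λ s′ → T′ s′ × Edge s s′
      successor s d with below-root j s d
      ... | σ , refl , _ = main (suc j) (update σ j z) , (update σ j z , refl , update-same σ j z) , refl , update-below σ j z

    branching-sat : Sat frame T₀ (sem positional branching ρ₀)
    branching-sat = ⋀⁼-intro positional {T = T₀} branchingStep ρ₀ rP λ u →
      boxes-intro (length (pre u)) (branch-sat u it0 , branch-sat u it1 , branch-sat u itE)

    constant-sat : Sat frame T₀ (sem positional constant ρ₀)
    constant-sat = ⋀⁼-intro positional {T = T₀} constantStep ρ₀ rP λ u →
      boxes-intro P (lift (λ s s′ d d′ _ → equal u it0 s s′ d d′) , lift (λ s s′ d d′ _ → equal u it1 s s′ d d′))
      where
      equal : ∀ u z s s′ → descendants P T₀ s → descendants P T₀ s′ →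
              label (assignment s) (index positional (Zᵃ {7} (var #0 #0) #1 z) (enter ρ₀ rP u)) ≡
              label (assignment s′) (index positional (Zᵃ {7} (var #0 #0) #1 z) (enter ρ₀ rP u))
      equal u z s s′ d d′ with below-root P s d | below-root P s′ d′
      ... | σ , refl , _ | σ′ , refl , _ = trans (at-label (A σ)) (trans (guessed σ σ′ (length (pre u)) (toℕ (itemCode z))) (sym (at-label (A σ′))))
        where
        at-label : ∀ A′ → label A′ (index positional (Zᵃ {7} (var #0 #0) #1 z) (enter ρ₀ rP u)) ≡ Z A′ (length (pre u)) 1 (toℕ (itemCode z))
        at-label A′ = label-atom A′ (Zᵃ (var #0 #0) #1 z) (enter ρ₀ rP u) (small-enter ρ₀ rP u small₀)

    Leaves : Team frame
    Leaves = descendants P T₀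

    at-leaf : ∀ (C : World → Set) → (∀ σ → C (main P σ)) → ∀ s → Leaves s → C s
    at-leaf C h s d with below-root P s d
    ... | σ , refl , _ = h σ

    input-sat : Sat frame Leaves (sem positional (⋀ rX (pos (Zᵃ (var #0 #0) #0 it0)) (pos (Zᵃ (var #0 #0) #0 it1))) ρ₀)
    input-sat = ⋀-intro positional {T = Leaves} (pos (Zᵃ (var #0 #0) #0 it0)) (pos (Zᵃ (var #0 #0) #0 it1)) ρ₀ rX
      λ { u@(split p false q e) → holds u it0 (λ σ → input σ p false q e) ; u@(split p true q e) → holds u it1 (λ σ → input σ p true q e) }
      where
      holds : ∀ u z → (∀ σ → Z (A σ) (length (pre u)) 0 (toℕ (itemCode z)) ≡ true) →
              Sat frame Leaves (sem positional (pos (Zᵃ (var #0 #0) #0 z)) (enter ρ₀ rX u))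
      holds u z h = lift (at-leaf (λ s → label (assignment s) (index positional (Zᵃ {7} (var #0 #0) #0 z) (enter ρ₀ rX u)) ≡ true) λ σ →
        trans (label-atom (A σ) (Zᵃ (var #0 #0) #0 z) (enter ρ₀ rX u) (small-enter ρ₀ rX u small₀)) (h σ))

    rejects-sat : ∀ q → Sat frame Leaves (sem positional (rejects q) ρ₀)
    rejects-sat q with accepting q in e
    ... | true  = tautology-sat
    ... | false = ⋀⁼-intro positional {T = Leaves} (neg (Hᵃ q (var (suc rN₃) #0) (var #0 #0)) ∧ᵗ neg (Hᵃ q (var (suc rN₃) #0) (var #0 #1))) ρ₀ rN₁
      λ u → fails u #0 , fails u #1
      where
      fails : ∀ u c → Sat frame Leaves (sem positional (neg (Hᵃ {7} q (var (suc rN₃) #0) (var #0 c))) (enter ρ₀ rN₁ u))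
      fails u c = lift (at-leaf (λ s → label (assignment s) (index positional (Hᵃ {7} q (var (suc rN₃) #0) (var #0 c)) (enter ρ₀ rN₁ u)) ≡ false) λ σ →
        trans (label-atom (A σ) (Hᵃ q (var (suc rN₃) #0) (var #0 c)) (enter ρ₀ rN₁ u) (small-enter ρ₀ rN₁ u small₀))
              (trans (eval-H (A σ) (flags (A σ)) q (var (suc rN₃) #0) (var #0 c) (enter ρ₀ rN₁ u)) (accepted σ q (toℕ c + length (pre u)) e)))

    flagged-sat : Sat frame Leaves (sem positional (every flagged) ρ₀)
    flagged-sat = ⋀ᶠ-intro (λ p → instances (family p) (flagged p)) ρ₀ λ f → instances-intro {Leaves} (family f) (flagged f)
      λ u v w →
        let E = env₃ (family f) u v w
            γ = family f in
        lift (at-leaf (λ s → label (assignment s) (index positional (flag f) E) ≡ true) λ σ →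
          trans (label-flag′ (A σ) f E (instance-of γ u v w)) (cong not
            (respects⇒unviolated (sign γ) (eval (assign (A σ) noFlags) (prem₁ γ) E) (eval (assign (A σ) noFlags) (prem₂ γ) E)
              (eval (assign (A σ) noFlags) (concl γ) E) (respects σ (lookup families f) u v w))))

    leaf-sat : Sat frame Leaves (sem positional leaf ρ₀)
    leaf-sat =
      lift (at-leaf (λ s → label (assignment s) (index positional (Cᵃ {6} (con #0) (con #0) #0) ρ₀) ≡ true) λ σ →
        trans (label-atom (A σ) (Cᵃ (con #0) (con #0) #0) ρ₀ small₀) (starting σ)) ,
      lift (at-leaf (λ s → label (assignment s) (index positional (Hᵃ {6} start (con #0) (con #0)) ρ₀) ≡ true) λ σ →
        trans (label-atom (A σ) (Hᵃ start (con #0) (con #0)) ρ₀ small₀)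
              (trans (eval-H (A σ) (flags (A σ)) start (con #0) (con #0) ρ₀) (initially σ))) ,
      input-sat , ⋀ᶠ-intro rejects ρ₀ rejects-sat , flagged-sat

    formula-sat : Sat frame (_≡ root) (sem positional formula ρ₀)
    formula-sat =
      (T₀ , (branching-sat , constant-sat , boxes-intro P leaf-sat) , lift λ { _ refl → main 0 σ₀ , refl , refl }) ,
      violated-sat , boxes-intro P (guarded-sat (descendants P (image (_≡ root))))

-- The assignment given by the actual run

eqL : List Bool → List Bool → Bool
eqL []      []      = true
eqL (a ∷ u) (b ∷ v) = same a b ∧ eqL u v
eqL _       _       = false

eqL-refl : ∀ u → eqL u u ≡ true
eqL-refl []      = refl
eqL-refl (a ∷ u) rewrite same-refl a = eqL-refl u

∧-elim : ∀ a {b} → a ∧ b ≡ true → a ≡ true × b ≡ true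
∧-elim true e = refl , e

eqL-sound : ∀ u v → eqL u v ≡ true → u ≡ v
eqL-sound []      []      e = refl
eqL-sound (a ∷ u) (b ∷ v) e = let e₁ , e₂ = ∧-elim (same a b) e in cong₂ _∷_ (same-sound a b e₁) (eqL-sound u v e₂)

drop-head : ∀ i ℓ {a r} → drop i ℓ ≡ a ∷ r → inputTape ℓ i ≡ toSym a × drop (suc i) ℓ ≡ r
drop-head zero    (b ∷ ℓ) refl = refl , refl
drop-head (suc i) (b ∷ ℓ) e    = drop-head i ℓ e

drop-end : ∀ i ℓ → drop i ℓ ≡ [] → inputTape ℓ i ≡ blank × drop (suc i) ℓ ≡ []
drop-end zero    []      e = refl , refl
drop-end (suc i) []      e = refl , refl
drop-end (suc i) (b ∷ ℓ) e = drop-end i ℓ e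

itemBits : Item → Bool × Bool
itemBits it0 = false , false
itemBits it1 = true , true
itemBits itE = false , true

toSym-itemBits : ∀ z → (toSym (proj₁ (itemBits z)) , toSym (proj₂ (itemBits z))) ≡ itemSyms z
toSym-itemBits it0 = refl
toSym-itemBits it1 = refl
toSym-itemBits itE = refl

itemCode-injective : ∀ z z′ → toℕ (itemCode z) ≡ toℕ (itemCode z′) → z ≡ z′
itemCode-injective it0 it0 e = refl
itemCode-injective it1 it1 e = refl
itemCode-injective itE itE e = refl

cell-injective : ∀ s s′ → toℕ (cell s) ≡ toℕ (cell s′) → s ≡ s′
cell-injective blank blank e = refl
cell-injective b0    b0    e = refl
cell-injective b1    b1    e = refl

module Intended (V : TM) (x cN cP : List Bool) (N-positive : 0 < length cN)
  (x≤ : length x ≤ length cN) (P≤ : length cP ≤ length cN)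
  (B′ : ℕ) (B≡ : suc B′ ≡ (length cN + length cN) + 5)
  (y₁ : List Bool) (y₃ : List Bool → List Bool) where

  open Formula V
  open TM V using (nStates; start; accepting)
  open Clause
  open Assignments V
  open Completeness V x cN cP N-positive x≤ P≤ B′ B≡ using (noFlags; Respects; Suitable)
  open Decoding B′ (2 + (suc nStates + nFamilies)) using (positional)
  open Soundness V positional x cN cP N-positive using (N; P; ρ₀; env₃; AllInstances)
  open Config

  segLength : Fin 4 → ℕ
  segLength m = reg ρ₀ (segRange m)

  module Row (σ : ℕ → Item) where

    items : ℕ → ℕ → Item
    items 0 = stream x
    items 1 = stream y₁
    items 2 = σ
    items _ = stream (y₃ (decode P 0 σ))

    suffix₃ suffix₂ suffix₁ : ℕ → List Bool
    suffix₃ j = segment (decode (P ∸ j) j (items 3)) []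
    suffix₂ j = segment (decode (P ∸ j) j (items 2)) (suffix₃ 0)
    suffix₁ j = segment (decode (P ∸ j) j (items 1)) (suffix₂ 0)

    -- What remains of the input from entry j of segment m on.
    suffix : ℕ → ℕ → List Bool
    suffix 0 j = segment (decode (length x ∸ j) j (items 0)) (suffix₁ 0)
    suffix 1 j = suffix₁ j
    suffix 2 j = suffix₂ j
    suffix 3 j = suffix₃ j
    suffix _ j = []

    text : List Bool
    text = suffix 0 0

    conf : ℕ → Config V
    conf = after V text

    assignment : Asg
    assignment = record
      { T = λ t i s → toℕ (cell (tape (conf t) i)) ≡ᵇ s
      -- Remaining words are compared instead of positions. The clauses only strip two bits at a
      -- time, and this relation is closed under that without any computation of offsets.
      ; C = λ j i m → eqL (drop i text) (suffix m j)
      ; Z = λ j m z → toℕ (itemCode (items m j)) ≡ᵇ z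
      ; H = λ q t i _ → (toℕ (state (conf t)) ≡ᵇ toℕ q) ∧ (head (conf t) ≡ᵇ i)
      }

    open Asg assignment

    T-intro : ∀ t i {s} → tape (conf t) i ≡ s → T t i (toℕ (cell s)) ≡ true
    T-intro t i refl = ≡ᵇ-refl (toℕ (cell (tape (conf t) i)))

    T-elim : ∀ t i s → T t i (toℕ (cell s)) ≡ true → tape (conf t) i ≡ s
    T-elim t i s e = cell-injective _ s (≡ᵇ-sound _ _ e)

    C-intro : ∀ j i m → drop i text ≡ suffix m j → C j i m ≡ true
    C-intro j i m e rewrite e = eqL-refl (suffix m j)

    C-elim : ∀ j i m → C j i m ≡ true → drop i text ≡ suffix m j
    C-elim j i m = eqL-sound (drop i text) (suffix m j)

    Z-elim : ∀ j m z → Z j m (toℕ (itemCode z)) ≡ true → items m j ≡ z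
    Z-elim j m z e = itemCode-injective (items m j) z (≡ᵇ-sound _ _ e)

    H-intro : ∀ q t i → state (conf t) ≡ q → head (conf t) ≡ i → H q t i 0 ≡ true
    H-intro q t i refl refl rewrite ≡ᵇ-refl (toℕ (state (conf t))) = ≡ᵇ-refl (head (conf t))

    H-elim : ∀ q t i → H q t i 0 ≡ true → state (conf t) ≡ q × head (conf t) ≡ i
    H-elim q t i e = let e₁ , e₂ = ∧-elim (toℕ (state (conf t)) ≡ᵇ toℕ q) e in toℕ-injective (≡ᵇ-sound _ _ e₁) , ≡ᵇ-sound _ _ e₂

    eval-H-elim : ∀ q (t i : Ex 9) E → eval (assign assignment noFlags) (Hᵃ q t i) E ≡ true →
                  state (conf (value t E)) ≡ q × head (conf (value t E)) ≡ value i E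
    eval-H-elim q t i E e = H-elim q (value t E) (value i E) (trans (sym (eval-H assignment noFlags q t i E)) e)

    eval-H-intro : ∀ q (t i : Ex 9) E → state (conf (value t E)) ≡ q → head (conf (value t E)) ≡ value i E →
                   eval (assign assignment noFlags) (Hᵃ q t i) E ≡ true
    eval-H-intro q t i E e e′ = trans (eval-H assignment noFlags q t i E) (H-intro q (value t E) (value i E) e e′)

    suffix-segment : ∀ m j → suffix (toℕ (Fin.inject₁ m)) j ≡
      segment (decode (segLength m ∸ j) j (items (toℕ (Fin.inject₁ m)))) (suffix (suc (toℕ m)) 0)
    suffix-segment zero j                   = refl
    suffix-segment (suc zero) j             = refl
    suffix-segment (suc (suc zero)) j       = refl
    suffix-segment (suc (suc (suc zero))) j = refl

    following : Fin 4 → Item → ℕ → List Bool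
    following m itE j = suffix (suc (toℕ m)) 0
    following m z   j = suffix (toℕ (Fin.inject₁ m)) (suc j)

    suffix-item : ∀ m z j → j < segLength m → items (toℕ (Fin.inject₁ m)) j ≡ z →
                  suffix (toℕ (Fin.inject₁ m)) j ≡ proj₁ (itemBits z) ∷ proj₂ (itemBits z) ∷ following m z j
    suffix-item m z j j< e = trans (suffix-segment m j)
      (trans (cong (λ k → segment (decode k j (items (toℕ (Fin.inject₁ m)))) (suffix (suc (toℕ m)) 0)) (room j<))
        (trans (cong (λ v → segment (decodeItem (segLength m ∸ suc j) j (items (toℕ (Fin.inject₁ m))) v) (suffix (suc (toℕ m)) 0)) e) (go z)))
      where
      go : ∀ z → segment (decodeItem (segLength m ∸ suc j) j (items (toℕ (Fin.inject₁ m))) z) (suffix (suc (toℕ m)) 0)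
                 ≡ proj₁ (itemBits z) ∷ proj₂ (itemBits z) ∷ following m z j
      go it0 = cong (λ l → false ∷ false ∷ l) (sym (suffix-segment m (suc j)))
      go it1 = cong (λ l → true ∷ true ∷ l) (sym (suffix-segment m (suc j)))
      go itE = refl

    suffix-stop : ∀ m → suffix (toℕ (Fin.inject₁ m)) (segLength m) ≡ false ∷ true ∷ suffix (suc (toℕ m)) 0
    suffix-stop m = trans (suffix-segment m (segLength m))
      (cong (λ k → segment (decode k (segLength m) (items (toℕ (Fin.inject₁ m)))) (suffix (suc (toℕ m)) 0)) (n∸n≡0 (segLength m)))

    written-holds : ∀ m z r j i → drop i text ≡ proj₁ (itemBits z) ∷ proj₂ (itemBits z) ∷ following m z j → ∀ E →
                    j ≡ reg E #2 → i ≡ reg E #1 → eval (assign assignment noFlags) (written m z r) E ≡ true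
    written-holds m z fstCell j i e E refl refl =
      T-intro 0 i (trans (proj₁ (drop-head i text e)) (cong proj₁ (toSym-itemBits z)))
    written-holds m z sndCell j i e E refl refl =
      T-intro 0 (suc i) (trans (proj₁ (drop-head (suc i) text (proj₂ (drop-head i text e)))) (cong proj₂ (toSym-itemBits z)))
    written-holds m it0 continue j i e E refl refl = C-intro (suc j) (2 + i) (toℕ (Fin.inject₁ m)) (proj₂ (drop-head (suc i) text (proj₂ (drop-head i text e))))
    written-holds m it1 continue j i e E refl refl = C-intro (suc j) (2 + i) (toℕ (Fin.inject₁ m)) (proj₂ (drop-head (suc i) text (proj₂ (drop-head i text e))))
    written-holds m itE continue j i e E refl refl = C-intro 0 (2 + i) (suc (toℕ m)) (proj₂ (drop-head (suc i) text (proj₂ (drop-head i text e))))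

    conf-next : ∀ t q s → state (conf t) ≡ q → tape (conf t) (head (conf t)) ≡ s →
      state (conf (suc t)) ≡ proj₁ (next q s) × head (conf (suc t)) ≡ move (proj₂ (proj₂ (next q s))) (head (conf t)) ×
      (∀ i → tape (conf (suc t)) i ≡ (if i ≡ᵇ head (conf t) then proj₁ (proj₂ (next q s)) else tape (conf t) i))
    conf-next t q s refl refl rewrite run-suc V t (initial V text) = Stepping.step-next V (conf t)

    respects-moved : ∀ q o s → next q s ≡ o → ∀ E →
      eval (assign assignment noFlags) (prem₁ (moved q o s)) E ≡ true → eval (assign assignment noFlags) (prem₂ (moved q o s)) E ≡ true →
      eval (assign assignment noFlags) (concl (moved q o s)) E ≡ true
    respects-moved q (q′ , s′ , left) s e E h₁ h₂ with eval-H-elim q (a+ #0) (b+ #1) E h₁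
    ... | st≡ , hd≡ with conf-next (reg E #2) q s st≡ (trans (cong (tape (conf (reg E #2))) hd≡) (T-elim (reg E #2) (suc (reg E #1)) s h₂))
    ... | se , he , _ = eval-H-intro q′ (a+ #1) (b+ #0) E (trans se (cong proj₁ e)) (trans he (cong₂ (λ o h → move (proj₂ (proj₂ o)) h) e hd≡))
    respects-moved q (q′ , s′ , stay) s e E h₁ h₂ with eval-H-elim q (a+ #0) (b+ #0) E h₁
    ... | st≡ , hd≡ with conf-next (reg E #2) q s st≡ (trans (cong (tape (conf (reg E #2))) hd≡) (T-elim (reg E #2) (reg E #1) s h₂))
    ... | se , he , _ = eval-H-intro q′ (a+ #1) (b+ #0) E (trans se (cong proj₁ e)) (trans he (cong₂ (λ o h → move (proj₂ (proj₂ o)) h) e hd≡))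
    respects-moved q (q′ , s′ , right) s e E h₁ h₂ with eval-H-elim q (a+ #0) (b+ #0) E h₁
    ... | st≡ , hd≡ with conf-next (reg E #2) q s st≡ (trans (cong (tape (conf (reg E #2))) hd≡) (T-elim (reg E #2) (reg E #1) s h₂))
    ... | se , he , _ = eval-H-intro q′ (a+ #1) (b+ #1) E (trans se (cong proj₁ e)) (trans he (cong₂ (λ o h → move (proj₂ (proj₂ o)) h) e hd≡))

    move-from₀ : ∀ m → move m 0 ≡ toℕ (from₀ m)
    move-from₀ left  = refl
    move-from₀ right = refl
    move-from₀ stay  = refl

    respects : ∀ φ → AllInstances (clause φ) (Respects assignment (clause φ))
    respects (item m z r) u v w h₁ h₂ =
      written-holds m z r (length (pre u)) (length (pre v))
        (trans (C-elim (length (pre u)) (length (pre v)) (toℕ (Fin.inject₁ m)) h₁)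
               (suffix-item m z (length (pre u)) j< (Z-elim (length (pre u)) (toℕ (Fin.inject₁ m)) z h₂))) (env₃ (clause (item m z r)) u v w) refl refl
      where
      j< : length (pre u) < segLength m
      j< = ≤-trans (≤-trans (m≤m+n (suc (length (pre u))) (length (post u))) (≤-reflexive (sym (+-suc (length (pre u)) (length (post u))))))
                   (≤-reflexive (trans (sym (length-++ (pre u))) (cong length (sym (whole u)))))
    respects (stop zero r) u v w h₁ h₂ =
      written-holds zero itE r (length (pre u)) (length (pre v)) (trans (C-elim (length x) (length (pre v)) 0 h₁) (suffix-stop zero)) (env₃ (clause (stop zero r)) u v w) refl refl
    respects (stop (suc m) r) u v w h₁ h₂ =
      written-holds (suc m) itE r (length (pre u)) (length (pre v))
        (trans (C-elim P (length (pre v)) (suc (toℕ (Fin.inject₁ m))) h₁) (suffix-stop (suc m))) (env₃ (clause (stop (suc m) r)) u v w) refl refl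
    respects (choose c) u v w = remaining (items (toℕ (chosen c)) (length (pre u)))
      where
      remaining : ∀ z → (toℕ (itemCode z) ≡ᵇ 0) ≡ false → (toℕ (itemCode z) ≡ᵇ 1) ≡ false → (toℕ (itemCode z) ≡ᵇ 2) ≡ true
      remaining itE _ _ = refl
    respects (pad true) u v w h₁ _ =
      T-intro 0 (length (pre v)) (proj₁ (drop-end (length (pre v)) text (C-elim 0 (length (pre v)) 4 h₁)))
    respects (pad false) u v w h₁ _ =
      C-intro 0 (suc (length (pre v))) 4 (proj₂ (drop-end (length (pre v)) text (C-elim 0 (length (pre v)) 4 h₁)))
    respects (tableau write q s) u v w h₁ h₂ with eval-H-elim q (a+ #0) (b+ #0) (env₃ (clause (tableau write q s)) u v w) h₁
    ... | st≡ , hd≡ with conf-next (length (pre u)) q s st≡ (trans (cong (tape (conf (length (pre u)))) hd≡) (T-elim (length (pre u)) (length (pre v)) s h₂))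
    ... | _ , _ , te = T-intro (suc (length (pre u))) (length (pre v)) (trans (te (length (pre v)))
      (cong (λ b → if b then proj₁ (proj₂ (next q s)) else tape (conf (length (pre u))) (length (pre v)))
            (trans (cong (length (pre v) ≡ᵇ_) hd≡) (≡ᵇ-refl (length (pre v))))))
    respects (tableau goes q s) = go (next q s) refl
      where
      go : ∀ o → next q s ≡ o → AllInstances (moved q o s) (Respects assignment (moved q o s))
      go o@(_ , _ , left)  e u v w = respects-moved q o s e (env₃ (moved q o s) u v w)
      go o@(_ , _ , stay)  e u v w = respects-moved q o s e (env₃ (moved q o s) u v w)
      go o@(_ , _ , right) e u v w = respects-moved q o s e (env₃ (moved q o s) u v w)
    respects (tableau goes₀ q s) u v w h₁ h₂ with eval-H-elim q (a+ #0) (con #0) (env₃ (clause (tableau goes₀ q s)) u v w) h₁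
    ... | st≡ , hd≡ with conf-next (length (pre u)) q s st≡ (trans (cong (tape (conf (length (pre u)))) hd≡) (T-elim (length (pre u)) 0 s h₂))
    ... | se , he , _ = eval-H-intro (proj₁ (next q s)) (a+ #1) (con (from₀ (proj₂ (proj₂ (next q s))))) (env₃ (clause (tableau goes₀ q s)) u v w) se
      (trans he (trans (cong (move (proj₂ (proj₂ (next q s)))) hd≡) (move-from₀ (proj₂ (proj₂ (next q s))))))
    respects (tableau keepʳ q s) u v w h₁ h₂ with eval-H-elim q (a+ #0) (b+ #0) (env₃ (clause (tableau keepʳ q s)) u v w) h₁
    ... | st≡ , hd≡ with conf-next (length (pre u)) q (tape (conf (length (pre u))) (head (conf (length (pre u))))) st≡ refl
    ... | _ , _ , te = T-intro (suc (length (pre u))) i (trans (te i) (trans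
      (cong (λ b → if b then proj₁ (proj₂ (next q (tape (conf (length (pre u))) (head (conf (length (pre u))))))) else tape (conf (length (pre u))) i)
            (trans (cong (i ≡ᵇ_) hd≡) (≢⇒≡ᵇ (λ e → m≢1+m+n (length (pre v)) {length (pre w)} (sym e)))))
      (T-elim (length (pre u)) i s h₂)))
      where i = suc (length (pre v) + length (pre w))
    respects (tableau keepˡ q s) u v w h₁ h₂ with eval-H-elim q (a+ #0) bc+ (env₃ (clause (tableau keepˡ q s)) u v w) h₁
    ... | st≡ , hd≡ with conf-next (length (pre u)) q (tape (conf (length (pre u))) (head (conf (length (pre u))))) st≡ refl
    ... | _ , _ , te = T-intro (suc (length (pre u))) i (trans (te i) (trans
      (cong (λ b → if b then proj₁ (proj₂ (next q (tape (conf (length (pre u))) (head (conf (length (pre u))))))) else tape (conf (length (pre u))) i)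
            (trans (cong (i ≡ᵇ_) hd≡) (≢⇒≡ᵇ (m≢1+m+n (length (pre v)) {length (pre w)}))))
      (T-elim (length (pre u)) i s h₂)))
      where i = length (pre v)

    starting : C 0 0 0 ≡ true
    starting = eqL-refl text

    initially : H start 0 0 0 ≡ true
    initially = H-intro start 0 0 refl refl

    input : ∀ p b q → x ≡ p ++ b ∷ q → Z (length p) 0 (if b then 1 else 0) ≡ true
    input p b q e = trans (cong (λ z → toℕ (itemCode z) ≡ᵇ (if b then 1 else 0))
                             (trans (cong (λ x → stream x (length p)) e) (stream-at p b q))) (code b)
      where
      code : ∀ b → (toℕ (itemCode (if b then it1 else it0)) ≡ᵇ (if b then 1 else 0)) ≡ true
      code true  = refl
      code false = refl

    accepted : Accepted V (conf N) → ∀ q i → accepting q ≡ false → H q N i 0 ≡ false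
    accepted acc q i e with toℕ (state (conf N)) ≡ᵇ toℕ q in eq
    ... | false = refl
    ... | true  = ⊥-elim (contra (trans (sym acc) (trans (cong accepting (toℕ-injective (≡ᵇ-sound _ _ eq))) e)))
      where
      contra : true ≡ false → ⊥
      contra ()

    branched : ∀ j z → σ j ≡ z → Z j 2 (toℕ (itemCode z)) ≡ true
    branched j z refl = ≡ᵇ-refl (toℕ (itemCode (σ j)))

  suitable : (∀ σ → Accepted V (after V (Row.text σ) N)) → Suitable Row.assignment
  suitable acc = record
    { respects  = Row.respects
    ; starting  = Row.starting
    ; initially = Row.initially
    ; input     = Row.input
    ; accepted  = λ σ → Row.accepted σ (acc σ)
    ; guessed   = λ σ σ′ j z → refl
    ; branched  = Row.branched
    }

-- The reduction

length-double : ∀ y → length (double y) ≡ 2 * length y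
length-double []      = refl
length-double (b ∷ y) = trans (cong (2 +_) (length-double y)) (sym (*-suc 2 (length y)))

length-segment : ∀ y rest → length (segment y rest) ≡ 2 * length y + (2 + length rest)
length-segment y rest = trans (length-++ (double y ++ false ∷ true ∷ []))
  (trans (cong (_+ length rest) (trans (length-++ (double y)) (cong (_+ 2) (length-double y)))) (+-assoc (2 * length y) 2 (length rest)))

tuple : List Bool → List Bool → List Bool → List Bool → List Bool
tuple x y₁ y₂ y₃ = encTuple (x ∷ y₁ ∷ y₂ ∷ y₃ ∷ [])

tupleBound : ℕ → ℕ → ℕ
tupleBound n p = 2 * n + (2 + (2 * p + (2 + (2 * p + (2 + (2 * p + (2 + 0)))))))

length-tuple : ∀ x y₁ y₂ y₃ {p} → length y₁ ≤ p → length y₂ ≤ p → length y₃ ≤ p → length (tuple x y₁ y₂ y₃) ≤ tupleBound (length x) p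
length-tuple x y₁ y₂ y₃ le₁ le₂ le₃ = ≤-trans (≤-reflexive (trans (length-segment x _) (cong (λ l → 2 * length x + (2 + l))
    (trans (length-segment y₁ _) (cong (λ l → 2 * length y₁ + (2 + l)) (trans (length-segment y₂ _) (cong (λ l → 2 * length y₂ + (2 + l)) (length-segment y₃ []))))))))
  (+-monoʳ-≤ (2 * length x) (+-monoʳ-≤ 2 (+-mono-≤ (*-monoʳ-≤ 2 le₁) (+-monoʳ-≤ 2 (+-mono-≤ (*-monoʳ-≤ 2 le₂) (+-monoʳ-≤ 2 (+-monoˡ-≤ 2 (*-monoʳ-≤ 2 le₃))))))))

poly-mono : ∀ d {m n} → m ≤ n → poly d m ≤ poly d n
poly-mono d le = +-monoˡ-≤ d (*-monoʳ-≤ d (^-monoˡ-≤ d le))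

module Reduction (V : TM) (d c : ℕ) (halts : PolyTimeMachine V d) where
  open Formula V

  -- `N` has to be positive and to bound the input, the guessed words and the running time of the
  -- verifier on the longest possible tuple.
  needed : ℕ → ℕ
  needed n = suc (n + (poly c n + poly d (tupleBound n (poly c n))))

  polyB-needed : PolyBounded needed
  polyB-needed = polyB-+ (polyB-const 1) (polyB-+ polyB-id (polyB-+ (polyB-poly c) (polyB-∘ (polyB-poly d)
    (polyB-+ (polyB-* (polyB-const 2) polyB-id) (polyB-+ (polyB-const 2) (polyB-+ twice (polyB-+ (polyB-const 2)
      (polyB-+ twice (polyB-+ (polyB-const 2) (polyB-+ twice (polyB-+ (polyB-const 2) (polyB-const 0))))))))))))
    where
    twice : PolyBounded (λ n → 2 * poly c n)
    twice = polyB-* (polyB-const 2) (polyB-poly c)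

  -- Abstract, because unfolding this closed expression would be infeasible.
  abstract

    exponent : Σ ℕ λ e → ∀ n → needed n ≤ poly e n
    exponent = polyB-bound polyB-needed

  e : ℕ
  e = proj₁ exponent

  open Registers K c e
  open Printing {K} {6} #0 #1 #2

  generator : G 1
  generator = withRegisters (print formula)

  reduction : List Bool → List Bool
  reduction x = ⟦ generator ⟧ (x ∷ [])

  module _ (x : List Bool) where

    n : ℕ
    n = length x

    cN cP : List Bool
    cN = ones (cells x)
    cP = ones (bound x)

    cN≡ : length cN ≡ poly e n
    cN≡ = length-replicate (poly e n)

    cP≡ : length cP ≡ poly c n
    cP≡ = length-replicate (poly c n)

    needed≤ : needed n ≤ length cN
    needed≤ = ≤-trans (proj₂ exponent n) (≤-reflexive (sym cN≡))

    N-positive : 0 < length cN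
    N-positive = ≤-trans (s≤s z≤n) needed≤

    x≤ : length x ≤ length cN
    x≤ = ≤-trans (≤-trans (m≤m+n n _) (n≤1+n _)) needed≤

    P≤ : length cP ≤ length cN
    P≤ = ≤-trans (≤-reflexive cP≡) (≤-trans (≤-trans (m≤m+n (poly c n) _) (≤-trans (m≤n+m _ n) (n≤1+n _))) needed≤)

    time≤ : poly d (tupleBound n (poly c n)) ≤ length cN
    time≤ = ≤-trans (≤-trans (m≤n+m _ (poly c n)) (≤-trans (m≤n+m _ n) (n≤1+n _))) needed≤

    B′ : ℕ
    B′ = (length cN + length cN) + 4

    B≡ : suc B′ ≡ (length cN + length cN) + 5
    B≡ = sym (+-suc (length cN + length cN) 4)

    open Decoding B′ (2 + (suc (TM.nStates V) + nFamilies)) using (positional)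

    base≡ : base x ≡ suc B′
    base≡ = trans (cong (λ m → (m + m) + 5) (sym cN≡)) (sym B≡)

    weights≡ : Correctness.W (tailRegs x) ≡ positional
    weights≡ = trans (cong₂ (λ w₂ w₁ → weights w₂ w₁ (length (ones K))) (length-replicate (base x * (base x * K))) (length-replicate (base x * K)))
      (trans (cong (weights (base x * (base x * K)) (base x * K)) (length-replicate K))
             (cong (λ b → weights (b * (b * K)) (b * K) K) base≡))

    Φ : Fml
    Φ = sem positional formula (mainRegs x)

    reduction≡ : reduction x ≡ enc Φ
    reduction≡ = trans (⟦withRegisters⟧ (print formula) x)
      (trans (Correctness.⟦print⟧ (tailRegs x) formula (mainRegs x)) (cong (λ w → enc (sem w formula (mainRegs x))) weights≡))

    accepts⇒ : ∀ y₁ y₂ y₃ → length y₁ ≤ poly c n → length y₂ ≤ poly c n → length y₃ ≤ poly c n →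
               after V (tuple x y₁ y₂ y₃) (length cN) ≡ after V (tuple x y₁ y₂ y₃) (poly d (length (tuple x y₁ y₂ y₃)))
    accepts⇒ y₁ y₂ y₃ le₁ le₂ le₃ = after-halted V (tuple x y₁ y₂ y₃) (poly d (length (tuple x y₁ y₂ y₃))) (length cN)
      (≤-trans (poly-mono d (length-tuple x y₁ y₂ y₃ le₁ le₂ le₃)) time≤) (halts (tuple x y₁ y₂ y₃))

    ExistsForallExists : Set
    ExistsForallExists = Σ (List Bool) λ y₁ → length y₁ ≤ poly c n ×
      ((y₂ : List Bool) → length y₂ ≤ poly c n → Σ (List Bool) λ y₃ → length y₃ ≤ poly c n × AcceptsP V d (tuple x y₁ y₂ y₃))

    sound : Satisfiable Φ → ExistsForallExists
    sound (W , T , lift (s₀ , t₀) , sat) = y₁ , y₁≤ , λ y₂ le → y₃ y₂ , y₃≤ y₂ ,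
      subst (Accepted V) (accepts⇒ y₁ y₂ (y₃ y₂) y₁≤ le (y₃≤ y₂)) (accepts-all y₂ (≤-trans le (≤-reflexive (sym cP≡))))
      where
      open Reading V positional x cN cP N-positive W T t₀ sat using (y₁; y₃; accepts-all)
      y₁≤ : length y₁ ≤ poly c n
      y₁≤ = ≤-trans (decode-length (length cP) 0 _) (≤-reflexive cP≡)
      y₃≤ : ∀ y₂ → length (y₃ y₂) ≤ poly c n
      y₃≤ y₂ = ≤-trans (decode-length (length cP) 0 _) (≤-reflexive cP≡)

    complete : ExistsForallExists → Satisfiable Φ
    complete (y₁ , y₁≤ , answer) = Build.frame A good , (_≡ root) , lift (root , refl) , Build.formula-sat A good
      where
      -- The answers are extended to all words by a default; the words decoded from streams respect
      -- the bound, so the default never enters a row.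
      y₃ : List Bool → List Bool
      y₃ y₂ with length y₂ ≤? poly c n
      ... | yes le = proj₁ (answer y₂ le)
      ... | no  _  = []
      open Completeness V x cN cP N-positive x≤ P≤ B′ B≡ using (root; module Build)
      open Intended V x cN cP N-positive x≤ P≤ B′ B≡ y₁ y₃

      y₃-good : ∀ y₂ → length y₂ ≤ poly c n → length (y₃ y₂) ≤ poly c n × AcceptsP V d (tuple x y₁ y₂ (y₃ y₂))
      y₃-good y₂ le with length y₂ ≤? poly c n
      ... | yes le′ = proj₂ (answer y₂ le′)
      ... | no  ¬le = ⊥-elim (¬le le)

      accepting-rows : ∀ σ → Accepted V (after V (Row.text σ) (length cN))
      accepting-rows σ = subst (λ w → Accepted V (after V w (length cN))) (sym text≡)
        (subst (Accepted V) (sym (accepts⇒ y₁ y₂ (y₃ y₂) y₁≤ y₂≤ y₃≤)) (proj₂ (y₃-good y₂ y₂≤)))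
        where
        y₂ = decode (length cP) 0 σ
        y₂≤ : length y₂ ≤ poly c n
        y₂≤ = ≤-trans (decode-length (length cP) 0 σ) (≤-reflexive cP≡)
        y₃≤ = proj₁ (y₃-good y₂ y₂≤)
        fits : ∀ y → length y ≤ poly c n → length y ≤ length cP
        fits y le = ≤-trans le (≤-reflexive (sym cP≡))
        text≡ : Row.text σ ≡ tuple x y₁ y₂ (y₃ y₂)
        text≡ = trans (cong₂ (λ a b → segment a (segment b (segment y₂ (segment (decode (length cP) 0 (stream (y₃ y₂))) []))))
                        (decode-stream (length x) x ≤-refl) (decode-stream (length cP) y₁ (fits y₁ y₁≤)))
                      (cong (λ z → segment x (segment y₁ (segment y₂ (segment z [])))) (decode-stream (length cP) (y₃ y₂) (fits (y₃ y₂) y₃≤)))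

      A = Row.assignment
      good = suitable accepting-rows

theorem9 : (M : OpSet) →
    opBox ∈ₒ M → opDia ∈ₒ M → opAnd ∈ₒ M → opNeg ∈ₒ M → opDep ∈ₒ M →
    Sigma3p-hard (MDL3-SAT M)
theorem9 M box∈ dia∈ and∈ neg∈ dep∈ L (V , d , c , halts , L⇔) = reduction , computable generator , λ x → mk⇔ (to x) (from x)
  where
  open Reduction V d c halts
  to : ∀ x → L x → MDL3-SAT M (reduction x)
  to x l = Φ x , lift (sym (reduction≡ x) , sem-good _ M box∈ dia∈ and∈ neg∈ dep∈ (Formula.formula V) _) , complete x (Equivalence.to (L⇔ x) l)
  from : ∀ x → MDL3-SAT M (reduction x) → L x
  from x (φ , lift (e , _) , satisfiable) = Equivalence.from (L⇔ x)
    (sound x (subst Satisfiable (enc-injective φ (Φ x) (trans e (reduction≡ x))) satisfiable))
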